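{- Let $p>3$ be a prime. Then $$\sum_{n=0}^{p-1}\frac{6n+1}{(-512)^n}\binom{2n}{n}^3\equiv p\left(\frac{ -2}{p}\right)+\frac{p^3}{16}E_{p-3}\left(\frac14\right)\pmod{p^4}.$$
   Context: $\left(\frac{\cdot}{p}\right)$ denotes the Legendre symbol. The Euler polynomials $E_n(x)$ are defined by $\frac{2e^{xt}}{e^t+1}=\sum_{n\ge0}E_n(x)\frac{t^n}{n!}$ ($|t|<\pi$). Congruences between rational numbers with denominators coprime to $p$ are understood in the ring of rationals with denominator prime to $p$. -}

module Defs where

open import Data.Bool using (Bool; true; false; if_then_else_; _∨_)
open import Data.Nat as ℕ using (ℕ; zero; suc)
open import Data.Nat.Divisibility using (_∣?_)
open import Data.Nat.Coprimality using (Coprime)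
open import Data.Nat.Combinatorics using (_C_)
open import Data.Integer as ℤ using (ℤ; +_; -[1+_]; ∣_∣)
open import Data.Rational as ℚ using (ℚ; _+_; _*_; _-_; -_; 0ℚ; 1ℚ; _/_)
open import Data.Product using (Σ; _×_)
open import Relation.Binary.PropositionalEquality using (_≡_)
open import Relation.Nullary.Decidable using (does; yes; no)

_^ℚ_ : ℚ → ℕ → ℚ
q ^ℚ zero = 1ℚ
q ^ℚ suc n = q * (q ^ℚ n)

ℕ→ℚ : ℕ → ℚ
ℕ→ℚ n = (+ n) / 1

sumTo : ℕ → (ℕ → ℚ) → ℚ
sumTo zero f = 0ℚ
sumTo (suc m) f = sumTo m f + f m

squareBelow : ℕ → ℤ → ℕ → Bool
squareBelow p a zero = false
squareBelow p a (suc x) =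
  squareBelow p a x ∨ does (p ∣? ∣ (+ x) ℤ.* (+ x) ℤ.- a ∣)

legendre : ℤ → ℕ → ℤ
legendre a p =
  if does (p ∣? ∣ a ∣) then + 0
  else (if squareBelow p a p then + 1 else -[1+ 0 ])

-- Euler polynomials evaluated at x, via the coefficient recursion of
-- 2e^{xt}/(e^t+1) = Σ E_n(x) t^n/n!, i.e. (e^t+1) Σ E_n(x) t^n/n! = 2 e^{xt}:
--   2 E_n(x) + Σ_{k<n} C(n,k) E_k(x) = 2 x^n,
-- so E_n(x) = x^n - (1/2) Σ_{k<n} C(n,k) E_k(x).
-- eulerList x n = [E_{n-1}(x), …, E_0(x)] (most recent first)
eulerUpTo : ℚ → ℕ → (ℕ → ℚ)
-- eulerUpTo x m k = E_k(x) for k < m (junk otherwise)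
eulerUpTo x zero k = 0ℚ
eulerUpTo x (suc m) k with k ℕ.≟ m
... | yes _ =
        (x ^ℚ m) - ((+ 1) / 2) * sumTo m (λ j → ℕ→ℚ (m C j) * eulerUpTo x m j)
... | no _ = eulerUpTo x m k

EulerPoly : ℕ → ℚ → ℚ
EulerPoly n x = eulerUpTo x (suc n) n

CongModIn : ℕ → ℚ → ℚ → ℚ → Set
CongModIn p m a b = Σ ℚ (λ c → Coprime (ℚ.↧ₙ c) p × (a - b ≡ m * c))

{-# OPTIONS --safe #-}

-- The N-th partial sum, cleared of denominators, is the value at s = 0 of a polynomial P s N.
-- As a function of a with s = a², P satisfies a recurrence of step 4 (a WZ pair in a), and the
-- single sum − c N · q satisfies the same one, where c N = ∏ (− (2i+1)) contains the factor p when
-- N = p.  Descending from a = 4N − 4 to 0 shows P 0 N = − c N · q 0; ascending through the odd a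
-- from ± 1 to p evaluates c p · q (p²) in closed form, with sign (−1)^⌊p/4⌋, which is the Legendre
-- symbol of −2.  So modulo p⁴ only the coefficient of s in q modulo p remains.  To find it, run
-- the recurrence at a = 4j + ε in a ring of characteristic p with ε⁴ = 0.  There
-- ∏ (x + ρi) = x^(p−1) − 1 and (n + ε)^p = n collapse its right side to
-- − ε (u^(p−1) + v^(p−1) − 2) with u, v = 4j + 2 ∓ 1 + ε, and the alternating sum over j < p
-- telescopes to 2 ε q(ε²) because a = 4p + ε is a = ε again.  The coefficient of ε³ is an
-- alternating sum of (4j+1)^(p−3), that is − 4^(p−3) E_{p−3}(1/4) modulo p.
module Submission where

open import Defs
open import Algebra.Bundles using (CommutativeRing)
import Algebra.Consequences.Setoid as Consequences
import Algebra.Solver.Ring as RingSolver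
open import Algebra.Solver.Ring.AlmostCommutativeRing
  using (fromCommutativeRing; _-Raw-AlmostCommutative⟶_)
open import Data.Bool using (Bool; true; false; _∨_; if_then_else_)
open import Data.Bool.Properties using (∨-zeroʳ)
open import Data.Integer as ℤ using (ℤ; +_; -[1+_])
import Data.Integer.Divisibility.Signed as Signed
import Data.Integer.Properties as ℤₚ
open import Data.Maybe.Base using (Maybe; just; nothing)
open import Data.Nat as ℕ using (ℕ; zero; suc; _<_; _≤_; _∸_; s≤s; z≤n; _!)
open import Data.Nat.Combinatorics using (_C_; nCn≡1; k![n∸k]!∣n!; nCk+nC[k+1]≡[n+1]C[k+1])
open import Data.Nat.Combinatorics.Specification using (nCk≡n!/k![n-k]!; k>n⇒nCk≡0)
open import Data.Nat.Coprimality as Coprimality using (Coprime; coprime-Bézout; coprime-divisor)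
open import Data.Nat.Divisibility using (_∣_; _∤_; divides; ∣⇒≤; m∣m*n; _∣?_; ∣-trans)
open import Data.Nat.DivMod using (_%_; m/n*n≡m; m≡m%n+[m/n]*n; m%n<n)
open import Data.Nat.GCD using (module Bézout)
open import Data.Nat.Primality using (Prime; euclidsLemma; prime⇒irreducible; prime⇒nonTrivial)
import Data.Nat.Properties as ℕₚ
import Data.Nat.Tactic.RingSolver as ℕ-solver
open import Data.Product using (Σ; _×_; _,_; proj₁; proj₂)
open import Data.Rational as ℚ using (ℚ; mkℚ; _/_; toℚᵘ)
import Data.Rational.Properties as ℚₚ
open import Data.Rational.Unnormalised as ℚᵘ using (mkℚᵘ; *≡*) renaming (_≃_ to _≃ᵘ_)
import Data.Rational.Unnormalised.Properties as ℚᵘₚ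
open import Data.Sum using (_⊎_; inj₁; inj₂)
open import Data.Vec.Base using (Vec; []; _∷_; replicate)
open import Level using (0ℓ)
open import Relation.Binary.Bundles using (Setoid)
open import Relation.Binary.PropositionalEquality as ≡ using (_≡_; _≢_)
import Relation.Binary.Reasoning.Setoid as SetoidReasoning
open import Relation.Binary.Structures using (IsEquivalence)
open import Relation.Nullary using (yes; no; contradiction)
open import Relation.Nullary.Decidable using (does; dec-true; dec-false)

-- With s = a², `P s N` over its denominator is the partial sum of (6n+1) (-1/8)^n (1/2)_n
-- ((1-a)/2)_n ((1+a)/2)_n / (n! (1-a/4)_n (1+a/4)_n), a deformation of the given series. The
-- recurrence for `q` has the source term -2b e(b²), which vanishes at small odd b. There it is
-- homogeneous and, up to alternating signs, solved by a ∏ 4i(16i² - a²); this is the origin of the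
-- closed form at a = p. The wanted value is at s = 0, not at s = p². Moving from p² to 0 changes
-- `q` by its linear coefficient times p², and the factor p of `c p` turns this into the p³ term.
-- The denominator moves too, but the linear coefficient of ∏ (16i² - s) is divisible by p, so it
-- stays the same modulo p³. Multiplied by ε, the even function q(ε²) becomes odd and shows its
-- linear coefficient at ε³; this dictates ε⁴ = 0. The collapse by Frobenius rests on ε^(p-1) = 0,
-- and this is where p ≥ 5 enters.

record ℤ-Algebra : Set₁ where
  field
    commutativeRing : CommutativeRing 0ℓ 0ℓ
  open CommutativeRing commutativeRing
  field
    -- A field rather than the canonical map: it is the identity for ℤ and `z / 1` for ℚ, so
    -- literals keep their usual form there.
    ι      : ℤ → Carrier
    ι-+    : ∀ a b → ι (a ℤ.+ b) ≈ ι a + ι b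
    ι-*    : ∀ a b → ι (a ℤ.* b) ≈ ι a * ι b
    ι-neg  : ∀ a → ι (ℤ.- a) ≈ - ι a
    ι-0    : ι (+ 0) ≈ 0#
    ι-1    : ι (+ 1) ≈ 1#

-- Notation over a ring with a map from ℤ

module Over (A : ℤ-Algebra) where
  open ℤ-Algebra A public
  open CommutativeRing commutativeRing public
    using (Carrier; _≈_; _+_; _*_; -_; _-_; setoid; refl; sym; trans;
           +-cong; +-congˡ; +-congʳ; *-cong; *-congˡ; *-congʳ; -‿cong; reflexive)
  open SetoidReasoning setoid public

  private
    coeff≟ : (a b : ℤ) → Maybe (ι a ≈ ι b)
    coeff≟ a b with a ℤ.≟ b
    ... | yes a≡b = just (reflexive (≡.cong ι a≡b))
    ... | no _    = nothing

    morphism : ℤ.+-*-rawRing -Raw-AlmostCommutative⟶ fromCommutativeRing commutativeRing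
    morphism = record { ⟦_⟧ = ι ; +-homo = ι-+ ; *-homo = ι-* ; -‿homo = ι-neg
                      ; 0-homo = ι-0 ; 1-homo = ι-1 }

  module Solver = RingSolver ℤ.+-*-rawRing (fromCommutativeRing commutativeRing) morphism coeff≟
  open Solver public using (solve; _:=_; _:+_; _:*_; _:-_; :-_; con; Polynomial)

  :n : ∀ {m} → ℕ → Polynomial m
  :n k = con (+ k)

  -‿cong₂ : ∀ {a b c d} → a ≈ b → c ≈ d → a - c ≈ b - d
  -‿cong₂ p q = +-cong p (-‿cong q)

  -- ν n is the image of n, by recursion so that ν (suc n) unfolds.  Literals are written ι (+ n),
  -- also for 0 and 1: the solver then reads them as constants.
  ν : ℕ → Carrier
  ν zero    = ι (+ 0)
  ν (suc n) = ν n + ι (+ 1)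

  ν≈ι : ∀ n → ν n ≈ ι (+ n)
  ν≈ι zero    = refl
  ν≈ι (suc n) = trans (+-congʳ (ν≈ι n))
    (trans (sym (ι-+ (+ n) (+ 1))) (reflexive (≡.cong (λ k → ι (+ k)) (ℕₚ.+-comm n 1))))

  ∑ ∏ : ℕ → (ℕ → Carrier) → Carrier
  ∑ zero    f = ι (+ 0)
  ∑ (suc n) f = ∑ n f + f n
  ∏ zero    f = ι (+ 1)
  ∏ (suc n) f = ∏ n f * f n

  infixr 8 _^_
  _^_ : Carrier → ℕ → Carrier
  x ^ zero  = ι (+ 1)
  x ^ suc n = x * x ^ n

  ∑-cong : ∀ n {f g} → (∀ i → i < n → f i ≈ g i) → ∑ n f ≈ ∑ n g
  ∑-cong zero    _ = refl
  ∑-cong (suc n) h = +-cong (∑-cong n (λ i i<n → h i (ℕₚ.m<n⇒m<1+n i<n))) (h n ℕₚ.≤-refl)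

  ∏-cong : ∀ n {f g} → (∀ i → i < n → f i ≈ g i) → ∏ n f ≈ ∏ n g
  ∏-cong zero    _ = refl
  ∏-cong (suc n) h = *-cong (∏-cong n (λ i i<n → h i (ℕₚ.m<n⇒m<1+n i<n))) (h n ℕₚ.≤-refl)

  ^-cong : ∀ n {x y} → x ≈ y → x ^ n ≈ y ^ n
  ^-cong zero    _ = refl
  ^-cong (suc n) h = *-cong h (^-cong n h)

  odd : ℕ → Carrier
  odd i = ι (+ 2) * ν i + ι (+ 1)

  :odd : ∀ {m} → Polynomial m → Polynomial m
  :odd n = :n 2 :* n :+ :n 1

  -- The polynomials in s = a² and their recurrences in a

  e : ℕ → Carrier → Carrier
  e k s = ∏ k (λ i → odd i * odd i - s)

  e-cong : ∀ k {s t} → s ≈ t → e k s ≈ e k t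
  e-cong k s≈t = ∏-cong k (λ _ _ → -‿cong₂ refl s≈t)

  c : ℕ → Carrier
  c n = ∏ n (λ i → - odd i)

  -- Unrolled: the sum over j < k of `e j s` times the product of -4i(X+1-2i) over j < i < k. `X`
  -- stays free because the recurrence in b holds for all `X`; comparison with `P` fixes it as 4N -
  -- 2.
  q : Carrier → Carrier → ℕ → Carrier
  q X s zero    = ι (+ 0)
  q X s (suc k) = q X s k * (- (ι (+ 4) * ν k) * (X + ι (+ 1) - ι (+ 2) * ν k)) + e k s

  -- Unrolled: the sum over n < N of (6n+1) `c n` `e n s` times the product of 4i(16i² - s) over n <
  -- i < N.
  P : Carrier → ℕ → Carrier
  P s zero    = ι (+ 0)
  P s (suc n) = P s n * (ι (+ 4) * ν n * (ι (+ 16) * (ν n * ν n) - s))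
              + (ι (+ 6) * ν n + ι (+ 1)) * c n * e n s

  q-cong : ∀ {X Y s t} k → X ≈ Y → s ≈ t → q X s k ≈ q Y t k
  q-cong zero    _ _ = refl
  q-cong (suc k) X≈Y s≈t = +-cong (*-cong (q-cong k X≈Y s≈t)
    (*-congˡ (+-congʳ (+-congʳ X≈Y)))) (e-cong k s≈t)

  sq⁺ sq⁻ : Carrier → Carrier
  sq⁺ b = (b + ι (+ 2)) * (b + ι (+ 2))
  sq⁻ b = (b - ι (+ 2)) * (b - ι (+ 2))

  -- Since (2i+1)² - (b+2)² = (2i-1-b)(2i+3+b), passing from b to b+2 shifts both strings of linear
  -- factors by one index, and only the end factors differ.
  e-shift⁺ : ∀ n b → e (suc n) (sq⁺ b) ≈
    - ((odd n + b) * (odd (suc n) + b)) * e n (b * b)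
  e-shift⁺ zero b = solve 1 (λ b → :n 1 :* (:odd (:n 0) :* :odd (:n 0) :- (b :+ :n 2) :* (b :+ :n 2))
    := :- ((:odd (:n 0) :+ b) :* (:odd (:n 0 :+ :n 1) :+ b)) :* :n 1) refl b
  e-shift⁺ (suc n) b = begin
    e (suc n) (sq⁺ b) * (odd (suc n) * odd (suc n) - sq⁺ b)
      ≈⟨ *-congʳ (e-shift⁺ n b) ⟩
    - ((odd n + b) * (odd (suc n) + b)) * e n (b * b) * (odd (suc n) * odd (suc n) - sq⁺ b)
      ≈⟨ solve 3 (λ n b E →
           :- ((:odd n :+ b) :* (:odd (n :+ :n 1) :+ b)) :* E
             :* (:odd (n :+ :n 1) :* :odd (n :+ :n 1) :- (b :+ :n 2) :* (b :+ :n 2))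
           := :- ((:odd (n :+ :n 1) :+ b) :* (:odd (n :+ :n 1 :+ :n 1) :+ b))
             :* (E :* (:odd n :* :odd n :- b :* b))) refl (ν n) b (e n (b * b)) ⟩
    - ((odd (suc n) + b) * (odd (suc (suc n)) + b)) * e (suc n) (b * b) ∎

  e-shift⁻ : ∀ n b → e (suc n) (sq⁻ b) ≈
    - ((odd n - b) * (odd (suc n) - b)) * e n (b * b)
  e-shift⁻ n b = begin
    e (suc n) (sq⁻ b)
      ≈⟨ e-cong (suc n) (solve 1 (λ b → (b :- :n 2) :* (b :- :n 2)
           := (:- b :+ :n 2) :* (:- b :+ :n 2)) refl b) ⟩
    e (suc n) (sq⁺ (- b))
      ≈⟨ e-shift⁺ n (- b) ⟩
    - ((odd n - b) * (odd (suc n) - b)) * e n (- b * - b)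
      ≈⟨ *-congˡ (e-cong n (solve 1 (λ b → :- b :* :- b := b :* b) refl b)) ⟩
    - ((odd n - b) * (odd (suc n) - b)) * e n (b * b) ∎

  -- The multiplier `f` that extends `q` by one index does not involve s, so the recurrence at k is
  -- merely scaled by it; the two new `e` terms are multiples of the same `e k (b * b)` by the shift
  -- lemmas.
  q-recurrence : ∀ X b k →
    (X - b) * q X (sq⁺ b) (suc k) - (X + b) * q X (sq⁻ b) (suc k)
      ≈ - (ι (+ 2) * b * e k (b * b))
  q-recurrence X b zero = solve 2 (λ X b →
      (X :- b) :* (:n 0 :* (:- (:n 4 :* :n 0) :* (X :+ :n 1 :- :n 2 :* :n 0)) :+ :n 1)
      :- (X :+ b) :* (:n 0 :* (:- (:n 4 :* :n 0) :* (X :+ :n 1 :- :n 2 :* :n 0)) :+ :n 1)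
    := :- (:n 2 :* b :* :n 1)) refl X b
  q-recurrence X b (suc k) = begin
    (X - b) * (q⁺ * f + e (suc k) (sq⁺ b)) - (X + b) * (q⁻ * f + e (suc k) (sq⁻ b))
      ≈⟨ -‿cong₂ (*-congˡ (+-congˡ (e-shift⁺ k b))) (*-congˡ (+-congˡ (e-shift⁻ k b))) ⟩
    (X - b) * (q⁺ * f + - ((odd k + b) * (odd (suc k) + b)) * E)
      - (X + b) * (q⁻ * f + - ((odd k - b) * (odd (suc k) - b)) * E)
      ≈⟨ solve 8 (λ X b q⁺ q⁻ f E n₁ n₂ →
           (X :- b) :* (q⁺ :* f :+ :- ((n₁ :+ b) :* (n₂ :+ b)) :* E)
             :- (X :+ b) :* (q⁻ :* f :+ :- ((n₁ :- b) :* (n₂ :- b)) :* E)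
           := ((X :- b) :* q⁺ :- (X :+ b) :* q⁻) :* f
             :+ ((X :- b) :* :- ((n₁ :+ b) :* (n₂ :+ b))
                 :- (X :+ b) :* :- ((n₁ :- b) :* (n₂ :- b))) :* E)
           refl X b q⁺ q⁻ f E (odd k) (odd (suc k)) ⟩
    ((X - b) * q⁺ - (X + b) * q⁻) * f
      + ((X - b) * - ((odd k + b) * (odd (suc k) + b))
         - (X + b) * - ((odd k - b) * (odd (suc k) - b))) * E
      ≈⟨ +-congʳ (*-congʳ (q-recurrence X b k)) ⟩
    - (ι (+ 2) * b * E) * f
      + ((X - b) * - ((odd k + b) * (odd (suc k) + b))
         - (X + b) * - ((odd k - b) * (odd (suc k) - b))) * E
      ≈⟨ solve 4 (λ X b n E →
           :- (:n 2 :* b :* E) :* (:- (:n 4 :* (n :+ :n 1)) :* (X :+ :n 1 :- :n 2 :* (n :+ :n 1)))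
           :+ ((X :- b) :* :- ((:odd n :+ b) :* (:odd (n :+ :n 1) :+ b))
               :- (X :+ b) :* :- ((:odd n :- b) :* (:odd (n :+ :n 1) :- b))) :* E
           := :- (:n 2 :* b :* (E :* (:odd n :* :odd n :- b :* b)))) refl X b (ν k) E ⟩
    - (ι (+ 2) * b * e (suc k) (b * b)) ∎
    where
    q⁺ = q X (sq⁺ b) (suc k)
    q⁻ = q X (sq⁻ b) (suc k)
    f  = - (ι (+ 4) * ν (suc k)) * (X + ι (+ 1) - ι (+ 2) * ν (suc k))
    E  = e k (b * b)

  -- Let m = k+1, X = 4m-2 and X′ = 4m+2. Then 16m² - (b+2)² = (X-b)(X′+b) and 16m² - (b-2)² =
  -- (X+b)(X′-b), so the weights at X′ become those at X times the common factor X′² - b².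
  P-recurrence : ∀ b k → let X = ι (+ 4) * ν (suc k) - ι (+ 2) in
    (X - b) * P (sq⁺ b) (suc k) - (X + b) * P (sq⁻ b) (suc k)
      ≈ ι (+ 2) * b * c (suc k) * e k (b * b)
  P-recurrence b zero = solve 1 (λ b →
      let p₁ = λ s → :n 0 :* (:n 4 :* :n 0 :* (:n 16 :* (:n 0 :* :n 0) :- s))
                 :+ (:n 6 :* :n 0 :+ :n 1) :* :n 1 :* :n 1
          X  = :n 4 :* (:n 0 :+ :n 1) :- :n 2 in
      (X :- b) :* p₁ ((b :+ :n 2) :* (b :+ :n 2)) :- (X :+ b) :* p₁ ((b :- :n 2) :* (b :- :n 2))
      := :n 2 :* b :* (:n 1 :* :- :odd (:n 0)) :* :n 1) refl b
  P-recurrence b (suc k) = begin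
    (X′ - b) * (P⁺ * f (sq⁺ b) + w * e (suc k) (sq⁺ b))
      - (X′ + b) * (P⁻ * f (sq⁻ b) + w * e (suc k) (sq⁻ b))
      ≈⟨ -‿cong₂ (*-congˡ (+-congˡ (*-congˡ (e-shift⁺ k b))))
                 (*-congˡ (+-congˡ (*-congˡ (e-shift⁻ k b)))) ⟩
    (X′ - b) * (P⁺ * f (sq⁺ b) + w * (- ((odd k + b) * (odd (suc k) + b)) * E))
      - (X′ + b) * (P⁻ * f (sq⁻ b) + w * (- ((odd k - b) * (odd (suc k) - b)) * E))
      ≈⟨ solve 6 (λ n b P⁺ P⁻ w E →
           let m  = n :+ :n 1
               X  = :n 4 :* m :- :n 2
               X′ = :n 4 :* (m :+ :n 1) :- :n 2
               f  = λ s → :n 4 :* m :* (:n 16 :* (m :* m) :- s) in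
           (X′ :- b) :* (P⁺ :* f ((b :+ :n 2) :* (b :+ :n 2))
               :+ w :* (:- ((:odd n :+ b) :* (:odd m :+ b)) :* E))
             :- (X′ :+ b) :* (P⁻ :* f ((b :- :n 2) :* (b :- :n 2))
               :+ w :* (:- ((:odd n :- b) :* (:odd m :- b)) :* E))
           := ((X :- b) :* P⁺ :- (X :+ b) :* P⁻) :* (:n 4 :* m :* (X′ :* X′ :- b :* b))
             :+ ((X′ :- b) :* :- ((:odd n :+ b) :* (:odd m :+ b))
                 :- (X′ :+ b) :* :- ((:odd n :- b) :* (:odd m :- b))) :* E :* w)
           refl (ν k) b P⁺ P⁻ w E ⟩
    ((X - b) * P⁺ - (X + b) * P⁻) * (ι (+ 4) * ν (suc k) * (X′ * X′ - b * b))
      + ((X′ - b) * - ((odd k + b) * (odd (suc k) + b))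
         - (X′ + b) * - ((odd k - b) * (odd (suc k) - b))) * E * w
      ≈⟨ +-congʳ (*-congʳ (P-recurrence b k)) ⟩
    ι (+ 2) * b * c (suc k) * E * (ι (+ 4) * ν (suc k) * (X′ * X′ - b * b))
      + ((X′ - b) * - ((odd k + b) * (odd (suc k) + b))
         - (X′ + b) * - ((odd k - b) * (odd (suc k) - b))) * E * w
      ≈⟨ solve 4 (λ n b Γ E →
           let m  = n :+ :n 1
               X′ = :n 4 :* (m :+ :n 1) :- :n 2 in
           :n 2 :* b :* Γ :* E :* (:n 4 :* m :* (X′ :* X′ :- b :* b))
           :+ ((X′ :- b) :* :- ((:odd n :+ b) :* (:odd m :+ b))
               :- (X′ :+ b) :* :- ((:odd n :- b) :* (:odd m :- b))) :* E
             :* ((:n 6 :* m :+ :n 1) :* Γ)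
           := :n 2 :* b :* (Γ :* :- :odd m) :* (E :* (:odd n :* :odd n :- b :* b)))
           refl (ν k) b (c (suc k)) E ⟩
    ι (+ 2) * b * c (suc (suc k)) * e (suc k) (b * b) ∎
    where
    X  = ι (+ 4) * ν (suc k) - ι (+ 2)
    X′ = ι (+ 4) * ν (suc (suc k)) - ι (+ 2)
    P⁺ = P (sq⁺ b) (suc k)
    P⁻ = P (sq⁻ b) (suc k)
    f  = λ s → ι (+ 4) * ν (suc k) * (ι (+ 16) * (ν (suc k) * ν (suc k)) - s)
    w  = (ι (+ 6) * ν (suc k) + ι (+ 1)) * c (suc k)
    E  = e k (b * b)

ℤ-algebra : ℤ-Algebra
ℤ-algebra = record
  { commutativeRing = ℤₚ.+-*-commutativeRing ; ι = λ z → z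
  ; ι-+ = λ _ _ → ≡.refl ; ι-* = λ _ _ → ≡.refl ; ι-neg = λ _ → ≡.refl
  ; ι-0 = ≡.refl ; ι-1 = ≡.refl }

-- Product identities and the initial value at a = 1

module Products (A : ℤ-Algebra) where
  open Over A

  ∏-* : ∀ n f g → ∏ n (λ i → f i * g i) ≈ ∏ n f * ∏ n g
  ∏-* zero    f g = solve 0 (:n 1 := :n 1 :* :n 1) refl
  ∏-* (suc n) f g = trans (*-congʳ (∏-* n f g))
    (solve 4 (λ a b c d → a :* b :* (c :* d) := a :* c :* (b :* d)) refl _ _ _ _)

  ∏-zero : ∀ n f j → j < n → f j ≈ ι (+ 0) → ∏ n f ≈ ι (+ 0)
  ∏-zero (suc n) f j j<1+n fj≈0 with j ℕ.≟ n
  ... | yes ≡.refl = trans (*-congˡ fj≈0) (solve 1 (λ x → x :* :n 0 := :n 0) refl _)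
  ... | no  j≢n    = trans (*-congʳ (∏-zero n f j (ℕₚ.≤∧≢⇒< (ℕₚ.≤-pred j<1+n) j≢n) fj≈0))
                       (solve 1 (λ x → :n 0 :* x := :n 0) refl _)

  e-zero : ∀ k j → j < k → e k (odd j * odd j) ≈ ι (+ 0)
  e-zero k j j<k = ∏-zero k _ j j<k (solve 1 (λ x → x :- x := :n 0) refl _)

  -- At s = 0 this clears the denominators of the (k+1)-st partial sum.
  D : ℕ → Carrier → Carrier
  D k s = ∏ k (λ i → ι (+ 4) * ν (suc i) * (ι (+ 16) * (ν (suc i) * ν (suc i)) - s))

  -- The factors (4i-a)(4i+a) telescope when a moves by 4. Up to a sign, a `D k (a²)` thus obeys the
  -- homogeneous part of `q-recurrence`.
  D-recurrence : ∀ k b → let X = ι (+ 4) * ν (suc k) - ι (+ 2) in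
    (X - b) * ((b + ι (+ 2)) * D k (sq⁺ b)) ≈ - ((X + b) * ((b - ι (+ 2)) * D k (sq⁻ b)))
  D-recurrence zero b = solve 1 (λ b →
    let X = :n 4 :* (:n 0 :+ :n 1) :- :n 2 in
    (X :- b) :* ((b :+ :n 2) :* :n 1) := :- ((X :+ b) :* ((b :- :n 2) :* :n 1))) refl b
  D-recurrence (suc k) b = begin
    (X′ - b) * ((b + ι (+ 2)) * (D⁺ * f (sq⁺ b)))
      ≈⟨ solve 3 (λ n b D → let m = n :+ :n 1
                                X = :n 4 :* m :- :n 2
                                X′ = :n 4 :* (m :+ :n 1) :- :n 2
                                f  = λ s → :n 4 :* m :* (:n 16 :* (m :* m) :- s) in
           (X′ :- b) :* ((b :+ :n 2) :* (D :* f ((b :+ :n 2) :* (b :+ :n 2))))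
           := (X :- b) :* ((b :+ :n 2) :* D) :* (:n 4 :* m :* (X′ :+ b) :* (X′ :- b)))
           refl (ν k) b D⁺ ⟩
    (X - b) * ((b + ι (+ 2)) * D⁺) * (ι (+ 4) * ν (suc k) * (X′ + b) * (X′ - b))
      ≈⟨ *-congʳ (D-recurrence k b) ⟩
    - ((X + b) * ((b - ι (+ 2)) * D⁻)) * (ι (+ 4) * ν (suc k) * (X′ + b) * (X′ - b))
      ≈⟨ solve 3 (λ n b D → let m = n :+ :n 1
                                X = :n 4 :* m :- :n 2
                                X′ = :n 4 :* (m :+ :n 1) :- :n 2
                                f  = λ s → :n 4 :* m :* (:n 16 :* (m :* m) :- s) in
           :- ((X :+ b) :* ((b :- :n 2) :* D)) :* (:n 4 :* m :* (X′ :+ b) :* (X′ :- b))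
           := :- ((X′ :+ b) :* ((b :- :n 2) :* (D :* f ((b :- :n 2) :* (b :- :n 2))))))
           refl (ν k) b D⁻ ⟩
    - ((X′ + b) * ((b - ι (+ 2)) * (D⁻ * f (sq⁻ b)))) ∎
    where
    X  = ι (+ 4) * ν (suc k) - ι (+ 2)
    X′ = ι (+ 4) * ν (suc (suc k)) - ι (+ 2)
    D⁺ = D k (sq⁺ b)
    D⁻ = D k (sq⁻ b)
    f  = λ s → ι (+ 4) * ν (suc k) * (ι (+ 16) * (ν (suc k) * ν (suc k)) - s)

  -- The left factor runs 2M-1, 2M-3, ..., 2m+1: exactly the odd numbers missing from `∏ m odd`.
  ∏-odd-descending : ∀ d m M → ν M ≈ ν m + ν d → m ℕ.+ d ≡ M →
    ∏ d (λ i → ι (+ 2) * ν M - ι (+ 1) - ι (+ 2) * ν i) * ∏ m odd ≈ ∏ M odd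
  ∏-odd-descending zero m M _ m≡M = trans (solve 1 (λ x → :n 1 :* x := x) refl _)
    (reflexive (≡.cong (λ k → ∏ k odd) (≡.trans (≡.sym (ℕₚ.+-identityʳ m)) m≡M)))
  ∏-odd-descending (suc d) m M νM m+d≡M = begin
    R * (ι (+ 2) * ν M - ι (+ 1) - ι (+ 2) * ν d) * ∏ m odd
      ≈⟨ *-congʳ (*-congˡ (+-congʳ (+-congʳ (*-congˡ νM)))) ⟩
    R * (ι (+ 2) * (ν m + ν (suc d)) - ι (+ 1) - ι (+ 2) * ν d) * ∏ m odd
      ≈⟨ solve 4 (λ m d R O → R :* (:n 2 :* (m :+ (d :+ :n 1)) :- :n 1 :- :n 2 :* d) :* O
                   := R :* (O :* :odd m)) refl (ν m) (ν d) R (∏ m odd) ⟩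
    R * ∏ (suc m) odd
      ≈⟨ ∏-odd-descending d (suc m) M
           (trans νM (solve 2 (λ m d → m :+ (d :+ :n 1) := m :+ :n 1 :+ d) refl _ _))
           (≡.trans (≡.sym (ℕₚ.+-suc m d)) m+d≡M) ⟩
    ∏ M odd ∎
    where R = ∏ d (λ i → ι (+ 2) * ν M - ι (+ 1) - ι (+ 2) * ν i)

  ν-+ : ∀ m n → ν (m ℕ.+ n) ≈ ν m + ν n
  ν-+ zero    n = solve 1 (λ x → x := :n 0 :+ x) refl _
  ν-+ (suc m) n = trans (+-congʳ (ν-+ m n))
    (solve 2 (λ m n → m :+ n :+ :n 1 := m :+ :n 1 :+ n) refl _ _)

  ν-* : ∀ m n → ν (m ℕ.* n) ≈ ν m * ν n
  ν-* zero    n = solve 1 (λ x → :n 0 := :n 0 :* x) refl _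
  ν-* (suc m) n = trans (ν-+ n (m ℕ.* n)) (trans (+-congˡ (ν-* m n))
    (solve 2 (λ m n → n :+ m :* n := (m :+ :n 1) :* n) refl _ _))

  -- After the leading 1, consecutive odd numbers pair up as (4i-1)(4i+1).
  ∏-odd-pairs : ∀ k → ∏ (suc (k ℕ.+ k)) odd ≈
    ∏ k (λ i → ι (+ 16) * (ν (suc i) * ν (suc i)) - ι (+ 1))
  ∏-odd-pairs zero = solve 0 (:n 1 :* :odd (:n 0) := :n 1) refl
  ∏-odd-pairs (suc k) = begin
    ∏ (suc (k ℕ.+ suc k)) odd * odd (suc (k ℕ.+ suc k))
      ≡⟨ ≡.cong (λ j → ∏ (suc j) odd * odd (suc j)) (ℕₚ.+-suc k k) ⟩
    ∏ (suc (k ℕ.+ k)) odd * odd (suc (k ℕ.+ k)) * odd (suc (suc (k ℕ.+ k)))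
      ≈⟨ *-cong (*-cong (∏-odd-pairs k) (+-congʳ (*-congˡ (+-congʳ (ν-+ k k)))))
                (+-congʳ (*-congˡ (+-congʳ (+-congʳ (ν-+ k k))))) ⟩
    R * (ι (+ 2) * (ν k + ν k + ι (+ 1)) + ι (+ 1))
      * (ι (+ 2) * (ν k + ν k + ι (+ 1) + ι (+ 1)) + ι (+ 1))
      ≈⟨ solve 2 (λ k R → R :* :odd (k :+ k :+ :n 1) :* :odd (k :+ k :+ :n 1 :+ :n 1)
           := R :* (:n 16 :* ((k :+ :n 1) :* (k :+ :n 1)) :- :n 1)) refl (ν k) R ⟩
    R * (ι (+ 16) * (ν (suc k) * ν (suc k)) - ι (+ 1)) ∎
    where R = ∏ k (λ i → ι (+ 16) * (ν (suc i) * ν (suc i)) - ι (+ 1))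

  c-signs : ∀ k (g h : ℕ → Carrier) →
    c (suc k) * ∏ k (λ i → - g i * h i) ≈ - (∏ k g * (∏ k h * ∏ (suc k) odd))
  c-signs zero g h = solve 0 (:n 1 :* :- :odd (:n 0) :* :n 1
    := :- (:n 1 :* (:n 1 :* (:n 1 :* :odd (:n 0))))) refl
  c-signs (suc k) g h = begin
    c (suc k) * - odd (suc k) * (R * (- g k * h k))
      ≈⟨ solve 5 (λ Γ o R g h → Γ :* :- o :* (R :* (:- g :* h)) := Γ :* R :* (o :* g :* h))
           refl _ _ _ _ _ ⟩
    c (suc k) * R * (odd (suc k) * g k * h k)
      ≈⟨ *-congʳ (c-signs k g h) ⟩
    - (∏ k g * (∏ k h * ∏ (suc k) odd)) * (odd (suc k) * g k * h k)
      ≈⟨ solve 6 (λ G H O o g h → :- (G :* (H :* O)) :* (o :* g :* h)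
           := :- (G :* g :* (H :* h :* (O :* o)))) refl _ _ _ _ _ _ ⟩
    - (∏ (suc k) g * (∏ (suc k) h * ∏ (suc (suc k)) odd)) ∎
    where R = ∏ k (λ i → - g i * h i)

  e-one : ∀ k → e (suc k) (ι (+ 1)) ≈ ι (+ 0)
  e-one k = ∏-zero (suc k) _ 0 (s≤s z≤n)
    (solve 0 (:odd (:n 0) :* :odd (:n 0) :- :n 1 := :n 0) refl)

  -- At s = 1 the first factor of `e j` is 1 - 1, so only the summand of `e 0` survives and the sum
  -- becomes a single product.
  q-one : ∀ X k → q X (ι (+ 1)) (suc k) ≈
    ∏ k (λ i → - (ι (+ 4) * ν (suc i)) * (X + ι (+ 1) - ι (+ 2) * ν (suc i)))
  q-one X zero = solve 1 (λ X → :n 0 :* (:- (:n 4 :* :n 0) :* (X :+ :n 1 :- :n 2 :* :n 0)) :+ :n 1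
    := :n 1) refl X
  q-one X (suc k) = trans (+-cong (*-congʳ (q-one X k)) (e-one k))
    (solve 1 (λ x → x :+ :n 0 := x) refl _)

  -- Initial value for the ascent from both a = 1 and a = -1. With X = 4k+2 the factors X+1-2i
  -- descend from 4k+1 to 2k+3; together with the odd numbers 1, ..., 2k+1 in `c` they give the
  -- first 2k+1 odd numbers, which pair to ∏ (16i² - 1).
  D-one : ∀ k → - (c (suc k) * q (ι (+ 4) * ν (suc k) - ι (+ 2)) (ι (+ 1)) (suc k)) ≈ D k (ι (+ 1))
  D-one k = begin
    - (c (suc k) * q X (ι (+ 1)) (suc k))
      ≈⟨ -‿cong (*-congˡ (q-one X k)) ⟩
    - (c (suc k) * ∏ k (λ i → - (ι (+ 4) * ν (suc i)) * (X + ι (+ 1) - ι (+ 2) * ν (suc i))))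
      ≈⟨ -‿cong (c-signs k (λ i → ι (+ 4) * ν (suc i)) _) ⟩
    - - (J * (∏ k (λ i → X + ι (+ 1) - ι (+ 2) * ν (suc i)) * ∏ (suc k) odd))
      ≈⟨ solve 1 (λ x → :- :- x := x) refl _ ⟩
    J * (∏ k (λ i → X + ι (+ 1) - ι (+ 2) * ν (suc i)) * ∏ (suc k) odd)
      ≈⟨ *-congˡ (*-congʳ (∏-cong k (λ i _ → begin
           X + ι (+ 1) - ι (+ 2) * ν (suc i)
             ≈⟨ solve 2 (λ k i → :n 4 :* (k :+ :n 1) :- :n 2 :+ :n 1 :- :n 2 :* (i :+ :n 1)
                  := :n 2 :* (k :+ :n 1 :+ k) :- :n 1 :- :n 2 :* i) refl (ν k) (ν i) ⟩
           ι (+ 2) * (ν (suc k) + ν k) - ι (+ 1) - ι (+ 2) * ν i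
             ≈⟨ +-congʳ (+-congʳ (*-congˡ (sym (ν-+ (suc k) k)))) ⟩
           ι (+ 2) * ν (suc k ℕ.+ k) - ι (+ 1) - ι (+ 2) * ν i ∎))) ⟩
    J * (∏ k (λ i → ι (+ 2) * ν (suc k ℕ.+ k) - ι (+ 1) - ι (+ 2) * ν i) * ∏ (suc k) odd)
      ≈⟨ *-congˡ (∏-odd-descending k (suc k) (suc k ℕ.+ k) (ν-+ (suc k) k) ≡.refl) ⟩
    J * ∏ (suc k ℕ.+ k) odd
      ≈⟨ *-congˡ (∏-odd-pairs k) ⟩
    J * ∏ k (λ i → ι (+ 16) * (ν (suc i) * ν (suc i)) - ι (+ 1))
      ≈⟨ ∏-* k _ _ ⟨
    D k (ι (+ 1)) ∎
    where X = ι (+ 4) * ν (suc k) - ι (+ 2)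
          J = ∏ k (λ i → ι (+ 4) * ν (suc i))

-- Exact evaluations over ℤ

sgn : ℕ → ℤ
sgn zero    = + 1
sgn (suc n) = ℤ.- sgn n

module Evaluation where
  open Over ℤ-algebra
  open Products ℤ-algebra

  *-cancel-0 : ∀ {i j} → i ≢ + 0 → i * j ≡ + 0 → j ≡ + 0
  *-cancel-0 {i} i≢0 ij≡0 with ℤₚ.i*j≡0⇒i≡0∨j≡0 i ij≡0
  ... | inj₁ i≡0 = contradiction i≡0 i≢0
  ... | inj₂ j≡0 = j≡0

  +suc≢0 : ∀ {i} n → i ≡ + suc n → i ≢ + 0
  +suc≢0 n ≡.refl ()

  top : ℕ → ℤ
  top k = + 4 * ν (suc k) - + 2

  defect : ℕ → ℤ → ℤ
  defect k s = P s (suc k) + c (suc k) * q (top k) s (suc k)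

  -- Scaling `q` by `c (suc k)` makes the two source terms opposite, so they cancel in the sum.
  defect-recurrence : ∀ k b →
    (top k - b) * defect k (sq⁺ b) ≡ (top k + b) * defect k (sq⁻ b)
  defect-recurrence k b = begin
    (X - b) * (P⁺ + Γ * q⁺)
      ≡⟨ solve 7 (λ X b P⁺ P⁻ Γ q⁺ q⁻ → (X :- b) :* (P⁺ :+ Γ :* q⁺) :=
           ((X :- b) :* P⁺ :- (X :+ b) :* P⁻) :+ Γ :* ((X :- b) :* q⁺ :- (X :+ b) :* q⁻)
           :+ (X :+ b) :* (P⁻ :+ Γ :* q⁻)) refl X b P⁺ P⁻ Γ q⁺ q⁻ ⟩
    ((X - b) * P⁺ - (X + b) * P⁻) + Γ * ((X - b) * q⁺ - (X + b) * q⁻)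
      + (X + b) * (P⁻ + Γ * q⁻)
      ≡⟨ ≡.cong₂ (λ u v → u + Γ * v + (X + b) * (P⁻ + Γ * q⁻))
           (P-recurrence b k) (q-recurrence X b k) ⟩
    + 2 * b * Γ * E + Γ * - (+ 2 * b * E) + (X + b) * (P⁻ + Γ * q⁻)
      ≡⟨ solve 4 (λ b Γ E r → :n 2 :* b :* Γ :* E :+ Γ :* :- (:n 2 :* b :* E) :+ r := r)
           refl b Γ E _ ⟩
    (X + b) * (P⁻ + Γ * q⁻) ∎
    where
    X  = top k
    Γ  = c (suc k)
    E  = e k (b * b)
    P⁺ = P (sq⁺ b) (suc k)
    P⁻ = P (sq⁻ b) (suc k)
    q⁺ = q X (sq⁺ b) (suc k)
    q⁻ = q X (sq⁻ b) (suc k)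

  ν≡ : ∀ n → ν n ≡ + n
  ν≡ = ν≈ι

  4ν+2 : ℕ → ℤ
  4ν+2 j = + 4 * ν j + + 2

  sq⁻-4ν+2 : ∀ j → sq⁻ (4ν+2 j) ≡ + 4 * ν j * (+ 4 * ν j)
  sq⁻-4ν+2 j = solve 1 (λ j → (:n 4 :* j :+ :n 2 :- :n 2) :* (:n 4 :* j :+ :n 2 :- :n 2)
    := :n 4 :* j :* (:n 4 :* j)) refl (ν j)

  sq⁺-4ν+2 : ∀ j → sq⁺ (4ν+2 j) ≡ + 4 * ν (suc j) * (+ 4 * ν (suc j))
  sq⁺-4ν+2 j = solve 1 (λ j → (:n 4 :* j :+ :n 2 :+ :n 2) :* (:n 4 :* j :+ :n 2 :+ :n 2)
    := :n 4 :* (j :+ :n 1) :* (:n 4 :* (j :+ :n 1))) refl (ν j)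

  top+4ν+2≢0 : ∀ k j → top k + 4ν+2 j ≢ + 0
  top+4ν+2≢0 k j = +suc≢0 (3 ℕ.+ 4 ℕ.* (k ℕ.+ j)) (begin
    top k + 4ν+2 j
      ≡⟨ solve 2 (λ k j → :n 4 :* (k :+ :n 1) :- :n 2 :+ (:n 4 :* j :+ :n 2)
           := :n 4 :+ :n 4 :* (k :+ j)) refl (ν k) (ν j) ⟩
    + 4 + + 4 * (ν k + ν j) ≡⟨ ≡.cong (λ z → + 4 + + 4 * z) (≡.sym (ν-+ k j)) ⟩
    + 4 + + 4 * ν (k ℕ.+ j) ≡⟨ ≡.cong (λ z → + 4 + + 4 * z) (ν≡ (k ℕ.+ j)) ⟩
    + 4 + + 4 * + (k ℕ.+ j) ≡⟨ ≡.cong (λ z → + 4 + z) (≡.sym (ℤₚ.pos-* 4 (k ℕ.+ j))) ⟩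
    + suc (3 ℕ.+ 4 ℕ.* (k ℕ.+ j)) ∎)

  -- At b = top k the left side of the recurrence vanishes; then descend in steps of 4.
  defect-zero : ∀ k d j → j ℕ.+ d ≡ k → defect k (+ 4 * ν j * (+ 4 * ν j)) ≡ + 0
  defect-zero k zero j j≡k = *-cancel-0 (top+4ν+2≢0 k j) (begin
    (top k + 4ν+2 j) * defect k (+ 4 * ν j * (+ 4 * ν j))
      ≡⟨ ≡.cong (λ s → (top k + 4ν+2 j) * defect k s) (≡.sym (sq⁻-4ν+2 j)) ⟩
    (top k + 4ν+2 j) * defect k (sq⁻ (4ν+2 j))
      ≡⟨ defect-recurrence k (4ν+2 j) ⟨
    (top k - 4ν+2 j) * defect k (sq⁺ (4ν+2 j))
      ≡⟨ ≡.cong (λ i → (top k - 4ν+2 i) * defect k (sq⁺ (4ν+2 j)))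
           (≡.trans (≡.sym (ℕₚ.+-identityʳ j)) j≡k) ⟩
    (top k - 4ν+2 k) * defect k (sq⁺ (4ν+2 j))
      ≡⟨ solve 2 (λ k x → (:n 4 :* (k :+ :n 1) :- :n 2 :- (:n 4 :* k :+ :n 2)) :* x := :n 0)
           refl (ν k) _ ⟩
    + 0 ∎)
  defect-zero k (suc d) j j+d≡k = *-cancel-0 (top+4ν+2≢0 k j) (begin
    (top k + 4ν+2 j) * defect k (+ 4 * ν j * (+ 4 * ν j))
      ≡⟨ ≡.cong (λ s → (top k + 4ν+2 j) * defect k s) (≡.sym (sq⁻-4ν+2 j)) ⟩
    (top k + 4ν+2 j) * defect k (sq⁻ (4ν+2 j))
      ≡⟨ defect-recurrence k (4ν+2 j) ⟨
    (top k - 4ν+2 j) * defect k (sq⁺ (4ν+2 j))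
      ≡⟨ ≡.cong (λ s → (top k - 4ν+2 j) * defect k s) (sq⁺-4ν+2 j) ⟩
    (top k - 4ν+2 j) * defect k (+ 4 * ν (suc j) * (+ 4 * ν (suc j)))
      ≡⟨ ≡.cong ((top k - 4ν+2 j) *_)
           (defect-zero k d (suc j) (≡.trans (≡.sym (ℕₚ.+-suc j d)) j+d≡k)) ⟩
    (top k - 4ν+2 j) * + 0
      ≡⟨ ℤₚ.*-zeroʳ (top k - 4ν+2 j) ⟩
    + 0 ∎)

  P-zero : ∀ k → P (+ 0) (suc k) ≡ - (c (suc k) * q (top k) (+ 0) (suc k))
  P-zero k = begin
    p                          ≡⟨ solve 2 (λ p r → p := p :+ r :- r) refl p r ⟩
    defect k (+ 0) - r         ≡⟨ ≡.cong (_- r) (defect-zero k k 0 ≡.refl) ⟩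
    + 0 - r                    ≡⟨ solve 1 (λ r → :n 0 :- r := :- r) refl r ⟩
    - r ∎
    where p = P (+ 0) (suc k)
          r = c (suc k) * q (top k) (+ 0) (suc k)

  -- The two sides of the closed form. `Z` is even in a and `W` is odd, which matters for the start
  -- at a = -1.
  Z W : ℕ → ℤ → ℤ
  Z k a = - (c (suc k) * q (top k) (a * a) (suc k))
  W k a = a * D k (a * a)

  top-odd≢0 : ∀ k j → j < k → top k - odd j ≢ + 0
  top-odd≢0 k j (s≤s {n = d′} j≤d′) with ℕₚ.m≤n⇒∃[o]m+o≡n j≤d′
  ... | d , ≡.refl = +suc≢0 (4 ℕ.+ 2 ℕ.* j ℕ.+ 4 ℕ.* d) (begin
    top (suc (j ℕ.+ d)) - odd j
      ≡⟨ ≡.cong (λ z → + 4 * (z + + 1 + + 1) - + 2 - odd j) (ν-+ j d) ⟩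
    + 4 * (ν j + ν d + + 1 + + 1) - + 2 - odd j
      ≡⟨ solve 2 (λ j d → :n 4 :* (j :+ d :+ :n 1 :+ :n 1) :- :n 2 :- :odd j
           := :n 5 :+ :n 2 :* j :+ :n 4 :* d) refl (ν j) (ν d) ⟩
    + 5 + + 2 * ν j + + 4 * ν d
      ≡⟨ ≡.cong₂ (λ x y → + 5 + + 2 * x + + 4 * y) (ν≡ j) (ν≡ d) ⟩
    + 5 + + 2 * + j + + 4 * + d
      ≡⟨ ≡.cong₂ (λ x y → + 5 + x + y) (≡.sym (ℤₚ.pos-* 2 j)) (≡.sym (ℤₚ.pos-* 4 d)) ⟩
    + suc (4 ℕ.+ 2 ℕ.* j ℕ.+ 4 ℕ.* d) ∎)

  -- At b = a+2 = `odd j` with j < k, `e k (b * b)` has a zero factor, so `q-recurrence` loses its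
  -- source. `W` obeys the same relation with the opposite sign, whence -τ; the common factor X - b
  -- is positive and cancels.
  Z-step : ∀ k j a → j < k → a + + 2 ≡ odd j → ∀ τ → Z k a ≡ τ * W k a →
    Z k (a + + 4) ≡ - τ * W k (a + + 4)
  Z-step k j a j<k a+2≡odd τ Za≡ = ℤₚ.*-cancelˡ-≡ (X - b) _ _
      {{ ℤ.≢-nonZero (λ eq → top-odd≢0 k j j<k (≡.trans (≡.cong (λ z → X - z) (≡.sym a+2≡odd)) eq)) }}
      (begin
    (X - b) * Z k (a + + 4)
      ≡⟨ ≡.cong (λ s → (X - b) * - (Γ * q X s (suc k))) eq⁺ ⟩
    (X - b) * - (Γ * q⁺)
      ≡⟨ solve 5 (λ X b Γ q⁺ q⁻ → (X :- b) :* :- (Γ :* q⁺) :=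
           (X :+ b) :* :- (Γ :* q⁻) :- Γ :* ((X :- b) :* q⁺ :- (X :+ b) :* q⁻)) refl X b Γ q⁺ q⁻ ⟩
    (X + b) * - (Γ * q⁻) - Γ * ((X - b) * q⁺ - (X + b) * q⁻)
      ≡⟨ ≡.cong (λ z → (X + b) * - (Γ * q⁻) - Γ * z) (q-recurrence X b k) ⟩
    (X + b) * - (Γ * q⁻) - Γ * - (+ 2 * b * e k (b * b))
      ≡⟨ ≡.cong (λ z → (X + b) * - (Γ * q⁻) - Γ * - (+ 2 * b * z))
           (≡.trans (≡.cong (λ z → e k (z * z)) a+2≡odd) (e-zero k j j<k)) ⟩
    (X + b) * - (Γ * q⁻) - Γ * - (+ 2 * b * + 0)
      ≡⟨ solve 3 (λ x Γ b → x :- Γ :* :- (:n 2 :* b :* :n 0) := x) refl _ Γ b ⟩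
    (X + b) * - (Γ * q⁻)
      ≡⟨ ≡.cong (λ s → (X + b) * - (Γ * q X s (suc k))) (≡.sym eq⁻) ⟩
    (X + b) * Z k a
      ≡⟨ ≡.cong ((X + b) *_) Za≡ ⟩
    (X + b) * (τ * (a * D k (a * a)))
      ≡⟨ ≡.cong₂ (λ z s → (X + b) * (τ * (z * D k s))) (solve 1 (λ a → a := a :+ :n 2 :- :n 2) refl a) eq⁻ ⟩
    (X + b) * (τ * ((b - + 2) * D k (sq⁻ b)))
      ≡⟨ solve 4 (λ X b τ w → (X :+ b) :* (τ :* w) := :- τ :* :- ((X :+ b) :* w)) refl X b τ _ ⟩
    - τ * - ((X + b) * ((b - + 2) * D k (sq⁻ b)))
      ≡⟨ ≡.cong (- τ *_) (≡.sym (D-recurrence k b)) ⟩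
    - τ * ((X - b) * ((b + + 2) * D k (sq⁺ b)))
      ≡⟨ ≡.cong₂ (λ z s → - τ * ((X - b) * (z * D k s)))
           (solve 1 (λ a → a :+ :n 2 :+ :n 2 := a :+ :n 4) refl a) (≡.sym eq⁺) ⟩
    - τ * ((X - b) * W k (a + + 4))
      ≡⟨ solve 3 (λ τ x w → :- τ :* (x :* w) := x :* (:- τ :* w)) refl τ (X - b) _ ⟩
    (X - b) * (- τ * W k (a + + 4)) ∎)
    where
    X  = top k
    b  = a + + 2
    Γ  = c (suc k)
    q⁺ = q X (sq⁺ b) (suc k)
    q⁻ = q X (sq⁻ b) (suc k)
    eq⁺ : (a + + 4) * (a + + 4) ≡ sq⁺ b
    eq⁺ = solve 1 (λ a → (a :+ :n 4) :* (a :+ :n 4) := (a :+ :n 2 :+ :n 2) :* (a :+ :n 2 :+ :n 2)) refl a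
    eq⁻ : a * a ≡ sq⁻ b
    eq⁻ = solve 1 (λ a → a :* a := (a :+ :n 2 :- :n 2) :* (a :+ :n 2 :- :n 2)) refl a

  Z-chain : ∀ k a l (j : ℕ → ℕ) →
    (∀ i → i < l → j i < k) → (∀ i → a + + 4 * ν i + + 2 ≡ odd (j i)) →
    ∀ τ → Z k a ≡ τ * W k a → Z k (a + + 4 * ν l) ≡ sgn l * τ * W k (a + + 4 * ν l)
  Z-chain k a zero j _ _ τ Za≡ = begin
    Z k (a + + 4 * + 0)        ≡⟨ ≡.cong (Z k) a+0 ⟩
    Z k a                      ≡⟨ Za≡ ⟩
    τ * W k a                  ≡⟨ ≡.cong₂ (λ t z → t * W k z) (solve 1 (λ t → t := :n 1 :* t) refl τ) (≡.sym a+0) ⟩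
    + 1 * τ * W k (a + + 4 * + 0) ∎
    where a+0 = solve 1 (λ a → a :+ :n 4 :* :n 0 := a) refl a
  Z-chain k a (suc l) j j<k a+2≡ τ Za≡ = begin
    Z k (a + + 4 * ν (suc l))
      ≡⟨ ≡.cong (Z k) eq ⟩
    Z k (a + + 4 * ν l + + 4)
      ≡⟨ Z-step k (j l) (a + + 4 * ν l) (j<k l ℕₚ.≤-refl) (a+2≡ l) (sgn l * τ)
           (Z-chain k a l j (λ i i<l → j<k i (ℕₚ.m<n⇒m<1+n i<l)) a+2≡ τ Za≡) ⟩
    - (sgn l * τ) * W k (a + + 4 * ν l + + 4)
      ≡⟨ ≡.cong₂ (λ t z → t * W k z) (solve 2 (λ s t → :- (s :* t) := :- s :* t) refl (sgn l) τ) (≡.sym eq) ⟩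
    - sgn l * τ * W k (a + + 4 * ν (suc l)) ∎
    where eq = solve 2 (λ a l → a :+ :n 4 :* (l :+ :n 1) := a :+ :n 4 :* l :+ :n 4) refl a (ν l)

  -- The point k+1 is l steps of 4 above 1, or l+1 steps above -1. In the second case the start
  -- contributes the sign -1, which offsets the extra step.
  Z-value : ∀ k l → k ≡ 4 ℕ.* l ⊎ k ≡ 2 ℕ.+ 4 ℕ.* l →
    Z k (ν (suc k)) ≡ sgn l * W k (ν (suc k))
  Z-value k l (inj₁ ≡.refl) = begin
    Z k (ν (suc k))                      ≡⟨ ≡.cong (Z k) eq ⟩
    Z k (+ 1 + + 4 * ν l)
      ≡⟨ Z-chain k (+ 1) l (λ i → suc (2 ℕ.* i)) bound
           (λ i → ≡.trans (solve 1 (λ i → :n 1 :+ :n 4 :* i :+ :n 2 := :odd (:n 2 :* i :+ :n 1)) refl (ν i))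
                    (≡.cong (λ z → + 2 * (z + + 1) + + 1) (≡.sym (ν-* 2 i))))
           (+ 1) (≡.trans (D-one k) (solve 1 (λ d → d := :n 1 :* (:n 1 :* d)) refl _)) ⟩
    sgn l * + 1 * W k (+ 1 + + 4 * ν l)
      ≡⟨ ≡.cong₂ (λ t z → t * W k z) (ℤₚ.*-identityʳ (sgn l)) (≡.sym eq) ⟩
    sgn l * W k (ν (suc k)) ∎
    where
    eq : ν (suc k) ≡ + 1 + + 4 * ν l
    eq = ≡.trans (≡.cong (_+ + 1) (ν-* 4 l)) (ℤₚ.+-comm (+ 4 * ν l) (+ 1))
    bound : ∀ i → i < l → suc (2 ℕ.* i) < 4 ℕ.* l
    bound i i<l = ℕₚ.≤-trans (ℕₚ.≤-reflexive (≡.sym (ℕₚ.*-distribˡ-+ 2 1 i)))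
      (ℕₚ.≤-trans (ℕₚ.*-monoʳ-≤ 2 i<l) (ℕₚ.*-monoˡ-≤ l (s≤s (s≤s (z≤n {2})))))
  Z-value k l (inj₂ ≡.refl) = begin
    Z k (ν (suc k))                      ≡⟨ ≡.cong (Z k) eq ⟩
    Z k (- + 1 + + 4 * ν (suc l))
      ≡⟨ Z-chain k (- + 1) (suc l) (λ i → 2 ℕ.* i) bound
           (λ i → ≡.trans (solve 1 (λ i → :- :n 1 :+ :n 4 :* i :+ :n 2 := :odd (:n 2 :* i)) refl (ν i))
                    (≡.cong (λ z → + 2 * z + + 1) (≡.sym (ν-* 2 i))))
           (- + 1) (≡.trans (D-one k) (solve 1 (λ d → d := :- :n 1 :* (:- :n 1 :* d)) refl _)) ⟩
    - sgn l * - + 1 * W k (- + 1 + + 4 * ν (suc l))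
      ≡⟨ ≡.cong₂ (λ t z → t * W k z) (solve 1 (λ t → :- t :* :- :n 1 := t) refl (sgn l)) (≡.sym eq) ⟩
    sgn l * W k (ν (suc k)) ∎
    where
    eq : ν (suc k) ≡ - + 1 + + 4 * ν (suc l)
    eq = ≡.trans (≡.cong (λ z → z + + 1 + + 1 + + 1) (ν-* 4 l))
           (solve 1 (λ l → :n 4 :* l :+ :n 1 :+ :n 1 :+ :n 1 := :- :n 1 :+ :n 4 :* (l :+ :n 1)) refl (ν l))
    bound : ∀ i → i < suc l → 2 ℕ.* i < 2 ℕ.+ 4 ℕ.* l
    bound i (s≤s i≤l) = s≤s (ℕₚ.≤-trans (ℕₚ.*-monoʳ-≤ 2 i≤l) (ℕₚ.≤-trans
      (ℕₚ.*-monoˡ-≤ l (s≤s (s≤s (z≤n {2})))) (ℕₚ.n≤1+n (4 ℕ.* l))))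

-- Divisibility by a prime

nCk*k![n∸k]!≡n! : ∀ n k → k ≤ n → (n C k) ℕ.* (k ! ℕ.* (n ∸ k) !) ≡ n !
nCk*k![n∸k]!≡n! n k k≤n = ≡.trans (≡.cong (ℕ._* (k ! ℕ.* (n ∸ k) !)) (nCk≡n!/k![n-k]! k≤n))
  (m/n*n≡m {{ℕₚ.m*n≢0 (k !) ((n ∸ k) !) {{k ℕₚ.!≢0}} {{(n ∸ k) ℕₚ.!≢0}}}} (k![n∸k]!∣n! k≤n))

∤! : ∀ {p} → Prime p → ∀ k → k < p → p ∤ k !
∤! pp zero    1≤p p∣1 = contradiction (∣⇒≤ p∣1) (ℕₚ.<⇒≱ (ℕ.nonTrivial⇒n>1 _ {{prime⇒nonTrivial pp}}))
∤! pp (suc k) k<p p∣ with euclidsLemma (suc k) (k !) pp p∣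
... | inj₁ p∣1+k = ℕₚ.<⇒≱ k<p (∣⇒≤ p∣1+k)
... | inj₂ p∣k!  = ∤! pp k (ℕₚ.<⇒≤ k<p) p∣k!

p∣pCk : ∀ {p} → Prime p → ∀ k → 0 < k → k < p → p ∣ p C k
p∣pCk {p@(suc p′)} pp k@(suc k′) _ k<p with euclidsLemma (p C k) (k ! ℕ.* (p ∸ k) !) pp
    (≡.subst (p ∣_) (≡.sym (nCk*k![n∸k]!≡n! p k (ℕₚ.<⇒≤ k<p))) (m∣m*n (p′ !)))
... | inj₁ p∣C = p∣C
... | inj₂ p∣* with euclidsLemma (k !) _ pp p∣*
...   | inj₁ p∣k!    = contradiction p∣k! (∤! pp k k<p)
...   | inj₂ p∣p-k!  = contradiction p∣p-k! (∤! pp (p′ ∸ k′) (s≤s (ℕₚ.m∸n≤m p′ k′)))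

prime∧∤⇒coprime : ∀ {p n} → Prime p → p ∤ n → Coprime n p
prime∧∤⇒coprime pp p∤n {i} (i∣n , i∣p) with prime⇒irreducible pp i∣p
... | inj₁ i≡1    = i≡1
... | inj₂ ≡.refl = contradiction i∣n p∤n

prime∤1 : ∀ {p} → Prime p → p ∤ 1
prime∤1 {p} prime-p = ∤! prime-p 0 (ℕₚ.<-trans (s≤s z≤n) (ℕ.nonTrivial⇒n>1 p {{prime⇒nonTrivial prime-p}}))

∤-* : ∀ {p m n} → Prime p → p ∤ m → p ∤ n → p ∤ m ℕ.* n
∤-* {p} {m} {n} prime-p p∤m p∤n p∣mn with euclidsLemma m n prime-p p∣mn
... | inj₁ p∣m = p∤m p∣m
... | inj₂ p∣n = p∤n p∣n

-- Powers, the binomial theorem and monic polynomials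

module Powers (A : ℤ-Algebra) where
  open Over A
  open Products A

  ∑-head : ∀ n f → ∑ (suc n) f ≈ f 0 + ∑ n (λ i → f (suc i))
  ∑-head zero    f = solve 1 (λ x → :n 0 :+ x := x :+ :n 0) refl (f 0)
  ∑-head (suc n) f = trans (+-congʳ (∑-head n f))
    (solve 3 (λ a b c → a :+ b :+ c := a :+ (b :+ c)) refl _ _ _)

  ∑-+ : ∀ n f g → ∑ n (λ i → f i + g i) ≈ ∑ n f + ∑ n g
  ∑-+ zero    f g = solve 0 (:n 0 := :n 0 :+ :n 0) refl
  ∑-+ (suc n) f g = trans (+-congʳ (∑-+ n f g))
    (solve 4 (λ a b c d → a :+ b :+ (c :+ d) := a :+ c :+ (b :+ d)) refl _ _ _ _)

  ∑-*ˡ : ∀ n x f → ∑ n (λ i → x * f i) ≈ x * ∑ n f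
  ∑-*ˡ zero    x f = solve 1 (λ x → :n 0 := x :* :n 0) refl x
  ∑-*ˡ (suc n) x f = trans (+-congʳ (∑-*ˡ n x f))
    (solve 3 (λ x a b → x :* a :+ x :* b := x :* (a :+ b)) refl _ _ _)

  ∑-zero : ∀ n {f} → (∀ i → i < n → f i ≈ ι (+ 0)) → ∑ n f ≈ ι (+ 0)
  ∑-zero zero    h = refl
  ∑-zero (suc n) h = trans (+-cong (∑-zero n (λ i i<n → h i (ℕₚ.m<n⇒m<1+n i<n))) (h n ℕₚ.≤-refl))
    (solve 0 (:n 0 :+ :n 0 := :n 0) refl)

  ν-cong : ∀ {m n} → m ≡ n → ν m ≈ ν n
  ν-cong m≡n = reflexive (≡.cong ν m≡n)

  binomial : ∀ x n → ∑ (suc n) (λ k → ν (n C k) * x ^ k) ≈ (x + ι (+ 1)) ^ n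
  binomial x zero = solve 0 (:n 0 :+ (:n 0 :+ :n 1) :* :n 1 := :n 1) refl
  binomial x (suc n) = begin
    ∑ (suc (suc n)) (λ k → ν (suc n C k) * x ^ k)
      ≈⟨ ∑-head (suc n) _ ⟩
    ν (suc n C 0) * x ^ 0 + ∑ (suc n) (λ k → ν (suc n C suc k) * x ^ suc k)
      ≈⟨ +-congˡ (∑-cong (suc n) (λ k _ → pascal k)) ⟩
    ν (n C 0) * x ^ 0 + ∑ (suc n) (λ k → x * (ν (n C k) * x ^ k) + ν (n C suc k) * x ^ suc k)
      ≈⟨ +-congˡ (∑-+ (suc n) _ _) ⟩
    ν (n C 0) * x ^ 0 + (∑ (suc n) (λ k → x * (ν (n C k) * x ^ k))
                         + ∑ (suc n) (λ k → ν (n C suc k) * x ^ suc k))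
      ≈⟨ solve 3 (λ a b c → a :+ (b :+ c) := b :+ (a :+ c)) refl _ _ _ ⟩
    ∑ (suc n) (λ k → x * (ν (n C k) * x ^ k))
      + (ν (n C 0) * x ^ 0 + ∑ (suc n) (λ k → ν (n C suc k) * x ^ suc k))
      ≈⟨ +-cong (∑-*ˡ (suc n) x _) (sym (∑-head (suc n) (λ k → ν (n C k) * x ^ k))) ⟩
    x * B + (B + ν (n C suc n) * x ^ suc n)
      ≈⟨ +-congˡ (+-congˡ (*-congʳ (ν-cong (k>n⇒nCk≡0 (ℕₚ.n<1+n n))))) ⟩
    x * B + (B + ι (+ 0) * x ^ suc n)
      ≈⟨ solve 3 (λ x b y → x :* b :+ (b :+ :n 0 :* y) := (x :+ :n 1) :* b) refl x B _ ⟩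
    (x + ι (+ 1)) * B
      ≈⟨ *-congˡ (binomial x n) ⟩
    (x + ι (+ 1)) * (x + ι (+ 1)) ^ n ∎
    where
    B = ∑ (suc n) (λ k → ν (n C k) * x ^ k)
    pascal : ∀ k → ν (suc n C suc k) * x ^ suc k ≈ x * (ν (n C k) * x ^ k) + ν (n C suc k) * x ^ suc k
    pascal k = begin
      ν (suc n C suc k) * (x * x ^ k)
        ≈⟨ *-congʳ (trans (ν-cong (≡.sym (nCk+nC[k+1]≡[n+1]C[k+1] n k))) (ν-+ (n C k) (n C suc k))) ⟩
      (ν (n C k) + ν (n C suc k)) * (x * x ^ k)
        ≈⟨ solve 4 (λ a b x y → (a :+ b) :* (x :* y) := x :* (a :* y) :+ b :* (x :* y)) refl _ _ _ _ ⟩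
      x * (ν (n C k) * x ^ k) + ν (n C suc k) * x ^ suc k ∎

  ^-zero : ∀ n → ι (+ 0) ^ suc n ≈ ι (+ 0)
  ^-zero n = solve 1 (λ x → :n 0 :* x := :n 0) refl _

  ^-neg-even : ∀ m x → (- x) ^ (m ℕ.+ m) ≈ x ^ (m ℕ.+ m)
  ^-neg-even zero    x = refl
  ^-neg-even (suc m) x = begin
    - x * (- x) ^ (m ℕ.+ suc m)       ≡⟨ ≡.cong (λ k → - x * (- x) ^ k) (ℕₚ.+-suc m m) ⟩
    - x * (- x * (- x) ^ (m ℕ.+ m))   ≈⟨ *-congˡ (*-congˡ (^-neg-even m x)) ⟩
    - x * (- x * x ^ (m ℕ.+ m))       ≈⟨ solve 2 (λ x y → :- x :* (:- x :* y) := x :* (x :* y)) refl _ _ ⟩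
    x * (x * x ^ (m ℕ.+ m))           ≡⟨ ≡.cong (λ k → x * x ^ k) (≡.sym (ℕₚ.+-suc m m)) ⟩
    x * x ^ (m ℕ.+ suc m) ∎

  ^-+ : ∀ x m n → x ^ (m ℕ.+ n) ≈ x ^ m * x ^ n
  ^-+ x zero    n = solve 1 (λ y → y := :n 1 :* y) refl _
  ^-+ x (suc m) n = trans (*-congˡ (^-+ x m n))
    (solve 3 (λ x y z → x :* (y :* z) := x :* y :* z) refl _ _ _)

  *-^ : ∀ x y n → (x * y) ^ n ≈ x ^ n * y ^ n
  *-^ x y zero    = solve 0 (:n 1 := :n 1 :* :n 1) refl
  *-^ x y (suc n) = trans (*-congˡ (*-^ x y n))
    (solve 4 (λ x y a b → x :* y :* (a :* b) := x :* a :* (y :* b)) refl _ _ _ _)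

  -- Monic polynomials x^n + …, given by their n lower coefficients.
  eval : ∀ {n} → Vec Carrier n → Carrier → Carrier
  eval []       x = ι (+ 1)
  eval (a ∷ as) x = a + x * eval as x

  -- Synthetic division by x - r; the remainder is the value at r.
  quotient : ∀ {n} → Vec Carrier (suc n) → Carrier → Vec Carrier n
  quotient (_ ∷ [])           r = []
  quotient (_ ∷ as@(_ ∷ _))   r = eval as r ∷ quotient as r

  eval-quotient : ∀ {n} (as : Vec Carrier (suc n)) r x →
    eval as x ≈ (x - r) * eval (quotient as r) x + eval as r
  eval-quotient (a ∷ []) r x = solve 3 (λ a r x →
    a :+ x :* :n 1 := (x :- r) :* :n 1 :+ (a :+ r :* :n 1)) refl a r x
  eval-quotient (a ∷ as@(_ ∷ _)) r x = trans (+-congˡ (*-congˡ (eval-quotient as r x)))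
    (solve 5 (λ a r x h g → a :+ x :* ((x :- r) :* h :+ g) :=
       (x :- r) :* (g :+ x :* h) :+ (a :+ r :* g)) refl a r x _ _)

  -- Takes the place of "nonzero", since the rings in question have nilpotent elements.
  NonZeroDivisor : Carrier → Set
  NonZeroDivisor x = ∀ y → x * y ≈ ι (+ 0) → y ≈ ι (+ 0)

  -- Division by x - r n leaves a monic quotient that vanishes at the other r i, because r i - r n
  -- can be cancelled; then induct.
  monic-roots : ∀ n (as : Vec Carrier n) (r : ℕ → Carrier) →
    (∀ i → i < n → eval as (r i) ≈ ι (+ 0)) →
    (∀ i j → i < j → j < n → NonZeroDivisor (r i - r j)) →
    ∀ x → eval as x ≈ ∏ n (λ i → x - r i)
  monic-roots zero    []  r _ _ x = refl
  monic-roots (suc n) as r root reg x = begin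
    eval as x
      ≈⟨ eval-quotient as (r n) x ⟩
    (x - r n) * eval (quotient as (r n)) x + eval as (r n)
      ≈⟨ +-cong (*-congˡ (monic-roots n (quotient as (r n)) r root′
           (λ i j i<j j<n → reg i j i<j (ℕₚ.m<n⇒m<1+n j<n)) x)) (root n ℕₚ.≤-refl) ⟩
    (x - r n) * ∏ n (λ i → x - r i) + ι (+ 0)
      ≈⟨ solve 2 (λ a b → a :* b :+ :n 0 := b :* a) refl _ _ ⟩
    ∏ n (λ i → x - r i) * (x - r n) ∎
    where
    root′ : ∀ i → i < n → eval (quotient as (r n)) (r i) ≈ ι (+ 0)
    root′ i i<n = reg i n i<n ℕₚ.≤-refl _ (begin
      (r i - r n) * eval (quotient as (r n)) (r i)
        ≈⟨ solve 2 (λ a b → a := a :+ b :- b) refl _ _ ⟩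
      (r i - r n) * eval (quotient as (r n)) (r i) + eval as (r n) - eval as (r n)
        ≈⟨ -‿cong₂ (trans (sym (eval-quotient as (r n) (r i))) (root i (ℕₚ.m<n⇒m<1+n i<n)))
                   (root n ℕₚ.≤-refl) ⟩
      ι (+ 0) - ι (+ 0)
        ≈⟨ solve 0 (:n 0 :- :n 0 := :n 0) refl ⟩
      ι (+ 0) ∎)

  eval-replicate : ∀ n x → eval (replicate n (ι (+ 0))) x ≈ x ^ n
  eval-replicate zero    x = refl
  eval-replicate (suc n) x = trans (+-congˡ (*-congˡ (eval-replicate n x)))
    (solve 1 (λ y → :n 0 :+ y := y) refl _)

  ^-1-roots : ∀ n (r : ℕ → Carrier) →
    (∀ i → i < suc n → r i ^ suc n ≈ ι (+ 1)) →
    (∀ i j → i < j → j < suc n → NonZeroDivisor (r i - r j)) →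
    ∀ x → x ^ suc n - ι (+ 1) ≈ ∏ (suc n) (λ i → x - r i)
  ^-1-roots n r root reg x = trans (sym (evaluate x)) (monic-roots (suc n) as r
      (λ i i<n → trans (evaluate (r i)) (trans (+-congʳ (root i i<n))
         (solve 0 (:n 1 :- :n 1 := :n 0) refl))) reg x)
    where
    as = - ι (+ 1) ∷ replicate n (ι (+ 0))
    evaluate : ∀ x → eval as x ≈ x ^ suc n - ι (+ 1)
    evaluate x = trans (+-congˡ (*-congˡ (eval-replicate n x)))
      (solve 1 (λ y → :- :n 1 :+ y := y :- :n 1) refl _)

-- Rings in which p = 0

module Characteristic (A : ℤ-Algebra) {p′ : ℕ} (prime-p : Prime (suc p′))
    (p≈0 : Over._≈_ A (Over.ν A (suc p′)) (Over.ι A (+ 0))) where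
  open Over A
  open Products A
  open Powers A

  p : ℕ
  p = suc p′

  ∣⇒ν≈0 : ∀ {n} → p ∣ n → ν n ≈ ι (+ 0)
  ∣⇒ν≈0 (divides d ≡.refl) = trans (ν-* d p) (trans (*-congˡ p≈0)
    (solve 1 (λ x → x :* :n 0 := :n 0) refl _))

  frobenius-1 : ∀ x → (x + ι (+ 1)) ^ p ≈ x ^ p + ι (+ 1)
  frobenius-1 x = begin
    (x + ι (+ 1)) ^ p
      ≈⟨ binomial x p ⟨
    ∑ p f + ν (p C p) * x ^ p
      ≈⟨ +-cong (∑-head p′ f) (*-congʳ (ν-cong (nCn≡1 p))) ⟩
    ν (p C 0) * x ^ 0 + ∑ p′ (λ k → f (suc k)) + ν 1 * x ^ p
      ≈⟨ +-congʳ (+-congˡ (∑-zero p′ (λ k k<p′ → trans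
           (*-congʳ (∣⇒ν≈0 (p∣pCk prime-p (suc k) (s≤s z≤n) (s≤s k<p′))))
           (solve 1 (λ y → :n 0 :* y := :n 0) refl _)))) ⟩
    ν 1 * ι (+ 1) + ι (+ 0) + ν 1 * x ^ p
      ≈⟨ solve 1 (λ y → (:n 0 :+ :n 1) :* :n 1 :+ :n 0 :+ (:n 0 :+ :n 1) :* y := y :+ :n 1) refl _ ⟩
    x ^ p + ι (+ 1) ∎
    where f = λ k → ν (p C k) * x ^ k

  -- Adding 1 repeatedly yields `ν n` itself on the right instead of its p-th power, so Fermat's
  -- little theorem is included as the case x = 0.
  frobenius : ∀ n x → (ν n + x) ^ p ≈ ν n + x ^ p
  frobenius zero    x = trans (^-cong p (solve 1 (λ x → :n 0 :+ x := x) refl x))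
    (solve 1 (λ y → y := :n 0 :+ y) refl _)
  frobenius (suc n) x = begin
    (ν n + ι (+ 1) + x) ^ p   ≈⟨ ^-cong p (solve 2 (λ n x → n :+ :n 1 :+ x := n :+ x :+ :n 1) refl _ _) ⟩
    (ν n + x + ι (+ 1)) ^ p   ≈⟨ frobenius-1 (ν n + x) ⟩
    (ν n + x) ^ p + ι (+ 1)   ≈⟨ +-congʳ (frobenius n x) ⟩
    ν n + x ^ p + ι (+ 1)     ≈⟨ solve 2 (λ n y → n :+ y :+ :n 1 := n :+ :n 1 :+ y) refl _ _ ⟩
    ν n + ι (+ 1) + x ^ p ∎

  -- A Bézout relation makes n a unit modulo p, so this holds even beside nilpotents.
  ν-nonZeroDivisor : ∀ {n} → p ∤ n → NonZeroDivisor (ν n)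
  ν-nonZeroDivisor {n} p∤n y ny≈0 with coprime-Bézout (prime∧∤⇒coprime prime-p p∤n)
  ... | Bézout.+- u v 1+vp≡un = begin
    y                          ≈⟨ solve 2 (λ y v → y := (:n 0 :+ :n 1 :+ v :* :n 0) :* y) refl y (ν v) ⟩
    (ν 1 + ν v * ι (+ 0)) * y  ≈⟨ *-congʳ (+-congˡ (trans (*-congˡ (sym p≈0)) (sym (ν-* v p)))) ⟩
    (ν 1 + ν (v ℕ.* p)) * y    ≈⟨ *-congʳ (sym (ν-+ 1 (v ℕ.* p))) ⟩
    ν (1 ℕ.+ v ℕ.* p) * y      ≈⟨ *-congʳ (trans (ν-cong 1+vp≡un) (ν-* u n)) ⟩
    ν u * ν n * y              ≈⟨ solve 3 (λ u n y → u :* n :* y := u :* (n :* y)) refl _ _ _ ⟩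
    ν u * (ν n * y)            ≈⟨ *-congˡ ny≈0 ⟩
    ν u * ι (+ 0)              ≈⟨ solve 1 (λ u → u :* :n 0 := :n 0) refl _ ⟩
    ι (+ 0) ∎
  ... | Bézout.-+ u v 1+un≡vp = begin
    y                          ≈⟨ solve 2 (λ y u → y := (:n 0 :+ :n 1) :* y :+ u :* :n 0) refl y (ν u) ⟩
    ν 1 * y + ν u * ι (+ 0)    ≈⟨ +-congˡ (*-congˡ (sym ny≈0)) ⟩
    ν 1 * y + ν u * (ν n * y)  ≈⟨ solve 4 (λ o u n y → o :* y :+ u :* (n :* y) := (o :+ u :* n) :* y) refl _ _ _ _ ⟩
    (ν 1 + ν u * ν n) * y      ≈⟨ *-congʳ (trans (+-congˡ (sym (ν-* u n))) (sym (ν-+ 1 (u ℕ.* n)))) ⟩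
    ν (1 ℕ.+ u ℕ.* n) * y      ≈⟨ *-congʳ (trans (ν-cong 1+un≡vp) (∣⇒ν≈0 (divides v ≡.refl))) ⟩
    ι (+ 0) * y                ≈⟨ solve 1 (λ y → :n 0 :* y := :n 0) refl _ ⟩
    ι (+ 0) ∎

  fermat : ∀ {n} → p ∤ n → ν n ^ p′ ≈ ι (+ 1)
  fermat {n} p∤n = begin
    ν n ^ p′                        ≈⟨ solve 1 (λ y → y := y :- :n 1 :+ :n 1) refl _ ⟩
    ν n ^ p′ - ι (+ 1) + ι (+ 1)    ≈⟨ +-congʳ (ν-nonZeroDivisor p∤n _ (begin
      ν n * (ν n ^ p′ - ι (+ 1))      ≈⟨ solve 2 (λ n y → n :* (y :- :n 1) := n :* y :- n) refl _ _ ⟩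
      ν n ^ p - ν n                   ≈⟨ -‿cong₂ (trans (^-cong p (solve 1 (λ n → n := n :+ :n 0) refl (ν n)))
                                          (trans (frobenius n (ι (+ 0))) (+-congˡ (^-zero p′)))) refl ⟩
      ν n + ι (+ 0) - ν n             ≈⟨ solve 1 (λ n → n :+ :n 0 :- n := :n 0) refl _ ⟩
      ι (+ 0) ∎)) ⟩
    ι (+ 0) + ι (+ 1)               ≈⟨ solve 0 (:n 0 :+ :n 1 := :n 1) refl ⟩
    ι (+ 1) ∎

  ∤-suc : ∀ {i} → i < p′ → p ∤ suc i
  ∤-suc i<p′ p∣ = ℕₚ.<⇒≱ (s≤s i<p′) (∣⇒≤ p∣)

  NonZeroDivisor-resp : ∀ {x y} → x ≈ y → NonZeroDivisor y → NonZeroDivisor x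
  NonZeroDivisor-resp x≈y reg z xz≈0 = reg z (trans (*-congʳ (sym x≈y)) xz≈0)

  -- By Fermat and the evenness of p-1, the p-1 elements -ρ(i+1) are roots of x^(p-1) - 1. Their
  -- differences ρ(j-i) are prime to p, so the polynomial splits even if the ring has nilpotents.
  lagrange : ∀ m → p′ ≡ suc m ℕ.+ suc m → ∀ {ρ} → p ∤ ρ → ∀ x →
    ∏ p′ (λ i → x + ν ρ * ν (suc i)) ≈ x ^ p′ - ι (+ 1)
  lagrange m p′≡ {ρ} p∤ρ x = begin
    ∏ p′ (λ i → x + ν ρ * ν (suc i))
      ≈⟨ ∏-cong p′ (λ i _ → solve 2 (λ x y → x :+ y := x :- :- y) refl x _) ⟩
    ∏ p′ (λ i → x - r i)
      ≈⟨ helper p′ p′≡ (λ i i<p′ → begin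
           r i ^ p′                ≡⟨ ≡.cong (r i ^_) p′≡ ⟩
           r i ^ (suc m ℕ.+ suc m) ≈⟨ ^-neg-even (suc m) _ ⟩
           _                       ≡⟨ ≡.cong ((ν ρ * ν (suc i)) ^_) (≡.sym p′≡) ⟩
           (ν ρ * ν (suc i)) ^ p′  ≈⟨ ^-cong p′ (sym (ν-* ρ (suc i))) ⟩
           ν (ρ ℕ.* suc i) ^ p′    ≈⟨ fermat (∤-* prime-p p∤ρ (∤-suc i<p′)) ⟩
           ι (+ 1) ∎) (λ i j i<j j<p′ → NonZeroDivisor-resp (difference i<j)
             (ν-nonZeroDivisor (∤-* prime-p p∤ρ (λ p∣ → ℕₚ.<⇒≱ (ℕₚ.≤-<-trans (ℕₚ.m∸n≤m j i) (ℕₚ.<-trans j<p′ (ℕₚ.n<1+n p′)))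
               (∣⇒≤ {{ℕ.>-nonZero (ℕₚ.m<n⇒0<n∸m i<j)}} p∣))))) ⟩
    x ^ p′ - ι (+ 1) ∎
    where
    r : ℕ → Carrier
    r i = - (ν ρ * ν (suc i))
    difference : ∀ {i j} → i < j → r i - r j ≈ ν (ρ ℕ.* (j ∸ i))
    difference {i} {j} i<j = begin
      - (ν ρ * ν (suc i)) - - (ν ρ * ν (suc j))
        ≈⟨ -‿cong₂ refl (-‿cong (*-congˡ (+-congʳ (trans (ν-cong (≡.sym (ℕₚ.m+[n∸m]≡n (ℕₚ.<⇒≤ i<j)))) (ν-+ i (j ∸ i)))))) ⟩
      - (ν ρ * ν (suc i)) - - (ν ρ * (ν i + ν (j ∸ i) + ι (+ 1)))
        ≈⟨ solve 3 (λ ρ i d → :- (ρ :* (i :+ :n 1)) :- :- (ρ :* (i :+ d :+ :n 1)) := ρ :* d) refl _ _ _ ⟩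
      ν ρ * ν (j ∸ i)
        ≈⟨ ν-* ρ (j ∸ i) ⟨
      ν (ρ ℕ.* (j ∸ i)) ∎
    helper : ∀ n → n ≡ suc m ℕ.+ suc m →
      (∀ i → i < n → r i ^ n ≈ ι (+ 1)) →
      (∀ i j → i < j → j < n → NonZeroDivisor (r i - r j)) →
      ∏ n (λ i → x - r i) ≈ x ^ n - ι (+ 1)
    helper (suc n) _ root reg = sym (^-1-roots n r root reg x)

-- Signs, and expansions in s with integer coefficients

sgn-double : ∀ m → sgn (m ℕ.+ m) ≡ + 1
sgn-double zero    = ≡.refl
sgn-double (suc m) = ≡.trans (≡.cong (λ k → ℤ.- sgn k) (ℕₚ.+-suc m m))
  (≡.trans (ℤₚ.neg-involutive (sgn (m ℕ.+ m))) (sgn-double m))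

sgn-odd : ∀ {n} m → n ≡ m ℕ.+ m → sgn (suc n) ≡ -[1+ 0 ]
sgn-odd m n≡ = ≡.cong ℤ.-_ (≡.trans (≡.cong sgn n≡) (sgn-double m))

-- An expansion whose coefficients are integers valid in every ring: they can be computed modulo p
-- at s = ε² and used over ℤ at s = p².
PolynomialFunction : Set₁
PolynomialFunction = ∀ A → Over.Carrier A → Over.Carrier A

Taylor : PolynomialFunction → Set₁
Taylor f = Σ ℤ λ a → Σ ℤ λ b → ∀ A → let open Over A in
  ∀ s → Σ Carrier λ z → f A s ≈ ι a + ι b * s + s * s * z

taylor-const : ∀ a → Taylor (λ A _ → Over.ι A a)
taylor-const a = a , + 0 , λ A s → let open Over A in
  ι (+ 0) , solve 2 (λ a s → a := a :+ :n 0 :* s :+ s :* s :* :n 0) refl (ι a) s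

taylor-id : Taylor (λ A s → s)
taylor-id = + 0 , + 1 , λ A s → let open Over A in
  ι (+ 0) , solve 1 (λ s → s := :n 0 :+ :n 1 :* s :+ s :* s :* :n 0) refl s

taylor-+ : ∀ {f g} → Taylor f → Taylor g → Taylor (λ A s → Over._+_ A (f A s) (g A s))
taylor-+ (a , b , F) (a′ , b′ , G) = a ℤ.+ a′ , b ℤ.+ b′ , λ A s → let open Over A in
  proj₁ (F A s) + proj₁ (G A s) ,
  trans (+-cong (proj₂ (F A s)) (proj₂ (G A s)))
  (trans (solve 7 (λ a b z a′ b′ z′ s →
      a :+ b :* s :+ s :* s :* z :+ (a′ :+ b′ :* s :+ s :* s :* z′)
      := a :+ a′ :+ (b :+ b′) :* s :+ s :* s :* (z :+ z′)) refl _ _ _ _ _ _ s)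
    (+-congʳ (+-cong (sym (ι-+ a a′)) (*-congʳ (sym (ι-+ b b′))))))

taylor-neg : ∀ {f} → Taylor f → Taylor (λ A s → Over.-_ A (f A s))
taylor-neg (a , b , F) = ℤ.- a , ℤ.- b , λ A s → let open Over A in
  - proj₁ (F A s) ,
  trans (-‿cong (proj₂ (F A s)))
  (trans (solve 4 (λ a b z s → :- (a :+ b :* s :+ s :* s :* z)
      := :- a :+ :- b :* s :+ s :* s :* :- z) refl _ _ _ s)
    (+-congʳ (+-cong (sym (ι-neg a)) (*-congʳ (sym (ι-neg b))))))

taylor-* : ∀ {f g} → Taylor f → Taylor g → Taylor (λ A s → Over._*_ A (f A s) (g A s))
taylor-* (a , b , F) (a′ , b′ , G) = a ℤ.* a′ , a ℤ.* b′ ℤ.+ b ℤ.* a′ , λ A s → let open Over A in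
  _ ,
  trans (*-cong (proj₂ (F A s)) (proj₂ (G A s)))
  (trans (solve 7 (λ a b z a′ b′ z′ s →
      (a :+ b :* s :+ s :* s :* z) :* (a′ :+ b′ :* s :+ s :* s :* z′)
      := a :* a′ :+ (a :* b′ :+ b :* a′) :* s
         :+ s :* s :* (b :* b′ :+ (a :+ b :* s) :* z′ :+ z :* (a′ :+ b′ :* s) :+ s :* s :* z :* z′))
      refl _ _ _ _ _ _ s)
    (+-congʳ (+-cong (sym (ι-* a a′)) (*-congʳ
      (sym (trans (ι-+ (a ℤ.* b′) (b ℤ.* a′)) (+-cong (ι-* a b′) (ι-* b a′))))))))

taylor-ν : ∀ n → Taylor (λ A _ → Over.ν A n)
taylor-ν zero    = taylor-const (+ 0)
taylor-ν (suc n) = taylor-+ (taylor-ν n) (taylor-const (+ 1))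

taylor-∏ : ∀ n (f : ℕ → PolynomialFunction) → (∀ i → Taylor (f i)) →
  Taylor (λ A s → Over.∏ A n (λ i → f i A s))
taylor-∏ zero    f F = taylor-const (+ 1)
taylor-∏ (suc n) f F = taylor-* (taylor-∏ n f F) (F n)

taylor-odd : ∀ i → Taylor (λ A _ → Over.odd A i)
taylor-odd i = taylor-+ (taylor-* (taylor-const (+ 2)) (taylor-ν i)) (taylor-const (+ 1))

taylor-e : ∀ k → Taylor (λ A s → Over.e A k s)
taylor-e k = taylor-∏ k (λ i A s → let open Over A in odd i * odd i - s)
  (λ i → taylor-+ (taylor-* (taylor-odd i) (taylor-odd i)) (taylor-neg taylor-id))

taylor-q : ∀ n k → Taylor (λ A s → let open Over A in q (ι (+ 4) * ν n - ι (+ 2)) s k)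
taylor-q n zero    = taylor-const (+ 0)
taylor-q n (suc k) = taylor-+ (taylor-* (taylor-q n k) (taylor-*
    (taylor-neg (taylor-* (taylor-const (+ 4)) (taylor-ν k)))
    (taylor-+ (taylor-+ (taylor-+ (taylor-* (taylor-const (+ 4)) (taylor-ν n))
        (taylor-neg (taylor-const (+ 2)))) (taylor-const (+ 1)))
      (taylor-neg (taylor-* (taylor-const (+ 2)) (taylor-ν k))))))
  (taylor-e k)

module Homomorphism (A : ℤ-Algebra) where
  open Over A
  private module Z = Over ℤ-algebra

  ι-ν : ∀ n → ι (Z.ν n) ≈ ν n
  ι-ν n = trans (reflexive (≡.cong ι (Z.ν≈ι n))) (sym (ν≈ι n))

  ι-^ : ∀ x n → ι (x Z.^ n) ≈ ι x ^ n
  ι-^ x zero    = refl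
  ι-^ x (suc n) = trans (ι-* x (x Z.^ n)) (*-congˡ (ι-^ x n))

  ι-∑ : ∀ n f → ι (Z.∑ n f) ≈ ∑ n (λ i → ι (f i))
  ι-∑ zero    f = refl
  ι-∑ (suc n) f = trans (ι-+ (Z.∑ n f) (f n)) (+-congʳ (ι-∑ n f))

  ι-∏ : ∀ n f → ι (Z.∏ n f) ≈ ∏ n (λ i → ι (f i))
  ι-∏ zero    f = refl
  ι-∏ (suc n) f = trans (ι-* (Z.∏ n f) (f n)) (*-congʳ (ι-∏ n f))

  ι-odd : ∀ i → ι (Z.odd i) ≈ odd i
  ι-odd i = trans (ι-+ (+ 2 Z.* Z.ν i) (+ 1)) (+-congʳ (trans (ι-* (+ 2) (Z.ν i)) (*-congˡ (ι-ν i))))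

  ι-∸ : ∀ a b → ι (a ℤ.- b) ≈ ι a - ι b
  ι-∸ a b = trans (ι-+ a (ℤ.- b)) (+-congˡ (ι-neg b))

-- The part of `D` that depends on s.
G : ∀ A → ℕ → Over.Carrier A → Over.Carrier A
G A k s = let open Over A in ∏ k (λ i → ι (+ 16) * (ν (suc i) * ν (suc i)) - s)

taylor-G : ∀ k → Taylor (λ A s → G A k s)
taylor-G k = taylor-∏ k (λ i A s → let open Over A in ι (+ 16) * (ν (suc i) * ν (suc i)) - s)
  (λ i → taylor-+ (taylor-* (taylor-const (+ 16)) (taylor-* (taylor-ν (suc i)) (taylor-ν (suc i))))
                  (taylor-neg taylor-id))

-- The residue rings as interfaces

Multiple : ℕ → ℤ → Set
Multiple p a = Σ ℤ λ w → a ≡ w ℤ.* + p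

record Residues (p : ℕ) : Set₁ where
  field
    algebra : ℤ-Algebra
  open Over algebra
  field
    p≈0     : ν p ≈ ι (+ 0)
    detects : ∀ a → ι a ≈ ι (+ 0) → Multiple p a

-- Stands for (ℤ/p)[ε]/(ε⁴). The odd powers are read off because ε f(ε²) shows the constant
-- coefficient of f at ε and the linear one at ε³.
record CubicResidues (p : ℕ) : Set₁ where
  field
    algebra : ℤ-Algebra
  open Over algebra
  field
    p≈0     : ν p ≈ ι (+ 0)
    ε       : Carrier
    ε⁴≈0    : ε * ε * ε * ε ≈ ι (+ 0)
    detects : ∀ a b c → ε * ι a + ε * ε * ι b + ε * ε * ε * ι c ≈ ι (+ 0) →
      Multiple p a × Multiple p c

-- The recurrence at 4j + ε with ε⁴ = 0

module Nilpotent {p′ : ℕ} (prime-p : Prime (suc p′)) (m : ℕ)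
    (p′≡ : p′ ≡ suc (suc m) ℕ.+ suc (suc m)) (𝕂 : CubicResidues (suc p′)) where
  open CubicResidues 𝕂 using (p≈0; ε; ε⁴≈0) renaming (algebra to A)
  open Over A
  open Products A
  open Powers A
  open Characteristic A prime-p p≈0
  open Homomorphism A

  -- This is p - 3, in a form that displays its evenness.
  k : ℕ
  k = suc m ℕ.+ suc m

  p′≡2+k : p′ ≡ suc (suc k)
  p′≡2+k = ≡.trans p′≡ (≡.cong (λ j → suc (suc j)) (ℕₚ.+-suc m (suc m)))

  ε^p′≈0 : ε ^ p′ ≈ ι (+ 0)
  ε^p′≈0 = begin
    ε ^ p′                        ≡⟨ ≡.cong (ε ^_) (≡.trans p′≡2+k (≡.cong (λ j → suc (suc (suc j))) (ℕₚ.+-suc m m))) ⟩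
    ε * (ε * (ε * (ε * ε ^ (m ℕ.+ m))))
      ≈⟨ solve 2 (λ ε x → ε :* (ε :* (ε :* (ε :* x))) := ε :* ε :* ε :* ε :* x) refl ε _ ⟩
    ε * ε * ε * ε * ε ^ (m ℕ.+ m) ≈⟨ *-congʳ ε⁴≈0 ⟩
    ι (+ 0) * ε ^ (m ℕ.+ m)       ≈⟨ solve 1 (λ x → :n 0 :* x := :n 0) refl _ ⟩
    ι (+ 0) ∎

  even-power : ∀ x → (- x) ^ p′ ≈ x ^ p′
  even-power x = ≡.subst (λ j → (- x) ^ j ≈ x ^ j) (≡.sym p′≡) (^-neg-even (suc (suc m)) x)

  p∤2 : p ∤ 2
  p∤2 p∣2 with ℕₚ.≤-trans (ℕₚ.≤-reflexive (≡.cong suc (≡.sym p′≡2+k))) (∣⇒≤ p∣2)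
  ... | s≤s (s≤s ())

  p∤4 : p ∤ 4
  p∤4 = ∤-* prime-p p∤2 p∤2

  -- As (2i+1)² - b² = (2(i+1) + (b-1))(2(i+1) - (b+1)), `lagrange` with ρ = 2 applies to both
  -- factors.
  e-factor : ∀ b → e p′ (b * b) ≈ ((b - ι (+ 1)) ^ p′ - ι (+ 1)) * ((b + ι (+ 1)) ^ p′ - ι (+ 1))
  e-factor b = begin
    ∏ p′ (λ i → odd i * odd i - b * b)
      ≈⟨ ∏-cong p′ (λ i _ → solve 2 (λ i b → :odd i :* :odd i :- b :* b :=
           (b :- :n 1 :+ (:n 0 :+ :n 1 :+ :n 1) :* (i :+ :n 1))
           :* (:- (b :+ :n 1) :+ (:n 0 :+ :n 1 :+ :n 1) :* (i :+ :n 1))) refl (ν i) b) ⟩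
    ∏ p′ (λ i → (b - ι (+ 1) + ν 2 * ν (suc i)) * (- (b + ι (+ 1)) + ν 2 * ν (suc i)))
      ≈⟨ ∏-* p′ _ _ ⟩
    ∏ p′ (λ i → b - ι (+ 1) + ν 2 * ν (suc i)) * ∏ p′ (λ i → - (b + ι (+ 1)) + ν 2 * ν (suc i))
      ≈⟨ *-cong (lagrange (suc m) p′≡ p∤2 _) (lagrange (suc m) p′≡ p∤2 _) ⟩
    ((b - ι (+ 1)) ^ p′ - ι (+ 1)) * ((- (b + ι (+ 1))) ^ p′ - ι (+ 1))
      ≈⟨ *-congˡ (+-congʳ (even-power _)) ⟩
    ((b - ι (+ 1)) ^ p′ - ι (+ 1)) * ((b + ι (+ 1)) ^ p′ - ι (+ 1)) ∎

  -- Phrased for u u^(p-1) and not for u^(p-1), because p may divide n and u need not be a unit.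
  frobenius-ε : ∀ n {u} → u ≈ ν n + ε → u * u ^ p′ ≈ ν n
  frobenius-ε n {u} u≈ = begin
    u ^ p             ≈⟨ ^-cong p u≈ ⟩
    (ν n + ε) ^ p     ≈⟨ frobenius n ε ⟩
    ν n + ε * ε ^ p′  ≈⟨ +-congˡ (*-congˡ ε^p′≈0) ⟩
    ν n + ε * ι (+ 0) ≈⟨ solve 2 (λ n ε → n :+ ε :* :n 0 := n) refl (ν n) ε ⟩
    ν n ∎

  u v : ℕ → ℕ
  u j = 1 ℕ.+ 4 ℕ.* j
  v j = 3 ℕ.+ 4 ℕ.* j

  4j : ∀ j → ν (4 ℕ.* j) ≈ ι (+ 4) * ν j
  4j j = trans (ν-* 4 j) (*-congʳ (solve 0 (:n 0 :+ :n 1 :+ :n 1 :+ :n 1 :+ :n 1 := :n 4) refl))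

  U : ℕ → Carrier
  U j = (ν (u j) + ε) ^ p′ + (ν (v j) + ε) ^ p′ - ι (+ 2)

  b : ℕ → Carrier
  b j = ι (+ 4) * ν j + ι (+ 2) + ε

  -- Writing 2b = (b-1) + (b+1) supplies each of the two factors in turn with the power it lacks for
  -- Frobenius; each u u^(p-1) - u is then -ε.
  b-e : ∀ j → ι (+ 2) * b j * e p′ (b j * b j) ≈ - (ε * U j)
  b-e j = begin
    ι (+ 2) * b j * e p′ (b j * b j)
      ≈⟨ *-congˡ (e-factor (b j)) ⟩
    ι (+ 2) * b j * ((u₁ ^ p′ - ι (+ 1)) * (v₁ ^ p′ - ι (+ 1)))
      ≈⟨ solve 3 (λ b x y → :n 2 :* b :* ((x :- :n 1) :* (y :- :n 1)) :=
           ((b :- :n 1) :* x :- (b :- :n 1)) :* (y :- :n 1)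
           :+ ((b :+ :n 1) :* y :- (b :+ :n 1)) :* (x :- :n 1)) refl (b j) _ _ ⟩
    (u₁ * u₁ ^ p′ - u₁) * (v₁ ^ p′ - ι (+ 1)) + (v₁ * v₁ ^ p′ - v₁) * (u₁ ^ p′ - ι (+ 1))
      ≈⟨ +-cong (*-cong (-‿cong₂ (frobenius-ε (u j) u₁≈) u₁≈) (+-congʳ (^-cong p′ v₁≈)))
                (*-cong (-‿cong₂ (frobenius-ε (v j) v₁≈) v₁≈) (+-congʳ (^-cong p′ u₁≈))) ⟩
    (ν (u j) - (ν (u j) + ε)) * ((ν (v j) + ε) ^ p′ - ι (+ 1))
      + (ν (v j) - (ν (v j) + ε)) * ((ν (u j) + ε) ^ p′ - ι (+ 1))
      ≈⟨ solve 5 (λ a b ε x y → (a :- (a :+ ε)) :* (y :- :n 1) :+ (b :- (b :+ ε)) :* (x :- :n 1)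
           := :- (ε :* (x :+ y :- :n 2))) refl _ _ ε _ _ ⟩
    - (ε * U j) ∎
    where
    u₁ = b j - ι (+ 1)
    v₁ = b j + ι (+ 1)
    u₁≈ : u₁ ≈ ν (u j) + ε
    u₁≈ = trans (solve 2 (λ x ε → :n 4 :* x :+ :n 2 :+ ε :- :n 1 := :n 0 :+ :n 1 :+ :n 4 :* x :+ ε) refl (ν j) ε)
      (+-congʳ (trans (+-congˡ (sym (4j j))) (sym (ν-+ 1 (4 ℕ.* j)))))
    v₁≈ : v₁ ≈ ν (v j) + ε
    v₁≈ = trans (solve 2 (λ x ε → :n 4 :* x :+ :n 2 :+ ε :+ :n 1
        := :n 0 :+ :n 1 :+ :n 1 :+ :n 1 :+ :n 4 :* x :+ ε) refl (ν j) ε)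
      (+-congʳ (trans (+-congˡ (sym (4j j))) (sym (ν-+ 3 (4 ℕ.* j)))))

  alternating : ∀ (M K : ℕ → Carrier) → (∀ j → M (suc j) + M j ≈ K j) → ∀ n →
    ∑ n (λ j → ι (sgn j) * K j) ≈ M 0 - ι (sgn n) * M n
  alternating M K step zero    = solve 1 (λ x → :n 0 := x :- :n 1 :* x) refl _
  alternating M K step (suc n) = begin
    ∑ n (λ j → ι (sgn j) * K j) + ι (sgn n) * K n
      ≈⟨ +-cong (alternating M K step n) (*-congˡ (sym (step n))) ⟩
    M 0 - ι (sgn n) * M n + ι (sgn n) * (M (suc n) + M n)
      ≈⟨ solve 4 (λ a s x y → a :- s :* x :+ s :* (y :+ x) := a :- :- s :* y) refl _ _ _ _ ⟩
    M 0 - - ι (sgn n) * M (suc n)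
      ≈⟨ +-congˡ (-‿cong (*-congʳ (sym (ι-neg (sgn n))))) ⟩
    M 0 - ι (ℤ.- sgn n) * M (suc n) ∎

  X : Carrier
  X = ι (+ 4) * ν p - ι (+ 2)

  α : ℕ → Carrier
  α j = ι (+ 4) * ν j + ε

  M : ℕ → Carrier
  M j = α j * q X (α j * α j) p

  -- In characteristic p the number X = 4p - 2 is -2. The weights X - b and X + b become -(b+2) =
  -- -α(j+1) and b-2 = α(j), so the recurrence relates consecutive values of `M`.
  M-step : ∀ j → M (suc j) + M j ≈ - (ε * U j)
  M-step j = begin
    α (suc j) * q X (α (suc j) * α (suc j)) p + α j * q X (α j * α j) p
      ≈⟨ +-cong (*-cong α⁺ (q-cong p refl (*-cong α⁺ α⁺))) (*-cong α⁻ (q-cong p refl (*-cong α⁻ α⁻))) ⟩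
    (b j + ι (+ 2)) * q⁺ + (b j - ι (+ 2)) * q⁻
      ≈⟨ solve 4 (λ b q⁺ q⁻ P → (b :+ :n 2) :* q⁺ :+ (b :- :n 2) :* q⁻ :=
           :- ((:n 4 :* :n 0 :- :n 2 :- b) :* q⁺ :- (:n 4 :* :n 0 :- :n 2 :+ b) :* q⁻)) refl (b j) q⁺ q⁻ (ν p) ⟩
    - ((X₀ - b j) * q⁺ - (X₀ + b j) * q⁻)
      ≈⟨ -‿cong (-‿cong₂ (*-congʳ (+-congʳ X≈)) (*-congʳ (+-congʳ X≈))) ⟨
    - ((X - b j) * q⁺ - (X + b j) * q⁻)
      ≈⟨ -‿cong (q-recurrence X (b j) p′) ⟩
    - - (ι (+ 2) * b j * e p′ (b j * b j))
      ≈⟨ solve 1 (λ x → :- :- x := x) refl _ ⟩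
    ι (+ 2) * b j * e p′ (b j * b j)
      ≈⟨ b-e j ⟩
    - (ε * U j) ∎
    where
    X₀ = ι (+ 4) * ι (+ 0) - ι (+ 2)
    X≈ : X ≈ X₀
    X≈ = +-congʳ (*-congˡ p≈0)
    q⁺ = q X (sq⁺ (b j)) p
    q⁻ = q X (sq⁻ (b j)) p
    α⁺ : α (suc j) ≈ b j + ι (+ 2)
    α⁺ = solve 2 (λ j ε → :n 4 :* (j :+ :n 1) :+ ε := :n 4 :* j :+ :n 2 :+ ε :+ :n 2) refl (ν j) ε
    α⁻ : α j ≈ b j - ι (+ 2)
    α⁻ = solve 2 (λ j ε → :n 4 :* j :+ ε := :n 4 :* j :+ :n 2 :+ ε :- :n 2) refl (ν j) ε

  q-alternating : ι (+ 2) * (ε * q X (ε * ε) p) ≈ ∑ p (λ j → ι (sgn j) * - (ε * U j))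
  q-alternating = sym (begin
    ∑ p (λ j → ι (sgn j) * - (ε * U j))
      ≈⟨ alternating M _ M-step p ⟩
    M 0 - ι (sgn p) * M p
      -- The index p gives the same value as the index 0, and its sign is -1 because p is odd: the
      -- boundary terms add up instead of cancelling.
      ≈⟨ -‿cong₂ (M≈ 0 refl) (*-cong (reflexive (≡.cong ι (sgn-odd (suc (suc m)) p′≡))) (M≈ p p≈0)) ⟩
    ε * q X (ε * ε) p - ι -[1+ 0 ] * (ε * q X (ε * ε) p)
      ≈⟨ solve 1 (λ x → x :- con -[1+ 0 ] :* x := :n 2 :* x) refl _ ⟩
    ι (+ 2) * (ε * q X (ε * ε) p) ∎)
    where
    M≈ : ∀ j → ν j ≈ ι (+ 0) → M j ≈ ε * q X (ε * ε) p
    M≈ j j≈0 = *-cong α≈ (q-cong p refl (*-cong α≈ α≈))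
      where
      α≈ : α j ≈ ε
      α≈ = trans (+-congʳ (*-congˡ j≈0)) (solve 1 (λ ε → :n 4 :* :n 0 :+ ε := ε) refl ε)

  -- Doubled so that the coefficient (n+2)(n+1)/2 of ε² appears without a division.
  ^-expand : ∀ x n → Σ Carrier λ z → ι (+ 2) * (x + ε) ^ suc (suc n) ≈
    ι (+ 2) * x ^ suc (suc n) + ι (+ 2) * ν (suc (suc n)) * x ^ suc n * ε
      + ν (suc (suc n)) * ν (suc n) * x ^ n * (ε * ε) + ε * ε * ε * z
  ^-expand x zero = ι (+ 0) , solve 2 (λ x ε → :n 2 :* ((x :+ ε) :* ((x :+ ε) :* :n 1)) :=
      :n 2 :* (x :* (x :* :n 1)) :+ :n 2 :* (:n 0 :+ :n 1 :+ :n 1) :* (x :* :n 1) :* ε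
      :+ (:n 0 :+ :n 1 :+ :n 1) :* (:n 0 :+ :n 1) :* :n 1 :* (ε :* ε) :+ ε :* ε :* ε :* :n 0) refl x ε
  ^-expand x (suc n) with ^-expand x n
  ... | z , eq = _ , (begin
    ι (+ 2) * ((x + ε) * (x + ε) ^ suc (suc n))
      ≈⟨ solve 2 (λ a b → :n 2 :* (a :* b) := a :* (:n 2 :* b)) refl _ _ ⟩
    (x + ε) * (ι (+ 2) * (x + ε) ^ suc (suc n))
      ≈⟨ *-congˡ eq ⟩
    (x + ε) * (ι (+ 2) * x ^ suc (suc n) + ι (+ 2) * ν (suc (suc n)) * x ^ suc n * ε
      + ν (suc (suc n)) * ν (suc n) * x ^ n * (ε * ε) + ε * ε * ε * z)
      ≈⟨ solve 5 (λ x ε n y z →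
           let 1+n = n :+ :n 1 ; 2+n = 1+n :+ :n 1 ; 3+n = 2+n :+ :n 1 in
           (x :+ ε) :* (:n 2 :* (x :* (x :* y)) :+ :n 2 :* 2+n :* (x :* y) :* ε
             :+ 2+n :* 1+n :* y :* (ε :* ε) :+ ε :* ε :* ε :* z)
           := :n 2 :* (x :* (x :* (x :* y))) :+ :n 2 :* 3+n :* (x :* (x :* y)) :* ε
             :+ 3+n :* 2+n :* (x :* y) :* (ε :* ε)
             :+ ε :* ε :* ε :* (2+n :* 1+n :* y :+ (x :+ ε) :* z))
           refl x ε (ν n) (x ^ n) z ⟩
    ι (+ 2) * x ^ suc (suc (suc n)) + ι (+ 2) * ν (suc (suc (suc n))) * x ^ suc (suc n) * ε
      + ν (suc (suc (suc n))) * ν (suc (suc n)) * x ^ suc n * (ε * ε)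
      + ε * ε * ε * _ ∎)

  private module Z = Over ℤ-algebra

  -- For the exponent p-1 the doubled coefficients 2(p-1) and (p-1)(p-2) are -2 and 2 modulo p.
  ι-expand : ∀ z → ε * (ι (+ 2) * (ι z + ε) ^ p′) ≈
    ε * ι (+ 2 Z.* z Z.^ p′) + ε * ε * ι (-[1+ 1 ] Z.* z Z.^ suc k) + ε * ε * ε * ι (+ 2 Z.* z Z.^ k)
  ι-expand z = ≡.subst (λ n → ε * (ι (+ 2) * (ι z + ε) ^ n) ≈
      ε * ι (+ 2 Z.* z Z.^ n) + ε * ε * ι (-[1+ 1 ] Z.* z Z.^ suc k) + ε * ε * ε * ι (+ 2 Z.* z Z.^ k))
    (≡.sym p′≡2+k) (begin
      ε * (ι (+ 2) * (x + ε) ^ suc (suc k))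
        ≈⟨ *-congˡ (proj₂ (^-expand x k)) ⟩
      ε * (ι (+ 2) * x ^ suc (suc k) + ι (+ 2) * ν (suc (suc k)) * x ^ suc k * ε
        + ν (suc (suc k)) * ν (suc k) * x ^ k * (ε * ε) + ε * ε * ε * r)
        -- What exceeds the coefficients -2 and 2 is collected as a multiple of 3+n, which is p for
        -- n = k.
        ≈⟨ solve 6 (λ ε x₂ x₁ x₀ n r → let 1+n = n :+ :n 1 ; 2+n = 1+n :+ :n 1 ; 3+n = 2+n :+ :n 1 in
             ε :* (:n 2 :* x₂ :+ :n 2 :* 2+n :* x₁ :* ε :+ 2+n :* 1+n :* x₀ :* (ε :* ε) :+ ε :* ε :* ε :* r)
             := ε :* (:n 2 :* x₂) :+ ε :* ε :* (con -[1+ 1 ] :* x₁) :+ ε :* ε :* ε :* (:n 2 :* x₀)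
             :+ 3+n :* (:n 2 :* x₁ :* ε :* ε :+ x₀ :* (ε :* ε :* ε) :* n) :+ ε :* ε :* ε :* ε :* r)
             refl ε (x ^ suc (suc k)) (x ^ suc k) (x ^ k) (ν k) r ⟩
      main + ν (suc (suc (suc k))) * _ + ε * ε * ε * ε * r
        ≈⟨ +-cong (+-congˡ (*-congʳ (trans (ν-cong (≡.cong suc (≡.sym p′≡2+k))) p≈0))) (*-congʳ ε⁴≈0) ⟩
      main + ι (+ 0) * _ + ι (+ 0) * r
        ≈⟨ solve 3 (λ a b r → a :+ :n 0 :* b :+ :n 0 :* r := a) refl main _ r ⟩
      main
        ≈⟨ +-cong (+-cong (*-congˡ (fold (+ 2) (suc (suc k)))) (*-congˡ (fold -[1+ 1 ] (suc k))))
                  (*-congˡ (fold (+ 2) k)) ⟨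
      ε * ι (+ 2 Z.* z Z.^ suc (suc k)) + ε * ε * ι (-[1+ 1 ] Z.* z Z.^ suc k) + ε * ε * ε * ι (+ 2 Z.* z Z.^ k) ∎)
    where
    x = ι z
    r = proj₁ (^-expand x k)
    main = ε * (ι (+ 2) * x ^ suc (suc k)) + ε * ε * (ι -[1+ 1 ] * x ^ suc k) + ε * ε * ε * (ι (+ 2) * x ^ k)
    fold : ∀ a n → ι (a Z.* z Z.^ n) ≈ ι a * x ^ n
    fold a n = trans (ι-* a (z Z.^ n)) (*-congˡ (ι-^ z n))

  -- Integer coefficients, so that `detects` turns an equation in the ring into divisibility by p.
  cubic : ℤ → ℤ → ℤ → Carrier
  cubic a b c = ε * ι a + ε * ε * ι b + ε * ε * ε * ι c

  cubic-+ : ∀ a b c a′ b′ c′ → cubic a b c + cubic a′ b′ c′ ≈ cubic (a Z.+ a′) (b Z.+ b′) (c Z.+ c′)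
  cubic-+ a b c a′ b′ c′ = trans
    (solve 7 (λ ε a b c a′ b′ c′ → ε :* a :+ ε :* ε :* b :+ ε :* ε :* ε :* c
       :+ (ε :* a′ :+ ε :* ε :* b′ :+ ε :* ε :* ε :* c′)
       := ε :* (a :+ a′) :+ ε :* ε :* (b :+ b′) :+ ε :* ε :* ε :* (c :+ c′)) refl _ _ _ _ _ _ _)
    (sym (+-cong (+-cong (*-congˡ (ι-+ a a′)) (*-congˡ (ι-+ b b′))) (*-congˡ (ι-+ c c′))))

  cubic-* : ∀ s a b c → ι s * cubic a b c ≈ cubic (s Z.* a) (s Z.* b) (s Z.* c)
  cubic-* s a b c = trans
    (solve 5 (λ ε s a b c → s :* (ε :* a :+ ε :* ε :* b :+ ε :* ε :* ε :* c)
       := ε :* (s :* a) :+ ε :* ε :* (s :* b) :+ ε :* ε :* ε :* (s :* c)) refl _ _ _ _ _)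
    (sym (+-cong (+-cong (*-congˡ (ι-* s a)) (*-congˡ (ι-* s b))) (*-congˡ (ι-* s c))))

  cubic-∑ : ∀ n a b c → ∑ n (λ j → cubic (a j) (b j) (c j)) ≈ cubic (Z.∑ n a) (Z.∑ n b) (Z.∑ n c)
  cubic-∑ zero a b c = solve 1 (λ ε → :n 0 := ε :* :n 0 :+ ε :* ε :* :n 0 :+ ε :* ε :* ε :* :n 0) refl ε
  cubic-∑ (suc n) a b c = trans (+-congʳ (cubic-∑ n a b c))
    (cubic-+ (Z.∑ n a) (Z.∑ n b) (Z.∑ n c) (a n) (b n) (c n))

  -- The coefficients of ε, ε², ε³ in 2ε `U j`.
  U₁ U₂ U₃ : ℕ → ℤ
  U₁ j = + 2 Z.* (+ u j) Z.^ p′ Z.+ + 2 Z.* (+ v j) Z.^ p′ Z.- + 4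
  U₂ j = -[1+ 1 ] Z.* (+ u j) Z.^ suc k Z.+ -[1+ 1 ] Z.* (+ v j) Z.^ suc k
  U₃ j = + 2 Z.* (+ u j) Z.^ k Z.+ + 2 Z.* (+ v j) Z.^ k

  U-expand : ∀ j → ε * (ι (+ 2) * U j) ≈ cubic (U₁ j) (U₂ j) (U₃ j)
  U-expand j = begin
    ε * (ι (+ 2) * U j)
      ≈⟨ *-congˡ (*-congˡ (+-congʳ (+-cong (^-cong p′ (+-congʳ (ν≈ι (u j)))) (^-cong p′ (+-congʳ (ν≈ι (v j))))))) ⟩
    ε * (ι (+ 2) * ((ι (+ u j) + ε) ^ p′ + (ι (+ v j) + ε) ^ p′ - ι (+ 2)))
      ≈⟨ solve 3 (λ ε x y → ε :* (:n 2 :* (x :+ y :- :n 2)) := ε :* (:n 2 :* x) :+ ε :* (:n 2 :* y)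
           :+ (ε :* :- :n 4 :+ ε :* ε :* :n 0 :+ ε :* ε :* ε :* :n 0)) refl ε _ _ ⟩
    ε * (ι (+ 2) * (ι (+ u j) + ε) ^ p′) + ε * (ι (+ 2) * (ι (+ v j) + ε) ^ p′)
      + (ε * - ι (+ 4) + ε * ε * ι (+ 0) + ε * ε * ε * ι (+ 0))
      ≈⟨ +-cong (+-cong (ι-expand (+ u j)) (ι-expand (+ v j)))
                (+-congʳ (+-congʳ (*-congˡ (sym (ι-neg (+ 4)))))) ⟩
    cubic _ _ _ + cubic _ _ _ + cubic (ℤ.- + 4) (+ 0) (+ 0)
      ≈⟨ +-congʳ (cubic-+ _ _ _ _ _ _) ⟩
    cubic (+ 2 Z.* (+ u j) Z.^ p′ Z.+ + 2 Z.* (+ v j) Z.^ p′) (U₂ j) (U₃ j) + cubic (ℤ.- + 4) (+ 0) (+ 0)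
      ≈⟨ cubic-+ _ _ _ _ _ _ ⟩
    cubic (U₁ j) (U₂ j Z.+ + 0) (U₃ j Z.+ + 0)
      ≡⟨ ≡.cong₂ (cubic (U₁ j)) (ℤₚ.+-identityʳ (U₂ j)) (ℤₚ.+-identityʳ (U₃ j)) ⟩
    cubic (U₁ j) (U₂ j) (U₃ j) ∎

  coefficient₀ coefficient₁ : ℤ
  coefficient₀ = proj₁ (taylor-q p p)
  coefficient₁ = proj₁ (proj₂ (taylor-q p p))

  -- Twice `q-alternating`, compared coefficientwise. The factor ε in front of q(ε²) moves
  -- `coefficient₁` to ε³, and the Taylor remainder carries ε⁵ = 0.
  q-cubic : Σ ℤ λ a → Σ ℤ λ b →
    cubic a b (+ 4 Z.* coefficient₁ Z.+ Z.∑ p (λ j → sgn j Z.* U₃ j)) ≈ ι (+ 0)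
  q-cubic = _ , _ , (begin
    cubic (+ 4 Z.* coefficient₀ Z.+ Z.∑ p (λ j → sgn j Z.* U₁ j))
          (+ 0 Z.+ Z.∑ p (λ j → sgn j Z.* U₂ j))
          (+ 4 Z.* coefficient₁ Z.+ Z.∑ p (λ j → sgn j Z.* U₃ j))
      ≈⟨ cubic-+ (+ 4 Z.* coefficient₀) (+ 0) (+ 4 Z.* coefficient₁) _ _ _ ⟨
    cubic (+ 4 Z.* coefficient₀) (+ 0) (+ 4 Z.* coefficient₁) + cubic _ _ _
      ≈⟨ +-cong (begin
           cubic (+ 4 Z.* coefficient₀) (+ 0) (+ 4 Z.* coefficient₁)
             ≈⟨ +-cong (+-congʳ (*-congˡ (ι-* (+ 4) coefficient₀))) (*-congˡ (ι-* (+ 4) coefficient₁)) ⟩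
           ε * (ι (+ 4) * ι coefficient₀) + ε * ε * ι (+ 0) + ε * ε * ε * (ι (+ 4) * ι coefficient₁)
             ≈⟨ solve 4 (λ ε a b z → ε :* (:n 4 :* a) :+ ε :* ε :* :n 0 :+ ε :* ε :* ε :* (:n 4 :* b)
                  := :n 2 :* (:n 2 :* (ε :* (a :+ b :* (ε :* ε) :+ ε :* ε :* (ε :* ε) :* z)))
                     :- :n 4 :* (ε :* ε :* ε :* ε) :* (ε :* z)) refl ε _ _ rest ⟩
           _ - ι (+ 4) * (ε * ε * ε * ε) * (ε * rest)
             ≈⟨ -‿cong₂ (*-congˡ (*-congˡ (*-congˡ (sym (proj₂ (expansion A (ε * ε)))))))
                  (*-congʳ (*-congˡ ε⁴≈0)) ⟩
           ι (+ 2) * (ι (+ 2) * (ε * q X (ε * ε) p)) - ι (+ 4) * ι (+ 0) * (ε * rest)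
             ≈⟨ solve 2 (λ x y → x :- :n 4 :* :n 0 :* y := x) refl _ _ ⟩
           ι (+ 2) * (ι (+ 2) * (ε * q X (ε * ε) p))
             ≈⟨ *-congˡ q-alternating ⟩
           ι (+ 2) * S ∎)
         (begin
           cubic _ _ _
             ≈⟨ cubic-∑ p (λ j → sgn j Z.* U₁ j) (λ j → sgn j Z.* U₂ j) (λ j → sgn j Z.* U₃ j) ⟨
           ∑ p (λ j → cubic (sgn j Z.* U₁ j) (sgn j Z.* U₂ j) (sgn j Z.* U₃ j))
             ≈⟨ ∑-cong p (λ j _ → begin
                  _                                     ≈⟨ cubic-* (sgn j) (U₁ j) (U₂ j) (U₃ j) ⟨
                  ι (sgn j) * cubic (U₁ j) (U₂ j) (U₃ j) ≈⟨ *-congˡ (sym (U-expand j)) ⟩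
                  ι (sgn j) * (ε * (ι (+ 2) * U j))
                    ≈⟨ solve 3 (λ s ε u → s :* (ε :* (:n 2 :* u)) := :- :n 2 :* (s :* :- (ε :* u))) refl _ ε _ ⟩
                  - ι (+ 2) * (ι (sgn j) * - (ε * U j)) ∎) ⟩
           ∑ p (λ j → - ι (+ 2) * (ι (sgn j) * - (ε * U j)))
             ≈⟨ ∑-*ˡ p (- ι (+ 2)) _ ⟩
           - ι (+ 2) * S ∎) ⟩
    ι (+ 2) * S + - ι (+ 2) * S
      ≈⟨ solve 1 (λ x → :n 2 :* x :+ :- :n 2 :* x := :n 0) refl S ⟩
    ι (+ 0) ∎)
    where
    expansion = proj₂ (proj₂ (taylor-q p p))
    rest = proj₁ (expansion A (ε * ε))
    S = ∑ p (λ j → ι (sgn j) * - (ε * U j))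

  -- Splitting 16i² - ε² = (4i+ε)(4i-ε) gives two products, each equal to ε^(p-1) - 1 = -1.
  G-ε² : G A p′ (ε * ε) ≈ ι (+ 1)
  G-ε² = begin
    ∏ p′ (λ i → ι (+ 16) * (ν (suc i) * ν (suc i)) - ε * ε)
      ≈⟨ ∏-cong p′ (λ i _ → solve 2 (λ i ε → let 4# = :n 0 :+ :n 1 :+ :n 1 :+ :n 1 :+ :n 1 in
           :n 16 :* (i :* i) :- ε :* ε := (ε :+ 4# :* i) :* (:- ε :+ 4# :* i)) refl (ν (suc i)) ε) ⟩
    ∏ p′ (λ i → (ε + ν 4 * ν (suc i)) * (- ε + ν 4 * ν (suc i)))
      ≈⟨ ∏-* p′ _ _ ⟩
    ∏ p′ (λ i → ε + ν 4 * ν (suc i)) * ∏ p′ (λ i → - ε + ν 4 * ν (suc i))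
      ≈⟨ *-cong (lagrange (suc m) p′≡ p∤4 ε) (lagrange (suc m) p′≡ p∤4 (- ε)) ⟩
    (ε ^ p′ - ι (+ 1)) * ((- ε) ^ p′ - ι (+ 1))
      ≈⟨ *-cong (+-congʳ ε^p′≈0) (+-congʳ (trans (even-power ε) ε^p′≈0)) ⟩
    (ι (+ 0) - ι (+ 1)) * (ι (+ 0) - ι (+ 1))
      ≈⟨ solve 0 ((:n 0 :- :n 1) :* (:n 0 :- :n 1) := :n 1) refl ⟩
    ι (+ 1) ∎

  -- Constancy of `G` at ε² forces g₀ to be 1 and g₁ to be 0 modulo p; the latter makes D(p²) and
  -- D(0) agree modulo p³.
  G-cubic : let g₀ , g₁ , _ = taylor-G p′ in
    cubic (g₀ ℤ.- + 1) (+ 0) g₁ ≈ ι (+ 0)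
  G-cubic = begin
    ε * ι (g₀ ℤ.- + 1) + ε * ε * ι (+ 0) + ε * ε * ε * ι g₁
      ≈⟨ +-congʳ (+-congʳ (*-congˡ (trans (ι-+ g₀ (ℤ.- + 1)) (+-congˡ (ι-neg (+ 1)))))) ⟩
    ε * (ι g₀ - ι (+ 1)) + ε * ε * ι (+ 0) + ε * ε * ε * ι g₁
      ≈⟨ solve 4 (λ ε a b z → ε :* (a :- :n 1) :+ ε :* ε :* :n 0 :+ ε :* ε :* ε :* b :=
           ε :* (a :+ b :* (ε :* ε) :+ ε :* ε :* (ε :* ε) :* z) :- ε :- (ε :* ε :* ε :* ε) :* (ε :* z))
           refl ε (ι g₀) (ι g₁) z ⟩
    ε * (ι g₀ + ι g₁ * (ε * ε) + ε * ε * (ε * ε) * z) - ε - ε * ε * ε * ε * (ε * z)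
      ≈⟨ -‿cong₂ (+-congʳ (*-congˡ (trans (sym (proj₂ (expansion A (ε * ε)))) G-ε²))) (*-congʳ ε⁴≈0) ⟩
    ε * ι (+ 1) - ε - ι (+ 0) * (ε * z)
      ≈⟨ solve 2 (λ ε y → ε :* :n 1 :- ε :- :n 0 :* y := :n 0) refl ε _ ⟩
    ι (+ 0) ∎
    where
    g₀ = proj₁ (taylor-G p′)
    g₁ = proj₁ (proj₂ (taylor-G p′))
    expansion = proj₂ (proj₂ (taylor-G p′))
    z = proj₁ (expansion A (ε * ε))

-- Quotients and quadratic extensions of rings

record RingLaws {Γ : Set} (_≈_ : Γ → Γ → Set) (_+_ _*_ : Γ → Γ → Γ) (-_ : Γ → Γ) (0# 1# : Γ) : Set where
  field
    isEquivalence : IsEquivalence _≈_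
    +-cong      : ∀ {a b c d} → a ≈ b → c ≈ d → (a + c) ≈ (b + d)
    *-cong      : ∀ {a b c d} → a ≈ b → c ≈ d → (a * c) ≈ (b * d)
    neg-cong    : ∀ {a b} → a ≈ b → (- a) ≈ (- b)
    +-assoc     : ∀ a b c → ((a + b) + c) ≈ (a + (b + c))
    +-comm      : ∀ a b → (a + b) ≈ (b + a)
    +-identityˡ : ∀ a → (0# + a) ≈ a
    +-inverseˡ  : ∀ a → ((- a) + a) ≈ 0#
    *-assoc     : ∀ a b c → ((a * b) * c) ≈ (a * (b * c))
    *-comm      : ∀ a b → (a * b) ≈ (b * a)
    *-identityˡ : ∀ a → (1# * a) ≈ a
    distribˡ    : ∀ a b c → (a * (b + c)) ≈ ((a * b) + (a * c))

  setoid : Setoid 0ℓ 0ℓ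
  setoid = record { isEquivalence = isEquivalence }

  commutativeRing : CommutativeRing 0ℓ 0ℓ
  commutativeRing = record
    { isCommutativeRing = record
      { isRing = record
        { +-isAbelianGroup = record
          { isGroup = record
            { isMonoid = record
              { isSemigroup = record
                { isMagma = record { isEquivalence = isEquivalence ; ∙-cong = +-cong }
                ; assoc = +-assoc }
              ; identity = comm∧idˡ⇒id +-comm +-identityˡ }
            ; inverse = comm∧invˡ⇒inv +-comm +-inverseˡ
            ; ⁻¹-cong = neg-cong }
          ; comm = +-comm }
        ; *-cong = *-cong
        ; *-assoc = *-assoc
        ; *-identity = comm∧idˡ⇒id *-comm *-identityˡ
        ; distrib = comm∧distrˡ⇒distr +-cong *-comm distribˡ }
      ; *-comm = *-comm } }
    where open Consequences setoid

module _ (A : ℤ-Algebra) where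
  open Over A

  infix 4 _≈_mod_
  _≈_mod_ : Carrier → Carrier → ℤ → Set
  a ≈ b mod n = Σ Carrier λ z → a ≈ b + z * ι n

  -- The carrier is unchanged and equality carries its cofactor, from which `detects` reads off the
  -- multiple of p.
  modulo : ℤ → ℤ-Algebra
  modulo n = record
    { commutativeRing = RingLaws.commutativeRing {_≈_ = λ a b → a ≈ b mod n} {_+_} {_*_} { -_} {ι (+ 0)} {ι (+ 1)} (record
      { isEquivalence = record
        { refl  = lift refl
        ; sym   = λ (z , p) → - z , (begin
            _ ≈⟨ solve 3 (λ b z n → b := b :+ z :* n :+ :- z :* n) refl _ z (ι n) ⟩
            _ ≈⟨ +-congʳ (sym p) ⟩
            _ ∎)
        ; trans = λ (z , p) (w , q) → w + z , trans p (trans (+-congʳ q)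
            (solve 4 (λ c z w n → c :+ w :* n :+ z :* n := c :+ (w :+ z) :* n) refl _ z w (ι n))) }
      ; +-cong = λ (z , p) (w , q) → z + w , trans (+-cong p q)
          (solve 5 (λ b z d w n → b :+ z :* n :+ (d :+ w :* n) := b :+ d :+ (z :+ w) :* n) refl _ z _ w (ι n))
      ; *-cong = λ {a} {b} {c} {d} (z , p) (w , q) → b * w + z * d + z * w * ι n , trans (*-cong p q)
          (solve 5 (λ b z d w n → (b :+ z :* n) :* (d :+ w :* n)
             := b :* d :+ (b :* w :+ z :* d :+ z :* w :* n) :* n) refl b z d w (ι n))
      ; neg-cong = λ (z , p) → - z , trans (-‿cong p)
          (solve 3 (λ b z n → :- (b :+ z :* n) := :- b :+ :- z :* n) refl _ z (ι n))
      ; +-assoc = λ a b c → lift (solve 3 (λ a b c → a :+ b :+ c := a :+ (b :+ c)) refl a b c)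
      ; +-comm = λ a b → lift (solve 2 (λ a b → a :+ b := b :+ a) refl a b)
      ; +-identityˡ = λ a → lift (solve 1 (λ a → :n 0 :+ a := a) refl a)
      ; +-inverseˡ = λ a → lift (solve 1 (λ a → :- a :+ a := :n 0) refl a)
      ; *-assoc = λ a b c → lift (solve 3 (λ a b c → a :* b :* c := a :* (b :* c)) refl a b c)
      ; *-comm = λ a b → lift (solve 2 (λ a b → a :* b := b :* a) refl a b)
      ; *-identityˡ = λ a → lift (solve 1 (λ a → :n 1 :* a := a) refl a)
      ; distribˡ = λ a b c → lift (solve 3 (λ a b c → a :* (b :+ c) := a :* b :+ a :* c) refl a b c) })
    ; ι = ι
    ; ι-+ = λ a b → lift (ι-+ a b)
    ; ι-* = λ a b → lift (ι-* a b)
    ; ι-neg = λ a → lift (ι-neg a)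
    ; ι-0 = lift refl
    ; ι-1 = lift refl }
    where
    lift : ∀ {a b} → a ≈ b → a ≈ b mod n
    lift {a} {b} p = ι (+ 0) , trans p (solve 2 (λ b n → b := b :+ :n 0 :* n) refl b (ι n))

  -- Adjoins a square root x of d; the pair (a , b) stands for a + b x.
  quadratic : Carrier → ℤ-Algebra
  quadratic d = record
    { commutativeRing = RingLaws.commutativeRing {Carrier × Carrier}
        {λ (a , b) (a′ , b′) → a ≈ a′ × b ≈ b′}
        {λ (a , b) (a′ , b′) → a + a′ , b + b′}
        {λ (a , b) (a′ , b′) → a * a′ + d * (b * b′) , a * b′ + b * a′}
        {λ (a , b) → - a , - b} {ι (+ 0) , ι (+ 0)} {ι (+ 1) , ι (+ 0)} (record
      { isEquivalence = record
        { refl = refl , refl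
        ; sym = λ (p , q) → sym p , sym q
        ; trans = λ (p , q) (p′ , q′) → trans p p′ , trans q q′ }
      ; +-cong = λ (p , q) (p′ , q′) → +-cong p p′ , +-cong q q′
      ; *-cong = λ (p , q) (p′ , q′) →
          +-cong (*-cong p p′) (*-congˡ (*-cong q q′)) , +-cong (*-cong p q′) (*-cong q p′)
      ; neg-cong = λ (p , q) → -‿cong p , -‿cong q
      ; +-assoc = λ _ _ _ → assoc⁺ , assoc⁺
      ; +-comm = λ _ _ → comm⁺ , comm⁺
      ; +-identityˡ = λ _ → id⁺ , id⁺
      ; +-inverseˡ = λ _ → inv⁺ , inv⁺
      ; *-assoc = λ (a , b) (a′ , b′) (a″ , b″) →
          solve 7 (λ d a b a′ b′ a″ b″ →
            (a :* a′ :+ d :* (b :* b′)) :* a″ :+ d :* ((a :* b′ :+ b :* a′) :* b″)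
            := a :* (a′ :* a″ :+ d :* (b′ :* b″)) :+ d :* (b :* (a′ :* b″ :+ b′ :* a″)))
            refl d a b a′ b′ a″ b″ ,
          solve 7 (λ d a b a′ b′ a″ b″ →
            (a :* a′ :+ d :* (b :* b′)) :* b″ :+ (a :* b′ :+ b :* a′) :* a″
            := a :* (a′ :* b″ :+ b′ :* a″) :+ b :* (a′ :* a″ :+ d :* (b′ :* b″)))
            refl d a b a′ b′ a″ b″
      ; *-comm = λ (a , b) (a′ , b′) →
          solve 5 (λ d a b a′ b′ → a :* a′ :+ d :* (b :* b′) := a′ :* a :+ d :* (b′ :* b)) refl d a b a′ b′ ,
          solve 4 (λ a b a′ b′ → a :* b′ :+ b :* a′ := a′ :* b :+ b′ :* a) refl a b a′ b′
      ; *-identityˡ = λ (a , b) →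
          solve 3 (λ d a b → :n 1 :* a :+ d :* (:n 0 :* b) := a) refl d a b ,
          solve 2 (λ a b → :n 1 :* b :+ :n 0 :* a := b) refl a b
      ; distribˡ = λ (a , b) (a′ , b′) (a″ , b″) →
          solve 7 (λ d a b a′ b′ a″ b″ → a :* (a′ :+ a″) :+ d :* (b :* (b′ :+ b″))
            := a :* a′ :+ d :* (b :* b′) :+ (a :* a″ :+ d :* (b :* b″))) refl d a b a′ b′ a″ b″ ,
          solve 6 (λ a b a′ b′ a″ b″ → a :* (b′ :+ b″) :+ b :* (a′ :+ a″)
            := a :* b′ :+ b :* a′ :+ (a :* b″ :+ b :* a″)) refl a b a′ b′ a″ b″ })
    ; ι = λ z → ι z , ι (+ 0)
    ; ι-+ = λ a b → ι-+ a b , solve 0 (:n 0 := :n 0 :+ :n 0) refl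
    ; ι-* = λ a b → trans (ι-* a b) (solve 3 (λ d a b → a :* b := a :* b :+ d :* (:n 0 :* :n 0)) refl d _ _) ,
                    solve 2 (λ a b → :n 0 := a :* :n 0 :+ :n 0 :* b) refl (ι a) (ι b)
    ; ι-neg = λ a → ι-neg a , solve 0 (:n 0 := :- :n 0) refl
    ; ι-0 = refl , refl
    ; ι-1 = refl , refl }
    where
    assoc⁺ : ∀ {a b c} → a + b + c ≈ a + (b + c)
    assoc⁺ = solve 3 (λ a b c → a :+ b :+ c := a :+ (b :+ c)) refl _ _ _
    comm⁺ : ∀ {a b} → a + b ≈ b + a
    comm⁺ = solve 2 (λ a b → a :+ b := b :+ a) refl _ _
    id⁺ : ∀ {a} → ι (+ 0) + a ≈ a
    id⁺ = solve 1 (λ a → :n 0 :+ a := a) refl _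
    inv⁺ : ∀ {a} → - a + a ≈ ι (+ 0)
    inv⁺ = solve 1 (λ a → :- a :+ a := :n 0) refl _

  module Quadratic (d : Carrier) where
    private module Q = Over (quadratic d)

    embed : Carrier → Q.Carrier
    embed a = a , ι (+ 0)

    root : Q.Carrier
    root = ι (+ 0) , ι (+ 1)

    root² : root Q.* root Q.≈ embed d
    root² = solve 1 (λ d → :n 0 :* :n 0 :+ d :* (:n 1 :* :n 1) := d) refl d ,
            solve 0 (:n 0 :* :n 1 :+ :n 1 :* :n 0 := :n 0) refl

    embed-* : ∀ a b → embed a Q.* embed b Q.≈ embed (a * b)
    embed-* a b = solve 3 (λ d a b → a :* b :+ d :* (:n 0 :* :n 0) := a :* b) refl d a b ,
                  solve 2 (λ a b → a :* :n 0 :+ :n 0 :* b := :n 0) refl a b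

    embed-+ : ∀ a b → embed a Q.+ embed b Q.≈ embed (a + b)
    embed-+ a b = refl , solve 0 (:n 0 :+ :n 0 := :n 0) refl

    embed-cong : ∀ {a b} → a ≈ b → embed a Q.≈ embed b
    embed-cong p = p , refl

    embed+root : ∀ a b → embed a Q.+ root Q.* embed b Q.≈ (a , b)
    embed+root a b =
      solve 3 (λ d a b → a :+ (:n 0 :* b :+ d :* (:n 1 :* :n 0)) := a) refl d a b ,
      solve 1 (λ b → :n 0 :+ (:n 0 :* :n 0 :+ :n 1 :* b) := b) refl b

-- Reflection and splitting of indices

sgn-+ : ∀ m n → sgn (m ℕ.+ n) ≡ sgn m ℤ.* sgn n
sgn-+ zero    n = ≡.sym (ℤₚ.*-identityˡ (sgn n))
sgn-+ (suc m) n = ≡.trans (≡.cong ℤ.-_ (sgn-+ m n)) (ℤₚ.neg-distribˡ-* (sgn m) (sgn n))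

sgn-² : ∀ n → sgn n ℤ.* sgn n ≡ + 1
sgn-² n = ≡.trans (≡.sym (sgn-+ n n)) (sgn-double n)

sgn-reflect : ∀ {n} m j → n ≡ m ℕ.+ m → j ≤ n → sgn (n ∸ j) ≡ sgn j
sgn-reflect {n} m j n≡ j≤n = begin
  sgn (n ∸ j)                      ≡⟨ ≡.sym (ℤₚ.*-identityʳ _) ⟩
  sgn (n ∸ j) ℤ.* + 1              ≡⟨ ≡.cong (sgn (n ∸ j) ℤ.*_) (≡.sym (sgn-² j)) ⟩
  sgn (n ∸ j) ℤ.* (sgn j ℤ.* sgn j) ≡⟨ ≡.sym (ℤₚ.*-assoc (sgn (n ∸ j)) (sgn j) (sgn j)) ⟩
  sgn (n ∸ j) ℤ.* sgn j ℤ.* sgn j  ≡⟨ ≡.cong (ℤ._* sgn j) (≡.sym (sgn-+ (n ∸ j) j)) ⟩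
  sgn (n ∸ j ℕ.+ j) ℤ.* sgn j      ≡⟨ ≡.cong (λ k → sgn k ℤ.* sgn j) (≡.trans (ℕₚ.m∸n+n≡m j≤n) n≡) ⟩
  sgn (m ℕ.+ m) ℤ.* sgn j          ≡⟨ ≡.cong (ℤ._* sgn j) (sgn-double m) ⟩
  + 1 ℤ.* sgn j                    ≡⟨ ℤₚ.*-identityˡ (sgn j) ⟩
  sgn j ∎
  where open ≡.≡-Reasoning

module Reindexing (A : ℤ-Algebra) where
  open Over A
  open Powers A

  ∑-reverse : ∀ n f → ∑ (suc n) f ≈ ∑ (suc n) (λ i → f (n ∸ i))
  ∑-reverse zero    f = refl
  ∑-reverse (suc n) f = begin
    ∑ (suc (suc n)) f
      ≈⟨ ∑-head (suc n) f ⟩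
    f 0 + ∑ (suc n) (λ i → f (suc i))
      ≈⟨ +-congˡ (∑-reverse n (λ i → f (suc i))) ⟩
    f 0 + ∑ (suc n) (λ i → f (suc (n ∸ i)))
      ≈⟨ solve 2 (λ a b → a :+ b := b :+ a) refl _ _ ⟩
    ∑ (suc n) (λ i → f (suc (n ∸ i))) + f 0
      ≈⟨ +-cong (∑-cong (suc n) (λ i i≤n → reflexive (≡.cong f (≡.sym (ℕₚ.+-∸-assoc 1 (ℕₚ.≤-pred i≤n))))))
                (reflexive (≡.cong f (≡.sym (ℕₚ.n∸n≡0 n)))) ⟩
    ∑ (suc (suc n)) (λ i → f (suc n ∸ i)) ∎

  ∏-head : ∀ n f → ∏ (suc n) f ≈ f 0 * ∏ n (λ i → f (suc i))
  ∏-head zero    f = solve 1 (λ x → :n 1 :* x := x :* :n 1) refl (f 0)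
  ∏-head (suc n) f = trans (*-congʳ (∏-head n f))
    (solve 3 (λ a b c → a :* b :* c := a :* (b :* c)) refl _ _ _)

  ∏-split : ∀ m n f → ∏ (m ℕ.+ n) f ≈ ∏ m f * ∏ n (λ i → f (m ℕ.+ i))
  ∏-split m zero    f = trans (reflexive (≡.cong (λ k → ∏ k f) (ℕₚ.+-identityʳ m)))
    (solve 1 (λ x → x := x :* :n 1) refl _)
  ∏-split m (suc n) f = trans (reflexive (≡.cong (λ k → ∏ k f) (ℕₚ.+-suc m n)))
    (trans (*-congʳ (∏-split m n f)) (solve 3 (λ a b c → a :* b :* c := a :* (b :* c)) refl _ _ _))

-- The rings ℤ/p and (ℤ/p)[ε]/(ε⁴)

residues : ∀ p → Residues p
residues p = record
  { algebra = modulo ℤ-algebra (+ p)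
  ; p≈0     = F.trans {F.ν p} {+ p} {+ 0} (F.ν≈ι p) (+ 1 , ≡.sym (≡.trans (ℤₚ.+-identityˡ _) (ℤₚ.*-identityˡ (+ p))))
  ; detects = λ a (w , a≡) → w , ≡.trans a≡ (ℤₚ.+-identityˡ (w ℤ.* + p)) }
  where module F = Over (modulo ℤ-algebra (+ p))

module Cubic (F : ℤ-Algebra) where
  -- Adjoins η with η² = 0; `K` then adjoins ε with ε² = η, so that ε⁴ = 0 and 1, η, ε, εη is a
  -- basis of `K` over `F`.
  B : ℤ-Algebra
  B = quadratic F (Over.ι F (+ 0))
  private
    module F = Over F
    module QB = Quadratic F (F.ι (+ 0))
    module B = Over B

  K : ℤ-Algebra
  K = quadratic B QB.root
  private
    module QK = Quadratic B QB.root
    module K = Over K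

  ε : K.Carrier
  ε = QK.root

  ν≈0 : ∀ n → F.ν n F.≈ F.ι (+ 0) → K.ν n K.≈ K.ι (+ 0)
  ν≈0 n n≈0 = K.trans {K.ν n} {K.ι (+ n)} {K.ι (+ 0)} (K.ν≈ι n)
    ((F.trans (F.sym (F.ν≈ι n)) n≈0 , F.refl) , (F.refl , F.refl))

  ε⁴≈0 : ε K.* ε K.* ε K.* ε K.≈ K.ι (+ 0)
  ε⁴≈0 = begin
    ε K.* ε K.* ε K.* ε                   ≈⟨ regroup K ε ⟩
    (ε K.* ε) K.* (ε K.* ε)               ≈⟨ K.*-cong QK.root² QK.root² ⟩
    QK.embed QB.root K.* QK.embed QB.root ≈⟨ QK.embed-* QB.root QB.root ⟩
    QK.embed (QB.root B.* QB.root)        ≈⟨ QK.embed-cong QB.root² ⟩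
    K.ι (+ 0) ∎
    where
    open K using (begin_; step-≈-⟩; step-≈-⟨; _∎)
    regroup : ∀ A → let open Over A in ∀ ε → ε * ε * ε * ε ≈ (ε * ε) * (ε * ε)
    regroup A = let open Over A in
      solve 1 (λ ε → ε :* ε :* ε :* ε := (ε :* ε) :* (ε :* ε)) refl

  -- The element equals bη + ε(a + cη), so a and c are two of its coordinates.
  cubic-injective : ∀ a b c →
    ε K.* K.ι a K.+ ε K.* ε K.* K.ι b K.+ ε K.* ε K.* ε K.* K.ι c K.≈ K.ι (+ 0) →
    F.ι a F.≈ F.ι (+ 0) × F.ι c F.≈ F.ι (+ 0)
  cubic-injective a b c eq = F.trans (F.sym (proj₁ B-part)) (proj₁ (proj₂ K-part)) ,
                             F.trans (F.sym (proj₂ B-part)) (proj₂ (proj₂ K-part))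
    where
    open K using (begin_; step-≈-⟩; step-≈-⟨; _∎)
    regroup : ∀ A → let open Over A in ∀ ε a b c →
      ε * ε * b + ε * (a + ε * ε * c) ≈ ε * a + ε * ε * b + ε * ε * ε * c
    regroup A = let open Over A in
      solve 4 (λ ε a b c → ε :* ε :* b :+ ε :* (a :+ ε :* ε :* c)
        := ε :* a :+ ε :* ε :* b :+ ε :* ε :* ε :* c) refl
    B-part : B.ι a B.+ QB.root B.* B.ι c B.≈ (F.ι a , F.ι c)
    B-part = QB.embed+root (F.ι a) (F.ι c)
    K-part : (QB.root B.* B.ι b , B.ι a B.+ QB.root B.* B.ι c) K.≈ K.ι (+ 0)
    K-part = begin
      _ ≈⟨ QK.embed+root _ _ ⟨
      QK.embed (QB.root B.* B.ι b) K.+ ε K.* QK.embed (B.ι a B.+ QB.root B.* B.ι c)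
        ≈⟨ K.+-cong (QK.embed-* _ _) (K.*-congˡ (K.trans (K.+-congˡ (QK.embed-* _ _)) (QK.embed-+ _ _))) ⟨
      QK.embed QB.root K.* K.ι b K.+ ε K.* (K.ι a K.+ QK.embed QB.root K.* K.ι c)
        ≈⟨ K.+-cong (K.*-congʳ QK.root²) (K.*-congˡ (K.+-congˡ (K.*-congʳ QK.root²))) ⟨
      ε K.* ε K.* K.ι b K.+ ε K.* (K.ι a K.+ ε K.* ε K.* K.ι c)
        ≈⟨ regroup K ε (K.ι a) (K.ι b) (K.ι c) ⟩
      ε K.* K.ι a K.+ ε K.* ε K.* K.ι b K.+ ε K.* ε K.* ε K.* K.ι c
        ≈⟨ eq ⟩
      K.ι (+ 0) ∎

cubicResidues : ∀ p → CubicResidues p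
cubicResidues p = record
  { algebra = Cubic.K F
  ; p≈0     = Cubic.ν≈0 F p (Residues.p≈0 (residues p))
  ; ε       = Cubic.ε F
  ; ε⁴≈0    = Cubic.ε⁴≈0 F
  ; detects = λ a b c eq → let a≈0 , c≈0 = Cubic.cubic-injective F a b c eq in
      Residues.detects (residues p) a a≈0 , Residues.detects (residues p) c c≈0 }
  where
  F = Residues.algebra (residues p)

-- Coefficients modulo p

module Congruences {p′ : ℕ} (prime-p : Prime (suc p′)) (m : ℕ)
    (p′≡ : p′ ≡ suc (suc m) ℕ.+ suc (suc m))
    (𝔽 : Residues (suc p′)) (𝕂 : CubicResidues (suc p′)) where
  private
    module 𝔽 = Residues 𝔽
    module 𝕂 = CubicResidues 𝕂
    module N = Nilpotent prime-p m p′≡ 𝕂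
    module Z = Over ℤ-algebra
  open N using (k; u; v; coefficient₀; coefficient₁; p∤2; p∤4; p′≡2+k) public
  open Over 𝔽.algebra
  open Products 𝔽.algebra
  open Powers 𝔽.algebra
  open Reindexing 𝔽.algebra
  open Characteristic 𝔽.algebra prime-p 𝔽.p≈0
  open Homomorphism 𝔽.algebra

  eulerSum : ℤ
  eulerSum = Z.∑ p (λ j → sgn j Z.* (+ u j) Z.^ k)

  eulerSum′ : Carrier
  eulerSum′ = ∑ p (λ j → ι (sgn j) * ν (u j) ^ k)

  ^-k-even : ∀ x → (- x) ^ k ≈ x ^ k
  ^-k-even = ^-neg-even (suc m)

  -- The substitution of p-1-j for j turns 4j+3 into -(4j+1) modulo p; as k and p-1 are even,
  -- neither the power nor the sign changes.
  reflected : ∑ p (λ j → ι (sgn j) * ν (v j) ^ k) ≈ eulerSum′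
  reflected = trans (∑-reverse p′ _) (∑-cong p (λ j j<p → *-cong
      (reflexive (≡.cong ι (sgn-reflect (suc (suc m)) j p′≡ (ℕₚ.≤-pred j<p))))
      (begin
        ν (v (p′ ∸ j)) ^ k  ≈⟨ ^-cong k (flip j (ℕₚ.≤-pred j<p)) ⟩
        (- ν (u j)) ^ k     ≈⟨ ^-k-even _ ⟩
        ν (u j) ^ k ∎)))
    where
    flip : ∀ j → j ≤ p′ → ν (v (p′ ∸ j)) ≈ - ν (u j)
    flip j j≤p′ = begin
      ν (v (p′ ∸ j))
        ≈⟨ trans (ν-+ 3 (4 ℕ.* (p′ ∸ j))) (+-congˡ (ν-* 4 (p′ ∸ j))) ⟩
      ν 3 + ν 4 * ν (p′ ∸ j)
        ≈⟨ solve 2 (λ d j → let 3# = :n 0 :+ :n 1 :+ :n 1 :+ :n 1 ; 4# = 3# :+ :n 1 in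
             3# :+ 4# :* d := 4# :* ((d :+ j) :+ :n 1) :- (:n 0 :+ :n 1 :+ 4# :* j)) refl _ (ν j) ⟩
      ν 4 * (ν (p′ ∸ j) + ν j + ι (+ 1)) - (ν 1 + ν 4 * ν j)
        ≈⟨ -‿cong₂ (*-congˡ (+-congʳ (trans (sym (ν-+ (p′ ∸ j) j)) (ν-cong (ℕₚ.m∸n+n≡m j≤p′)))))
                   (trans (+-congˡ (sym (ν-* 4 j))) (sym (ν-+ 1 (4 ℕ.* j)))) ⟩
      ν 4 * ν p - ν (u j)
        ≈⟨ +-congʳ (*-congˡ 𝔽.p≈0) ⟩
      ν 4 * ι (+ 0) - ν (u j)
        ≈⟨ solve 2 (λ a b → a :* :n 0 :- b := :- b) refl _ _ ⟩
      - ν (u j) ∎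

  eulerSum≈ : ι eulerSum ≈ eulerSum′
  eulerSum≈ = trans (ι-∑ p _) (∑-cong p (λ j _ → trans (ι-* (sgn j) _)
    (*-congˡ (trans (ι-^ (+ u j) k) (^-cong k (sym (ν≈ι (u j))))))))

  multiple⇒≈0 : ∀ {a} → Multiple p a → ι a ≈ ι (+ 0)
  multiple⇒≈0 (w , ≡.refl) = trans (ι-* w (+ p)) (trans (*-congˡ (trans (sym (ν≈ι p)) 𝔽.p≈0))
    (solve 1 (λ w → w :* :n 0 := :n 0) refl _))

  -- The ε³ part of `q-cubic` contains the sums over 4j+1 and over 4j+3, which agree. It therefore
  -- reads 4(c₁ + `eulerSum`) = 0, and 4 cancels.
  coefficient₁≈ : ι coefficient₁ ≈ - ι eulerSum
  coefficient₁≈ = begin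
    c₁
      ≈⟨ solve 2 (λ x y → x := x :+ y :- y) refl c₁ (ι eulerSum) ⟩
    c₁ + ι eulerSum - ι eulerSum
      ≈⟨ +-congʳ (ν-nonZeroDivisor p∤4 _ (begin
          ν 4 * (c₁ + ι eulerSum)
            ≈⟨ solve 2 (λ x y → (:n 0 :+ :n 1 :+ :n 1 :+ :n 1 :+ :n 1) :* (x :+ y)
                 := :n 4 :* x :+ :n 2 :* (y :+ y)) refl c₁ (ι eulerSum) ⟩
          ι (+ 4) * c₁ + ι (+ 2) * (ι eulerSum + ι eulerSum)
            ≈⟨ +-congˡ (*-congˡ (+-cong eulerSum≈ (trans eulerSum≈ (sym reflected)))) ⟩
          ι (+ 4) * c₁ + ι (+ 2) * (∑ p (λ j → ι (sgn j) * ν (u j) ^ k)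
            + ∑ p (λ j → ι (sgn j) * ν (v j) ^ k))
            ≈⟨ +-congˡ (*-congˡ (∑-+ p _ _)) ⟨
          ι (+ 4) * c₁ + ι (+ 2) * ∑ p (λ j → ι (sgn j) * ν (u j) ^ k + ι (sgn j) * ν (v j) ^ k)
            ≈⟨ +-congˡ (∑-*ˡ p (ι (+ 2)) _) ⟨
          ι (+ 4) * c₁ + ∑ p (λ j → ι (+ 2) * (ι (sgn j) * ν (u j) ^ k + ι (sgn j) * ν (v j) ^ k))
            ≈⟨ +-congˡ (∑-cong p (λ j _ → begin
                 ι (+ 2) * (ι (sgn j) * ν (u j) ^ k + ι (sgn j) * ν (v j) ^ k)
                   ≈⟨ solve 3 (λ s x y → :n 2 :* (s :* x :+ s :* y) := s :* (:n 2 :* x :+ :n 2 :* y)) refl _ _ _ ⟩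
                 ι (sgn j) * (ι (+ 2) * ν (u j) ^ k + ι (+ 2) * ν (v j) ^ k)
                   ≈⟨ *-congˡ (+-cong (power (u j)) (power (v j))) ⟨
                 ι (sgn j) * (ι (+ 2 Z.* (+ u j) Z.^ k) + ι (+ 2 Z.* (+ v j) Z.^ k))
                   ≈⟨ *-congˡ (ι-+ _ _) ⟨
                 ι (sgn j) * ι (N.U₃ j)
                   ≈⟨ ι-* (sgn j) (N.U₃ j) ⟨
                 ι (sgn j Z.* N.U₃ j) ∎)) ⟩
          ι (+ 4) * c₁ + ∑ p (λ j → ι (sgn j Z.* N.U₃ j))
            ≈⟨ +-cong (ι-* (+ 4) coefficient₁) (ι-∑ p (λ j → sgn j Z.* N.U₃ j)) ⟨
          ι (+ 4 Z.* coefficient₁) + ι (Z.∑ p (λ j → sgn j Z.* N.U₃ j))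
            ≈⟨ ι-+ _ _ ⟨
          ι (+ 4 Z.* coefficient₁ Z.+ Z.∑ p (λ j → sgn j Z.* N.U₃ j))
            ≈⟨ multiple⇒≈0 (proj₂ (𝕂.detects _ _ _ (proj₂ (proj₂ N.q-cubic)))) ⟩
          ι (+ 0) ∎)) ⟩
    ι (+ 0) - ι eulerSum
      ≈⟨ solve 1 (λ x → :n 0 :- x := :- x) refl (ι eulerSum) ⟩
    - ι eulerSum ∎
    where
    c₁ = ι coefficient₁
    power : ∀ n → ι (+ 2 Z.* (+ n) Z.^ k) ≈ ι (+ 2) * ν n ^ k
    power n = trans (ι-* (+ 2) _) (*-congˡ (trans (ι-^ (+ n) k) (^-cong k (sym (ν≈ι n)))))

module Central {p′ : ℕ} (prime-p : Prime (suc p′)) (m : ℕ)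
    (p′≡ : p′ ≡ suc (suc m) ℕ.+ suc (suc m))
    (𝔽 : Residues (suc p′)) (𝕂 : CubicResidues (suc p′)) where
  private
    module 𝔽 = Residues 𝔽
    module Z = Over ℤ-algebra
  open Congruences prime-p m p′≡ 𝔽 𝕂 public
  open Over 𝔽.algebra
  open Products 𝔽.algebra
  open Powers 𝔽.algebra
  open Characteristic 𝔽.algebra prime-p 𝔽.p≈0
  open Homomorphism 𝔽.algebra

  h : ℕ
  h = suc (suc m)

  congruent : ∀ a b → ι a ≈ ι b → Multiple p (a ℤ.- b)
  congruent a b a≈b = 𝔽.detects (a ℤ.- b) (trans (ι-∸ a b) (trans (+-congʳ a≈b)
    (solve 1 (λ b → b :- b := :n 0) refl (ι b))))

  coefficient₁-multiple : Multiple p (coefficient₁ ℤ.- (ℤ.- eulerSum))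
  coefficient₁-multiple = congruent coefficient₁ (ℤ.- eulerSum) (trans coefficient₁≈ (sym (ι-neg eulerSum)))

  -- Wilson's theorem for the multiples of ρ: the constant term of x^(p-1) - 1.
  lagrange-0 : ∀ {ρ} → p ∤ ρ → ∏ p′ (λ i → ν ρ * ν (suc i)) ≈ ι -[1+ 0 ]
  lagrange-0 {ρ} p∤ρ = begin
    ∏ p′ (λ i → ν ρ * ν (suc i))
      ≈⟨ ∏-cong p′ (λ i _ → solve 1 (λ x → x := :n 0 :+ x) refl _) ⟩
    ∏ p′ (λ i → ι (+ 0) + ν ρ * ν (suc i))
      ≈⟨ lagrange (suc m) p′≡ p∤ρ (ι (+ 0)) ⟩
    ι (+ 0) ^ p′ - ι (+ 1)
      ≈⟨ +-congʳ (trans (reflexive (≡.cong (ι (+ 0) ^_) p′≡)) (^-zero (suc m ℕ.+ suc (suc m)))) ⟩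
    ι (+ 0) - ι (+ 1)
      ≈⟨ solve 0 (:n 0 :- :n 1 := con -[1+ 0 ]) refl ⟩
    ι -[1+ 0 ] ∎

  J : ℤ
  J = Z.∏ p′ (λ i → + 4 Z.* Z.ν (suc i))

  J-multiple : Multiple p (J ℤ.- -[1+ 0 ])
  J-multiple = congruent J -[1+ 0 ] (trans (ι-∏ p′ _)
    (trans (∏-cong p′ (λ i _ → trans (ι-* (+ 4) (Z.ν (suc i)))
        (*-cong (sym (ν≈ι 4)) (ι-ν (suc i)))))
      (lagrange-0 p∤4)))

  ∏-double : ∀ n → ∏ (n ℕ.+ n) (λ i → ν (suc i)) ≈ ∏ n (λ i → odd i * (ι (+ 2) * ν (suc i)))
  ∏-double zero    = refl
  ∏-double (suc n) = begin
    ∏ (n ℕ.+ suc n) (λ i → ν (suc i)) * ν (suc (n ℕ.+ suc n))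
      ≡⟨ ≡.cong (λ k → ∏ k (λ i → ν (suc i)) * ν (suc k)) (ℕₚ.+-suc n n) ⟩
    ∏ (n ℕ.+ n) (λ i → ν (suc i)) * ν (suc (n ℕ.+ n)) * ν (suc (suc (n ℕ.+ n)))
      ≈⟨ *-cong (*-cong (∏-double n) (+-congʳ (ν-+ n n))) (+-congʳ (+-congʳ (ν-+ n n))) ⟩
    R * (ν n + ν n + ι (+ 1)) * (ν n + ν n + ι (+ 1) + ι (+ 1))
      ≈⟨ solve 2 (λ R n → R :* (n :+ n :+ :n 1) :* (n :+ n :+ :n 1 :+ :n 1)
           := R :* (:odd n :* (:n 2 :* (n :+ :n 1)))) refl R (ν n) ⟩
    R * (odd n * (ι (+ 2) * ν (suc n))) ∎
    where R = ∏ n (λ i → odd i * (ι (+ 2) * ν (suc i)))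

  -- What remains of `c p` after removal of the middle factor, i = h, where -(2i+1) = -p.
  c′ : ℤ
  c′ = Z.∏ h (λ i → Z.- Z.odd i) Z.* Z.∏ h (λ i → Z.- Z.odd (h ℕ.+ suc i))

  ι-neg-odd : ∀ i → ι (Z.- Z.odd i) ≈ - odd i
  ι-neg-odd i = trans (ι-neg (Z.odd i)) (-‿cong (ι-odd i))

  -- Pair index i with h+1+i: since 2(h+1+i)+1 = p + 2(i+1), the pair gives (2i+1)(2i+2) modulo p,
  -- and all pairs together give (p-1)!, which is -1 by Wilson.
  c′-multiple : Multiple p (c′ ℤ.- -[1+ 0 ])
  c′-multiple = congruent c′ -[1+ 0 ] (begin
    ι c′
      ≈⟨ trans (ι-* _ _) (*-cong (ι-∏ h _) (ι-∏ h _)) ⟩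
    ∏ h (λ i → ι (Z.- Z.odd i)) * ∏ h (λ i → ι (Z.- Z.odd (h ℕ.+ suc i)))
      ≈⟨ ∏-* h _ _ ⟨
    ∏ h (λ i → ι (Z.- Z.odd i) * ι (Z.- Z.odd (h ℕ.+ suc i)))
      ≈⟨ ∏-cong h (λ i _ → begin
           ι (Z.- Z.odd i) * ι (Z.- Z.odd (h ℕ.+ suc i))
             ≈⟨ *-cong (ι-neg-odd i) (trans (ι-neg-odd (h ℕ.+ suc i)) (-‿cong (+-congʳ (*-congˡ (ν-+ h (suc i)))))) ⟩
           - odd i * - (ι (+ 2) * (ν h + ν (suc i)) + ι (+ 1))
             ≈⟨ solve 3 (λ o h i → :- o :* :- (:n 2 :* (h :+ i) :+ :n 1)
                  := o :* (h :+ h :+ :n 1 :+ :n 2 :* i)) refl _ _ _ ⟩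
           odd i * (ν h + ν h + ι (+ 1) + ι (+ 2) * ν (suc i))
             ≈⟨ *-congˡ (+-congʳ (trans (+-congʳ (trans (sym (ν-+ h h)) (ν-cong (≡.sym p′≡)))) 𝔽.p≈0)) ⟩
           odd i * (ι (+ 0) + ι (+ 2) * ν (suc i))
             ≈⟨ *-congˡ (solve 1 (λ x → :n 0 :+ x := x) refl _) ⟩
           odd i * (ι (+ 2) * ν (suc i)) ∎) ⟩
    ∏ h (λ i → odd i * (ι (+ 2) * ν (suc i)))
      ≈⟨ ∏-double h ⟨
    ∏ (h ℕ.+ h) (λ i → ν (suc i))
      ≡⟨ ≡.cong (λ n → ∏ n (λ i → ν (suc i))) (≡.sym p′≡) ⟩
    ∏ p′ (λ i → ν (suc i))
      ≈⟨ ∏-cong p′ (λ i _ → solve 1 (λ x → x := (:n 0 :+ :n 1) :* x) refl _) ⟩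
    ∏ p′ (λ i → ν 1 * ν (suc i))
      ≈⟨ lagrange-0 (prime∤1 prime-p) ⟩
    ι -[1+ 0 ] ∎)

-- The partial sum modulo p⁴, denominators cleared

module Assembly {p′ : ℕ} (prime-p : Prime (suc p′)) (m : ℕ)
    (p′≡ : p′ ≡ suc (suc m) ℕ.+ suc (suc m)) (l : ℕ)
    (p′≡l : p′ ≡ 4 ℕ.* l ⊎ p′ ≡ 2 ℕ.+ 4 ℕ.* l)
    (𝔽 : Residues (suc p′)) (𝕂 : CubicResidues (suc p′)) where
  open Central prime-p m p′≡ 𝔽 𝕂 public
  open Over ℤ-algebra
  open Products ℤ-algebra
  open Reindexing ℤ-algebra
  open Evaluation
  private
    p : ℕ
    p = suc p′

    module 𝕂 = CubicResidues 𝕂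
    module N = Nilpotent prime-p m p′≡ 𝕂

  g₀ g₁ : ℤ
  g₀ = proj₁ (taylor-G p′)
  g₁ = proj₁ (proj₂ (taylor-G p′))

  g-multiples : Multiple p (g₀ - + 1) × Multiple p g₁
  g-multiples = 𝕂.detects (g₀ - + 1) (+ 0) g₁ N.G-cubic

  odd-h : odd (h ℕ.+ 0) ≡ + p
  odd-h = begin
    + 2 * ν (h ℕ.+ 0) + + 1 ≡⟨ ≡.cong (λ j → + 2 * ν j + + 1) (ℕₚ.+-identityʳ h) ⟩
    + 2 * ν h + + 1         ≡⟨ solve 1 (λ h → :n 2 :* h :+ :n 1 := h :+ h :+ :n 1) refl (ν h) ⟩
    ν h + ν h + + 1         ≡⟨ ≡.cong (_+ + 1) (ν-+ h h) ⟨
    ν (suc (h ℕ.+ h))       ≡⟨ ≡.cong (λ j → ν (suc j)) p′≡ ⟨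
    ν p                     ≡⟨ ν≡ p ⟩
    + p ∎

  c≡ : c p ≡ - (+ p * c′)
  c≡ = begin
    c p
      ≡⟨ ≡.cong c (≡.trans (≡.cong suc p′≡) (≡.sym (ℕₚ.+-suc h h))) ⟩
    c (h ℕ.+ suc h)
      ≡⟨ ∏-split h (suc h) (λ i → - odd i) ⟩
    A * ∏ (suc h) (λ i → - odd (h ℕ.+ i))
      ≡⟨ ≡.cong (A *_) (∏-head h (λ i → - odd (h ℕ.+ i))) ⟩
    A * (- odd (h ℕ.+ 0) * B)
      ≡⟨ ≡.cong (λ z → A * (- z * B)) odd-h ⟩
    A * (- + p * B)
      ≡⟨ solve 3 (λ A B p → A :* (:- p :* B) := :- (p :* (A :* B))) refl A B (+ p) ⟩
    - (+ p * c′) ∎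
    where A = ∏ h (λ i → - odd i)
          B = ∏ h (λ i → - odd (h ℕ.+ suc i))

  D≡ : ∀ s → D p′ s ≡ J * G ℤ-algebra p′ s
  D≡ s = ∏-* p′ _ _

  D₀ : ℤ
  D₀ = D p′ (+ 0)

  D₀≡ : D₀ ≡ J * g₀
  D₀≡ = ≡.trans (D≡ (+ 0)) (≡.cong (J *_) (≡.trans (proj₂ expansion)
    (solve 3 (λ a b z → a :+ b :* :n 0 :+ :n 0 :* :n 0 :* z := a) refl g₀ g₁ (proj₁ expansion))))
    where expansion = proj₂ (proj₂ (taylor-G p′)) ℤ-algebra (+ 0)

  D₀-multiple : Multiple p (D₀ + + 1)
  D₀-multiple = let a , a≡ = J-multiple ; b , b≡ = proj₁ g-multiples in a * g₀ - b , (begin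
    D₀ + + 1                       ≡⟨ ≡.cong (_+ + 1) D₀≡ ⟩
    J * g₀ + + 1                   ≡⟨ solve 2 (λ J g → J :* g :+ :n 1 := (J :- con -[1+ 0 ]) :* g :- (g :- :n 1)) refl J g₀ ⟩
    (J - -[1+ 0 ]) * g₀ - (g₀ - + 1) ≡⟨ ≡.cong₂ (λ x y → x * g₀ - y) a≡ b≡ ⟩
    a * + p * g₀ - b * + p         ≡⟨ solve 4 (λ a b p g → a :* p :* g :- b :* p := (a :* g :- b) :* p) refl a b (+ p) g₀ ⟩
    (a * g₀ - b) * + p ∎)

  -- Here the index 2 marks values at s = π². One has -ΓQ₀ = -ΓQ₂ + Γ(c₁π² + ...). The first term is
  -- sπD₂, and D₂ is D₀ modulo π³ because π divides g₁. The second is -π³c′c₁ modulo π⁴, where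
  -- modulo π the product c′c₁ is (-1)(-E) = E, that is -D₀E because D₀ is -1. So D₀ splits off from
  -- both.
  combine : ∀ {P₀ Γ Q₀ Q₂ D₀ D₂} s π J g₀ g₁ k₁ y a b d E c₀ c₁ c′ z →
    P₀ ≡ - (Γ * Q₀) → Q₀ ≡ c₀ → Q₂ ≡ c₀ + c₁ * (π * π) + π * π * (π * π) * z →
    - (Γ * Q₂) ≡ s * (π * D₂) → Γ ≡ - (π * c′) →
    D₂ ≡ J * (g₀ + g₁ * (π * π) + π * π * (π * π) * y) → D₀ ≡ J * g₀ → g₁ ≡ k₁ * π →
    c′ - -[1+ 0 ] ≡ a * π → c₁ - - E ≡ b * π → D₀ + + 1 ≡ d * π →
    Σ ℤ λ w → P₀ ≡ D₀ * (s * π + π * π * π * E) + π * π * π * π * w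
  combine {P₀} {Γ} {Q₀} {Q₂} {D₀} {D₂} s π J g₀ g₁ k₁ y a b d E c₀ c₁ c′ z
      P₀≡ Q₀≡ Q₂≡ CQ₂≡ C≡ D₂≡ D₀≡ g₁≡ c′≡ c₁≡ D₀+1≡ = w , (begin
    P₀
      ≡⟨ ≡.trans P₀≡ (≡.cong (λ x → - (Γ * x)) Q₀≡) ⟩
    - (Γ * c₀)
      ≡⟨ solve 4 (λ Γ a x y → :- (Γ :* a) := :- (Γ :* (a :+ x :+ y)) :+ Γ :* (x :+ y)) refl
           Γ c₀ (c₁ * (π * π)) (π * π * (π * π) * z) ⟩
    - (Γ * (c₀ + c₁ * (π * π) + π * π * (π * π) * z)) + Γ * (c₁ * (π * π) + π * π * (π * π) * z)
      ≡⟨ ≡.cong₂ _+_ (≡.trans (≡.cong (λ x → - (Γ * x)) (≡.sym Q₂≡)) CQ₂≡)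
           (≡.cong (_* (c₁ * (π * π) + π * π * (π * π) * z)) C≡) ⟩
    s * (π * D₂) + - (π * c′) * (c₁ * (π * π) + π * π * (π * π) * z)
      ≡⟨ solve 6 (λ s p D c b z → s :* (p :* D) :+ :- (p :* c) :* (b :* (p :* p) :+ p :* p :* (p :* p) :* z)
           := s :* (p :* D) :- p :* p :* p :* (c :* b) :- p :* p :* p :* p :* (p :* c :* z)) refl s π D₂ c′ c₁ z ⟩
    s * (π * D₂) - π * π * π * (c′ * c₁) - π * π * π * π * (π * c′ * z)
      ≡⟨ ≡.cong₂ (λ x v → s * (π * x) - π * π * π * v - π * π * π * π * (π * c′ * z)) D₂≡D₀ c′c₁≡ ⟩
    s * (π * (D₀ + π * π * π * t)) - π * π * π * (d * π * E - D₀ * E + π * r) - π * π * π * π * (π * c′ * z)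
      ≡⟨ solve 8 (λ s p D t d E r x →
           s :* (p :* (D :+ p :* p :* p :* t)) :- p :* p :* p :* (d :* p :* E :- D :* E :+ p :* r) :- p :* p :* p :* p :* x
           := D :* (s :* p :+ p :* p :* p :* E) :+ p :* p :* p :* p :* (s :* t :- d :* E :- r :- x))
           refl s π D₀ t d E r (π * c′ * z) ⟩
    D₀ * (s * π + π * π * π * E) + π * π * π * π * w ∎)
    where
    -- The cofactors: `t` of π³ in D₂ - D₀, `r` of π in c′c₁, and `w` of π⁴ in the result.
    t = J * (k₁ + π * y)
    r = a * b * π - a * E - b
    w = s * t - d * E - r - π * c′ * z
    D₂≡D₀ : D₂ ≡ D₀ + π * π * π * t
    D₂≡D₀ = begin
      D₂ ≡⟨ ≡.trans D₂≡ (≡.cong (λ g → J * (g₀ + g * (π * π) + π * π * (π * π) * y)) g₁≡) ⟩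
      J * (g₀ + k₁ * π * (π * π) + π * π * (π * π) * y)
        ≡⟨ solve 5 (λ J g p k y → J :* (g :+ k :* p :* (p :* p) :+ p :* p :* (p :* p) :* y)
             := J :* g :+ p :* p :* p :* (J :* (k :+ p :* y))) refl J g₀ π k₁ y ⟩
      J * g₀ + π * π * π * t ≡⟨ ≡.cong (_+ π * π * π * t) D₀≡ ⟨
      D₀ + π * π * π * t ∎
    c′c₁≡ : c′ * c₁ ≡ d * π * E - D₀ * E + π * r
    c′c₁≡ = begin
      c′ * c₁
        ≡⟨ solve 3 (λ c x E → c :* x := (c :- con -[1+ 0 ] :- :n 1) :* (x :- :- E :- E)) refl c′ c₁ E ⟩
      (c′ - -[1+ 0 ] - + 1) * (c₁ - - E - E)
        ≡⟨ ≡.cong₂ (λ x y → (x - + 1) * (y - E)) c′≡ c₁≡ ⟩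
      (a * π - + 1) * (b * π - E)
        ≡⟨ solve 5 (λ a b p E D → (a :* p :- :n 1) :* (b :* p :- E)
             := (D :+ :n 1) :* E :- D :* E :+ p :* (a :* b :* p :- a :* E :- b)) refl a b π E D₀ ⟩
      (D₀ + + 1) * E - D₀ * E + π * r
        ≡⟨ ≡.cong (λ x → x * E - D₀ * E + π * r) D₀+1≡ ⟩
      d * π * E - D₀ * E + π * r ∎

  P-evaluation : Σ ℤ λ w → P (+ 0) p ≡
    D₀ * (sgn l * + p + + p * + p * + p * eulerSum) + + p * + p * + p * + p * w
  P-evaluation = combine (sgn l) (+ p) J g₀ g₁ (proj₁ (proj₂ g-multiples)) (proj₁ G-expansion)
      (proj₁ c′-multiple) (proj₁ coefficient₁-multiple) (proj₁ D₀-multiple) eulerSum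
      coefficient₀ coefficient₁ c′ (proj₁ q-expansion)
      (P-zero p′) q-zero (proj₂ q-expansion) (value (+ p) (ν≡ p)) c≡
      (≡.trans (D≡ (+ p * + p)) (≡.cong (J *_) (proj₂ G-expansion))) D₀≡ (proj₂ (proj₂ g-multiples))
      (proj₂ c′-multiple) (proj₂ coefficient₁-multiple) (proj₂ D₀-multiple)
    where
    G-expansion = proj₂ (proj₂ (taylor-G p′)) ℤ-algebra (+ p * + p)
    q-expansion = proj₂ (proj₂ (taylor-q p p)) ℤ-algebra (+ p * + p)
    q-zero : q (top p′) (+ 0) p ≡ coefficient₀
    q-zero = let z , q₀≡ = proj₂ (proj₂ (taylor-q p p)) ℤ-algebra (+ 0) in
      ≡.trans q₀≡ (solve 3 (λ a b z → a :+ b :* :n 0 :+ :n 0 :* :n 0 :* z := a) refl coefficient₀ coefficient₁ z)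
    value : ∀ π → ν p ≡ π → - (c p * q (top p′) (π * π) p) ≡ sgn l * (π * D p′ (π * π))
    value π ≡.refl = Z-value p′ l p′≡l

-- The Legendre symbol of -2

multiple⇒∣ : ∀ {p a} → Multiple p a → p ∣ ℤ.∣ a ∣
multiple⇒∣ {p} (w , ≡.refl) = divides ℤ.∣ w ∣ (ℤₚ.abs-* w (+ p))

∣⇒multiple : ∀ {p a} → p ∣ ℤ.∣ a ∣ → Multiple p a
∣⇒multiple {p} {a} p∣a = Signed._∣_.quotient s , Signed._∣_.equality s
  where s = Signed.∣ᵤ⇒∣ {+ p} {a} p∣a

squareBelow-true : ∀ p a n x → x < n → p ∣ ℤ.∣ + x ℤ.* + x ℤ.- a ∣ → squareBelow p a n ≡ true
squareBelow-true p a (suc n) x x<1+n p∣ with x ℕ.≟ n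
... | yes ≡.refl = ≡.trans (≡.cong (squareBelow p a n ∨_) (dec-true (p ∣? ℤ.∣ + n ℤ.* + n ℤ.- a ∣) p∣)) (∨-zeroʳ (squareBelow p a n))
... | no  x≢n    = ≡.cong (_∨ does (p ∣? ℤ.∣ + n ℤ.* + n ℤ.- a ∣)) (squareBelow-true p a n x (ℕₚ.≤∧≢⇒< (ℕₚ.≤-pred x<1+n) x≢n) p∣)

squareBelow-false : ∀ p a n → (∀ x → x < n → p ∤ ℤ.∣ + x ℤ.* + x ℤ.- a ∣) → squareBelow p a n ≡ false
squareBelow-false p a zero    _   = ≡.refl
squareBelow-false p a (suc n) p∤ = ≡.cong₂ _∨_
  (squareBelow-false p a n (λ x x<n → p∤ x (ℕₚ.m<n⇒m<1+n x<n)))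
  (dec-false (p ∣? ℤ.∣ + n ℤ.* + n ℤ.- a ∣) (p∤ n ℕₚ.≤-refl))

private
  legendre-by : Bool → Bool → ℤ
  legendre-by x y = if x then + 0 else (if y then + 1 else -[1+ 0 ])

legendre-square : ∀ a p → p ∤ ℤ.∣ a ∣ → ∀ x → x < p → p ∣ ℤ.∣ + x ℤ.* + x ℤ.- a ∣ →
  legendre a p ≡ + 1
legendre-square a p p∤a x x<p p∣ =
  ≡.cong₂ legendre-by (dec-false (p ∣? ℤ.∣ a ∣) p∤a) (squareBelow-true p a p x x<p p∣)

legendre-nonsquare : ∀ a p → p ∤ ℤ.∣ a ∣ → (∀ x → x < p → p ∤ ℤ.∣ + x ℤ.* + x ℤ.- a ∣) →
  legendre a p ≡ -[1+ 0 ]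
legendre-nonsquare a p p∤a p∤ =
  ≡.cong₂ legendre-by (dec-false (p ∣? ℤ.∣ a ∣) p∤a) (squareBelow-false p a p p∤)

sgn-cases : ∀ n → sgn n ≡ + 1 ⊎ sgn n ≡ -[1+ 0 ]
sgn-cases zero    = inj₁ ≡.refl
sgn-cases (suc n) with sgn-cases n
... | inj₁ eq = inj₂ (≡.cong ℤ.-_ eq)
... | inj₂ eq = inj₁ (≡.cong ℤ.-_ eq)

module QuadraticResidue {p′ : ℕ} (prime-p : Prime (suc p′)) (m : ℕ)
    (p′≡ : p′ ≡ suc (suc m) ℕ.+ suc (suc m)) (l : ℕ)
    (p′≡l : p′ ≡ 4 ℕ.* l ⊎ p′ ≡ 2 ℕ.+ 4 ℕ.* l)
    (𝔽 : Residues (suc p′)) (𝕂 : CubicResidues (suc p′)) where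
  private
    module 𝔽 = Residues 𝔽
    module Z = Over ℤ-algebra
  open Central prime-p m p′≡ 𝔽 𝕂 using (h; ∏-double; p∤2; congruent; multiple⇒≈0)
  open Over 𝔽.algebra
  open Products 𝔽.algebra
  open Powers 𝔽.algebra
  open Reindexing 𝔽.algebra
  open Characteristic 𝔽.algebra prime-p 𝔽.p≈0
  open Homomorphism 𝔽.algebra

  ∏-neg : ∀ n f → ∏ n (λ i → - f i) ≈ ι (sgn n) * ∏ n f
  ∏-neg zero    f = solve 0 (:n 1 := :n 1 :* :n 1) refl
  ∏-neg (suc n) f = trans (*-congʳ (∏-neg n f)) (trans
    (solve 3 (λ s a b → s :* a :* :- b := :- s :* (a :* b)) refl _ _ _) (*-congʳ (sym (ι-neg (sgn n)))))

  ∏-const : ∀ n x → ∏ n (λ _ → x) ≈ x ^ n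
  ∏-const zero    x = refl
  ∏-const (suc n) x = trans (*-congʳ (∏-const n x)) (solve 2 (λ a b → a :* b := b :* a) refl _ _)

  -- The doubled factors exceeding p/2 are, up to sign, the odd numbers below p/2.
  gauss : ∀ M → l ℕ.+ M ≡ h → ν (l ℕ.+ l) + ν (M ℕ.+ M) + ι (+ 1) ≈ ι (+ 0) →
    ∏ l (λ i → ι (+ 2) * ν (suc i)) * ∏ M odd ≈ ∏ h (λ i → ν (suc i)) →
    ι (+ 2) ^ h * ∏ h (λ i → ν (suc i)) ≈ ι (sgn M) * ∏ h (λ i → ν (suc i))
  gauss M l+M≡h lM≈0 pairs = begin
    ι (+ 2) ^ h * ∏ h (λ i → ν (suc i))
      ≈⟨ *-congʳ (∏-const h (ι (+ 2))) ⟨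
    ∏ h (λ _ → ι (+ 2)) * ∏ h (λ i → ν (suc i))
      ≈⟨ ∏-* h _ _ ⟨
    ∏ h (λ i → ι (+ 2) * ν (suc i))
      ≡⟨ ≡.cong (λ n → ∏ n (λ i → ι (+ 2) * ν (suc i))) (≡.sym l+M≡h) ⟩
    ∏ (l ℕ.+ M) (λ i → ι (+ 2) * ν (suc i))
      ≈⟨ ∏-split l M _ ⟩
    L * ∏ M (λ i → ι (+ 2) * ν (suc (l ℕ.+ i)))
      ≈⟨ *-congˡ (∏-cong M (λ i _ → begin
           ι (+ 2) * (ν (l ℕ.+ i) + ι (+ 1))
             ≈⟨ *-congˡ (+-congʳ (ν-+ l i)) ⟩
           ι (+ 2) * (ν l + ν i + ι (+ 1))
             ≈⟨ solve 3 (λ l i M → :n 2 :* (l :+ i :+ :n 1)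
                  := :- (:n 2 :* M :- :n 1 :- :n 2 :* i) :+ (l :+ l :+ (M :+ M) :+ :n 1)) refl (ν l) (ν i) (ν M) ⟩
           - (ι (+ 2) * ν M - ι (+ 1) - ι (+ 2) * ν i) + (ν l + ν l + (ν M + ν M) + ι (+ 1))
             ≈⟨ +-congˡ (trans (+-congʳ (+-cong (sym (ν-+ l l)) (sym (ν-+ M M)))) lM≈0) ⟩
           - (ι (+ 2) * ν M - ι (+ 1) - ι (+ 2) * ν i) + ι (+ 0)
             ≈⟨ solve 1 (λ x → x :+ :n 0 := x) refl _ ⟩
           - (ι (+ 2) * ν M - ι (+ 1) - ι (+ 2) * ν i) ∎)) ⟩
    L * ∏ M (λ i → - (ι (+ 2) * ν M - ι (+ 1) - ι (+ 2) * ν i))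
      ≈⟨ *-congˡ (trans (∏-neg M _) (*-congˡ (trans (solve 1 (λ x → x := x :* :n 1) refl _)
           (∏-odd-descending M 0 M (solve 1 (λ x → x := :n 0 :+ x) refl (ν M)) ≡.refl)))) ⟩
    L * (ι (sgn M) * ∏ M odd)
      ≈⟨ solve 3 (λ L s O → L :* (s :* O) := s :* (L :* O)) refl _ _ _ ⟩
    ι (sgn M) * (L * ∏ M odd)
      ≈⟨ *-congˡ pairs ⟩
    ι (sgn M) * ∏ h (λ i → ν (suc i)) ∎
    where L = ∏ l (λ i → ι (+ 2) * ν (suc i))

  double-cancel : ∀ a b → a ℕ.+ a ≡ b ℕ.+ b → a ≡ b
  double-cancel a b eq = ℕₚ.*-cancelˡ-≡ a b 2
    (≡.trans (≡.cong (a ℕ.+_) (ℕₚ.+-identityʳ a)) (≡.trans eq (≡.cong (b ℕ.+_) (≡.sym (ℕₚ.+-identityʳ b)))))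

  4*≡ : ∀ n → 4 ℕ.* n ≡ (n ℕ.+ n) ℕ.+ (n ℕ.+ n)
  4*≡ n = ≡.trans (≡.cong (λ k → n ℕ.+ (n ℕ.+ k)) (≡.cong (n ℕ.+_) (ℕₚ.+-identityʳ n)))
    (≡.sym (ℕₚ.+-assoc n n (n ℕ.+ n)))

  factorial-nonZeroDivisor : ∀ n → n ≤ p′ → NonZeroDivisor (∏ n (λ i → ν (suc i)))
  factorial-nonZeroDivisor zero    _    y 1y≈0 = trans (solve 1 (λ y → y := :n 1 :* y) refl y) 1y≈0
  factorial-nonZeroDivisor (suc n) n<p′ y xy≈0 = ν-nonZeroDivisor (∤-suc n<p′) y
    (factorial-nonZeroDivisor n (ℕₚ.<⇒≤ n<p′) _ (trans
      (solve 3 (λ a b c → a :* (b :* c) := a :* b :* c) refl _ _ _) xy≈0))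

  h≤p′ : h ≤ p′
  h≤p′ = ℕₚ.≤-trans (ℕₚ.m≤m+n h h) (ℕₚ.≤-reflexive (≡.sym p′≡))

  cancel-factorial : ∀ {x y} → x * ∏ h (λ i → ν (suc i)) ≈ y * ∏ h (λ i → ν (suc i)) → x ≈ y
  cancel-factorial {x} {y} eq = begin
    x             ≈⟨ solve 2 (λ x y → x := x :- y :+ y) refl x y ⟩
    x - y + y     ≈⟨ +-congʳ (factorial-nonZeroDivisor h h≤p′ (x - y) (trans
                       (solve 3 (λ x y f → f :* (x :- y) := x :* f :- y :* f) refl x y _)
                       (trans (+-congʳ eq) (solve 1 (λ x → x :- x := :n 0) refl _)))) ⟩
    ι (+ 0) + y   ≈⟨ solve 1 (λ y → :n 0 :+ y := y) refl y ⟩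
    y ∎

  ν-p≈0 : ∀ {n} → n ≡ p → ν n ≈ ι (+ 0)
  ν-p≈0 ≡.refl = 𝔽.p≈0

  -- Gauss's lemma gives 2^h = (-1)^M with l + M = h, and (-1)^h (-1)^M = (-1)^(l+2M).
  -2^h : ι -[1+ 1 ] ^ h ≈ ι (sgn l)
  -2^h = begin
    ι -[1+ 1 ] ^ h
      ≈⟨ ^-cong h (solve 0 (con -[1+ 1 ] := con -[1+ 0 ] :* :n 2) refl) ⟩
    (ι -[1+ 0 ] * ι (+ 2)) ^ h
      ≈⟨ *-^ _ _ h ⟩
    ι -[1+ 0 ] ^ h * ι (+ 2) ^ h
      ≈⟨ *-cong (-1^ h) (proj₂ result) ⟩
    ι (sgn h) * ι (sgn (proj₁ result))
      ≈⟨ ι-* (sgn h) _ ⟨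
    ι (sgn h ℤ.* sgn (proj₁ result))
      ≡⟨ ≡.cong ι (≡.trans (≡.cong (λ n → sgn n ℤ.* sgn (proj₁ result)) (≡.sym l+M≡h))
           (sign (proj₁ result))) ⟩
    ι (sgn l) ∎
    where
    -1^ : ∀ n → ι -[1+ 0 ] ^ n ≈ ι (sgn n)
    -1^ zero    = refl
    -1^ (suc n) = trans (*-congˡ (-1^ n)) (trans (solve 1 (λ s → con -[1+ 0 ] :* s := :- s) refl _) (sym (ι-neg (sgn n))))
    sign : ∀ M → sgn (l ℕ.+ M) ℤ.* sgn M ≡ sgn l
    sign M = ≡.trans (≡.cong (ℤ._* sgn M) (sgn-+ l M)) (≡.trans (ℤₚ.*-assoc (sgn l) (sgn M) (sgn M))
      (≡.trans (≡.cong (sgn l ℤ.*_) (sgn-² M)) (ℤₚ.*-identityʳ (sgn l))))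
    split : p′ ≡ 4 ℕ.* l ⊎ p′ ≡ 2 ℕ.+ 4 ℕ.* l → (l ℕ.+ l ≡ h) ⊎ (l ℕ.+ suc l ≡ h)
    split (inj₁ eq) = inj₁ (double-cancel _ _ (≡.trans (≡.sym (4*≡ l)) (≡.trans (≡.sym eq) p′≡)))
    split (inj₂ eq) = inj₂ (double-cancel _ _ (≡.trans (≡.cong (λ n → n ℕ.+ n) (ℕₚ.+-suc l l))
        (≡.trans (≡.cong suc (ℕₚ.+-suc (l ℕ.+ l) (l ℕ.+ l))) (≡.trans (≡.cong (λ n → suc (suc n)) (≡.sym (4*≡ l)))
          (≡.trans (≡.sym eq) p′≡)))))
    result′ : Σ ℕ λ M → l ℕ.+ M ≡ h × ι (+ 2) ^ h ≈ ι (sgn M)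
    result′ with split p′≡l
    -- Among 1, ..., h there are l even numbers and M odd ones: M = l for h = 2l, and M = l+1 for h
    -- = 2l+1.
    ... | inj₁ 2l≡h = l , 2l≡h , cancel-factorial (gauss l 2l≡h
            (trans (+-congʳ (sym (ν-+ (l ℕ.+ l) (l ℕ.+ l)))) (ν-p≈0 (≡.cong suc
              (≡.trans (≡.cong₂ ℕ._+_ 2l≡h 2l≡h) (≡.sym p′≡)))))
            (begin
              ∏ l (λ i → ι (+ 2) * ν (suc i)) * ∏ l odd
                ≈⟨ solve 2 (λ a b → a :* b := b :* a) refl _ _ ⟩
              ∏ l odd * ∏ l (λ i → ι (+ 2) * ν (suc i)) ≈⟨ ∏-* l _ _ ⟨
              ∏ l (λ i → odd i * (ι (+ 2) * ν (suc i))) ≈⟨ ∏-double l ⟨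
              ∏ (l ℕ.+ l) (λ i → ν (suc i)) ≡⟨ ≡.cong (λ n → ∏ n (λ i → ν (suc i))) 2l≡h ⟩
              ∏ h (λ i → ν (suc i)) ∎))
    ... | inj₂ 2l+1≡h = suc l , 2l+1≡h , cancel-factorial (gauss (suc l) 2l+1≡h
            (trans (+-congʳ (sym (ν-+ (l ℕ.+ l) (suc l ℕ.+ suc l)))) (ν-p≈0 (≡.cong suc
              (≡.trans (regroup l) (≡.trans (≡.cong₂ ℕ._+_ 2l+1≡h 2l+1≡h) (≡.sym p′≡))))))
            (begin
              ∏ l (λ i → ι (+ 2) * ν (suc i)) * (∏ l odd * odd l)
                ≈⟨ solve 3 (λ a b c → a :* (b :* c) := b :* a :* c) refl _ _ _ ⟩
              ∏ l odd * ∏ l (λ i → ι (+ 2) * ν (suc i)) * odd l ≈⟨ *-congʳ (∏-* l _ _) ⟨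
              ∏ l (λ i → odd i * (ι (+ 2) * ν (suc i))) * odd l ≈⟨ *-congʳ (∏-double l) ⟨
              ∏ (l ℕ.+ l) (λ i → ν (suc i)) * odd l
                ≈⟨ *-congˡ (trans (solve 1 (λ l → :odd l := l :+ l :+ :n 1) refl (ν l)) (+-congʳ (sym (ν-+ l l)))) ⟩
              ∏ (suc (l ℕ.+ l)) (λ i → ν (suc i))
                ≡⟨ ≡.cong (λ n → ∏ n (λ i → ν (suc i))) (≡.trans (≡.sym (ℕₚ.+-suc l l)) 2l+1≡h) ⟩
              ∏ h (λ i → ν (suc i)) ∎))
      where
      regroup : ∀ n → (n ℕ.+ n) ℕ.+ (suc n ℕ.+ suc n) ≡ (n ℕ.+ suc n) ℕ.+ (n ℕ.+ suc n)
      regroup n = ≡.trans (≡.cong (λ k → (n ℕ.+ n) ℕ.+ suc k) (ℕₚ.+-suc n n))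
        (≡.trans (ℕₚ.+-suc (n ℕ.+ n) (suc (n ℕ.+ n))) (≡.sym (≡.cong₂ ℕ._+_ (ℕₚ.+-suc n n) (ℕₚ.+-suc n n))))
    result : Σ ℕ λ M → ι (+ 2) ^ h ≈ ι (sgn M)
    result = proj₁ result′ , proj₂ (proj₂ result′)
    l+M≡h : l ℕ.+ proj₁ result ≡ h
    l+M≡h = proj₁ (proj₂ result′)

  fermat-h : ∀ {n} → p ∤ n → (ν n * ν n) ^ h ≈ ι (+ 1)
  fermat-h {n} p∤n = begin
    (ν n * ν n) ^ h     ≈⟨ *-^ _ _ h ⟩
    ν n ^ h * ν n ^ h   ≈⟨ ^-+ (ν n) h h ⟨
    ν n ^ (h ℕ.+ h)     ≡⟨ ≡.cong (ν n ^_) (≡.sym p′≡) ⟩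
    ν n ^ p′            ≈⟨ fermat p∤n ⟩
    ι (+ 1) ∎

  -- The squares of 1, ..., h are roots by Fermat. Their differences factor into j-i and i+j+2, both
  -- positive and below p, so they can be cancelled.
  euler-criterion : ∀ x → x ^ h - ι (+ 1) ≈ ∏ h (λ i → x - ν (suc i) * ν (suc i))
  euler-criterion = ^-1-roots (suc m) (λ i → ν (suc i) * ν (suc i))
    (λ i i<h → fermat-h (∤-suc (ℕₚ.<-≤-trans i<h h≤p′)))
    (λ i j i<j j<h → NonZeroDivisor-resp (difference i j i<j) (neg-nonZeroDivisor (ν-nonZeroDivisor (∤-* prime-p
      (λ p∣ → ℕₚ.<⇒≱ (ℕₚ.≤-<-trans (ℕₚ.m∸n≤m j i) (ℕₚ.<-trans (ℕₚ.<-≤-trans j<h h≤p′) (ℕₚ.n<1+n p′)))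
        (∣⇒≤ {{ℕ.>-nonZero (ℕₚ.m<n⇒0<n∸m i<j)}} p∣))
      (λ p∣ → ℕₚ.<⇒≱ (s≤s (ℕₚ.≤-trans (ℕₚ.+-mono-≤ (ℕₚ.<-trans i<j j<h) j<h) (ℕₚ.≤-reflexive (≡.sym p′≡))))
        (∣⇒≤ p∣))))))
    where
    neg-nonZeroDivisor : ∀ {x} → NonZeroDivisor x → NonZeroDivisor (- x)
    neg-nonZeroDivisor {x} reg y -xy≈0 = reg y (trans (solve 2 (λ x y → x :* y := :- (:- x :* y)) refl x y)
      (trans (-‿cong -xy≈0) (solve 0 (:- :n 0 := :n 0) refl)))
    difference : ∀ i j → i < j → ν (suc i) * ν (suc i) - ν (suc j) * ν (suc j)
      ≈ - ν ((j ∸ i) ℕ.* (suc i ℕ.+ suc j))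
    difference i j i<j = begin
      ν (suc i) * ν (suc i) - ν (suc j) * ν (suc j)
        ≈⟨ solve 2 (λ i j → i :* i :- j :* j := :- ((j :- i) :* (i :+ j))) refl _ _ ⟩
      - ((ν (suc j) - ν (suc i)) * (ν (suc i) + ν (suc j)))
        ≈⟨ -‿cong (*-cong (trans (+-congʳ (+-congʳ (trans (ν-cong (≡.sym (ℕₚ.m+[n∸m]≡n (ℕₚ.<⇒≤ i<j)))) (ν-+ i (j ∸ i)))))
             (solve 2 (λ i d → i :+ d :+ :n 1 :- (i :+ :n 1) := d) refl _ _)) (sym (ν-+ (suc i) (suc j)))) ⟩
      - (ν (j ∸ i) * ν (suc i ℕ.+ suc j))
        ≈⟨ -‿cong (ν-* (j ∸ i) (suc i ℕ.+ suc j)) ⟨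
      - ν ((j ∸ i) ℕ.* (suc i ℕ.+ suc j)) ∎

  ∣-∏ : ∀ n f → p ∣ ℤ.∣ Z.∏ n f ∣ → Σ ℕ λ i → i < n × p ∣ ℤ.∣ f i ∣
  ∣-∏ zero    f p∣1 = contradiction p∣1 (prime∤1 prime-p)
  ∣-∏ (suc n) f p∣ with euclidsLemma ℤ.∣ Z.∏ n f ∣ ℤ.∣ f n ∣ prime-p
                          (≡.subst (p ∣_) (ℤₚ.abs-* (Z.∏ n f) (f n)) p∣)
  ... | inj₂ p∣fn = n , ℕₚ.≤-refl , p∣fn
  ... | inj₁ p∣∏  = let i , i<n , p∣fi = ∣-∏ n f p∣∏ in i , ℕₚ.m<n⇒m<1+n i<n , p∣fi

  -- When (-2)^h = 1, the product of `euler-criterion` at x = -2 vanishes modulo p, and Euclid's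
  -- lemma picks out a factor.
  residue : sgn l ≡ + 1 → Σ ℕ λ x → x < p × p ∣ ℤ.∣ + x ℤ.* + x ℤ.- -[1+ 1 ] ∣
  residue sgn≡1 = let i , i<h , p∣ = ∣-∏ h f (multiple⇒∣ (𝔽.detects (Z.∏ h f) product≈0)) in
    suc i , s≤s (ℕₚ.<-≤-trans i<h h≤p′) , ≡.subst (p ∣_) (abs-eq i) p∣
    where
    f : ℕ → ℤ
    f i = -[1+ 1 ] ℤ.- + suc i ℤ.* + suc i
    abs-eq : ∀ i → ℤ.∣ f i ∣ ≡ ℤ.∣ + suc i ℤ.* + suc i ℤ.- -[1+ 1 ] ∣
    abs-eq i = ℤₚ.∣i-j∣≡∣j-i∣ -[1+ 1 ] (+ suc i ℤ.* + suc i)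
    product≈0 : ι (Z.∏ h f) ≈ ι (+ 0)
    product≈0 = begin
      ι (Z.∏ h f)
        ≈⟨ ι-∏ h f ⟩
      ∏ h (λ i → ι (f i))
        ≈⟨ ∏-cong h (λ i _ → trans (ι-∸ -[1+ 1 ] _) (+-congˡ (-‿cong (trans (ι-* (+ suc i) (+ suc i))
             (*-cong (sym (ν≈ι (suc i))) (sym (ν≈ι (suc i)))))))) ⟩
      ∏ h (λ i → ι -[1+ 1 ] - ν (suc i) * ν (suc i))
        ≈⟨ euler-criterion (ι -[1+ 1 ]) ⟨
      ι -[1+ 1 ] ^ h - ι (+ 1)
        ≈⟨ +-congʳ (trans -2^h (reflexive (≡.cong ι sgn≡1))) ⟩
      ι (+ 1) - ι (+ 1)
        ≈⟨ solve 0 (:n 1 :- :n 1 := :n 0) refl ⟩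
      ι (+ 0) ∎

  -- A root x would give 1 = x^(p-1) = (-2)^h = -1 and hence p dividing 2.
  nonresidue : sgn l ≡ -[1+ 0 ] → ∀ x → x < p → p ∤ ℤ.∣ + x ℤ.* + x ℤ.- -[1+ 1 ] ∣
  nonresidue sgn≡-1 x x<p p∣ = p∤2 (multiple⇒∣ (congruent (+ 1) -[1+ 0 ] 1≈-1))
    where
    x²≈-2 : ν x * ν x ≈ ι -[1+ 1 ]
    x²≈-2 = begin
      ν x * ν x
        ≈⟨ *-cong (ν≈ι x) (ν≈ι x) ⟩
      ι (+ x) * ι (+ x)
        ≈⟨ solve 1 (λ y → y := y :- con -[1+ 1 ] :+ con -[1+ 1 ]) refl _ ⟩
      ι (+ x) * ι (+ x) - ι -[1+ 1 ] + ι -[1+ 1 ]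
        ≈⟨ +-congʳ (trans (ι-∸ (+ x ℤ.* + x) -[1+ 1 ]) (+-congʳ (ι-* (+ x) (+ x)))) ⟨
      ι (+ x ℤ.* + x ℤ.- -[1+ 1 ]) + ι -[1+ 1 ]
        ≈⟨ +-congʳ (multiple⇒≈0 (∣⇒multiple p∣)) ⟩
      ι (+ 0) + ι -[1+ 1 ]
        ≈⟨ solve 0 (:n 0 :+ con -[1+ 1 ] := con -[1+ 1 ]) refl ⟩
      ι -[1+ 1 ] ∎
    p∤x : p ∤ x
    p∤x p∣x = p∤2 (multiple⇒∣ (𝔽.detects -[1+ 1 ] (trans (sym x²≈-2) (trans (*-congʳ (∣⇒ν≈0 p∣x))
      (solve 1 (λ x → :n 0 :* x := :n 0) refl _)))))
    1≈-1 : ι (+ 1) ≈ ι -[1+ 0 ]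
    1≈-1 = begin
      ι (+ 1)         ≈⟨ fermat-h p∤x ⟨
      (ν x * ν x) ^ h ≈⟨ ^-cong h x²≈-2 ⟩
      ι -[1+ 1 ] ^ h  ≈⟨ -2^h ⟩
      ι (sgn l)       ≡⟨ ≡.cong ι sgn≡-1 ⟩
      ι -[1+ 0 ] ∎

  legendre-2 : legendre -[1+ 1 ] p ≡ sgn l
  legendre-2 with sgn-cases l
  ... | inj₁ sgn≡1 = ≡.trans (legendre-square -[1+ 1 ] p p∤2
          (proj₁ r) (proj₁ (proj₂ r)) (proj₂ (proj₂ r))) (≡.sym sgn≡1)
    where r = residue sgn≡1
  ... | inj₂ sgn≡-1 = ≡.trans (legendre-nonsquare -[1+ 1 ] p p∤2 (nonresidue sgn≡-1)) (≡.sym sgn≡-1)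

-- The rational partial sum and its cleared form

centralBinomial-suc : ∀ n → suc n ℕ.* ((2 ℕ.* suc n) C suc n) ≡ 2 ℕ.* suc (2 ℕ.* n) ℕ.* ((2 ℕ.* n) C n)
centralBinomial-suc n = ℕₚ.*-cancelʳ-≡ _ _ (suc n ℕ.* (n ! ℕ.* n !))
    {{ℕₚ.m*n≢0 (suc n) (n ! ℕ.* n !) {{_}} {{ℕₚ.m*n≢0 (n !) (n !) {{n ℕₚ.!≢0}} {{n ℕₚ.!≢0}}}}}} (begin
  suc n ℕ.* C₊ ℕ.* (suc n ℕ.* (n ! ℕ.* n !))
    ≡⟨ ℕ-assoc (suc n) C₊ (n !) ⟩
  C₊ ℕ.* (suc n ! ℕ.* suc n !)
    ≡⟨ central (suc n) ⟩
  (2 ℕ.* suc n) !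
    ≡⟨ ≡.cong _! (ℕₚ.*-suc 2 n) ⟩
  suc (suc (2 ℕ.* n)) ℕ.* (suc (2 ℕ.* n) ℕ.* (2 ℕ.* n) !)
    ≡⟨ ≡.cong (λ x → suc (suc (2 ℕ.* n)) ℕ.* (suc (2 ℕ.* n) ℕ.* x)) (≡.sym (central n)) ⟩
  suc (suc (2 ℕ.* n)) ℕ.* (suc (2 ℕ.* n) ℕ.* (C₀ ℕ.* (n ! ℕ.* n !)))
    ≡⟨ ℕ-rearrange n C₀ (n ! ℕ.* n !) ⟩
  2 ℕ.* suc (2 ℕ.* n) ℕ.* C₀ ℕ.* (suc n ℕ.* (n ! ℕ.* n !)) ∎)
  where
  open ≡.≡-Reasoning
  C₊ = (2 ℕ.* suc n) C suc n
  C₀ = (2 ℕ.* n) C n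
  central : ∀ n → ((2 ℕ.* n) C n) ℕ.* (n ! ℕ.* n !) ≡ (2 ℕ.* n) !
  central n = ≡.trans (≡.cong (λ k → ((2 ℕ.* n) C n) ℕ.* (n ! ℕ.* k !))
      (≡.sym (≡.trans (ℕₚ.m+n∸m≡n n (n ℕ.+ 0)) (ℕₚ.+-identityʳ n))))
    (nCk*k![n∸k]!≡n! (2 ℕ.* n) n (ℕₚ.m≤m+n n (n ℕ.+ 0)))
  ℕ-assoc : ∀ s c f → s ℕ.* c ℕ.* (s ℕ.* (f ℕ.* f)) ≡ c ℕ.* (s ℕ.* f ℕ.* (s ℕ.* f))
  ℕ-assoc = ℕ-solver.solve-∀
  ℕ-rearrange : ∀ n c f → suc (suc (2 ℕ.* n)) ℕ.* (suc (2 ℕ.* n) ℕ.* (c ℕ.* f))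
    ≡ 2 ℕ.* suc (2 ℕ.* n) ℕ.* c ℕ.* (suc n ℕ.* f)
  ℕ-rearrange = ℕ-solver.solve-∀

-- What the argument uses of ℚ. The constants -1/512, 1/2, 1/4 and 1/16 are known only through their
-- equations, and `E` is the sequence of values E_n(1/4).
record RationalSetting : Set₁ where
  field
    algebra : ℤ-Algebra
  open Over algebra
  field
    inverse   : ∀ z → z ≢ + 0 → Σ Carrier λ y → ι z * y ≈ ι (+ 1)
    r half x sixteenth : Carrier
    512r≈-1   : ι (+ 512) * r ≈ - ι (+ 1)
    2half≈1   : ι (+ 2) * half ≈ ι (+ 1)
    4x≈1      : ι (+ 4) * x ≈ ι (+ 1)
    16s≈1     : ι (+ 16) * sixteenth ≈ ι (+ 1)
    E         : ℕ → Carrier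
    E-rec     : ∀ n → E n ≈ x ^ n - half * ∑ n (λ j → ι (+ (n C j)) * E j)

module PartialSum (𝔸 : RationalSetting) where
  open RationalSetting 𝔸 using (r; 512r≈-1) renaming (algebra to A)
  open Over A
  open Products A
  open Powers A
  open Homomorphism A
  private
    module Z = Over ℤ-algebra
    module ZP = Products ℤ-algebra

  term : ℕ → Carrier
  term n = ι (+ (6 ℕ.* n ℕ.+ 1)) * ι (+ ((2 ℕ.* n) C n)) ^ 3 * r ^ n

  private
    binom : ℕ → Carrier
    binom n = ν ((2 ℕ.* n) C n)

    binom-suc : ∀ n → ν (suc n) * binom (suc n) ≈ ι (+ 2) * odd n * binom n
    binom-suc n = begin
      ν (suc n) * binom (suc n)
        ≈⟨ ν-* (suc n) ((2 ℕ.* suc n) C suc n) ⟨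
      ν (suc n ℕ.* ((2 ℕ.* suc n) C suc n))
        ≈⟨ ν-cong (centralBinomial-suc n) ⟩
      ν (2 ℕ.* suc (2 ℕ.* n) ℕ.* ((2 ℕ.* n) C n))
        ≈⟨ trans (ν-* (2 ℕ.* suc (2 ℕ.* n)) ((2 ℕ.* n) C n)) (*-congʳ (trans (ν-* 2 (suc (2 ℕ.* n)))
             (*-cong (ν≈ι 2) (+-congʳ (trans (ν-* 2 n) (*-congʳ (ν≈ι 2))))))) ⟩
      ι (+ 2) * odd n * binom n ∎

    -- By `binom-suc` each step multiplies the left side by (2(2n+1))³ · 64 · r. As 8 · 64 = 512,
    -- this is -(2n+1)³, the factor by which `c n` and `e n` grow at s = 0.
    cube-term : ∀ n → binom n * binom n * binom n * r ^ n * D n (ι (+ 0)) ≈ c n * e n (ι (+ 0))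
    cube-term zero    = solve 0 ((:n 0 :+ :n 1) :* (:n 0 :+ :n 1) :* (:n 0 :+ :n 1) :* :n 1 :* :n 1
      := :n 1 :* :n 1) refl
    cube-term (suc n) = begin
      B′ * B′ * B′ * (r * r ^ n) * (D n (ι (+ 0)) * (ι (+ 4) * m * (ι (+ 16) * (m * m) - ι (+ 0))))
        ≈⟨ solve 5 (λ b m r x d → b :* b :* b :* (r :* x) :* (d :* (:n 4 :* m :* (:n 16 :* (m :* m) :- :n 0)))
             := (m :* b) :* (m :* b) :* (m :* b) :* (:n 64 :* r) :* (x :* d)) refl B′ m r (r ^ n) (D n (ι (+ 0))) ⟩
      (m * B′) * (m * B′) * (m * B′) * (ι (+ 64) * r) * (r ^ n * D n (ι (+ 0)))
        ≈⟨ *-congʳ (*-congʳ (*-cong (*-cong (binom-suc n) (binom-suc n)) (binom-suc n))) ⟩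
      (ι (+ 2) * odd n * B₀) * (ι (+ 2) * odd n * B₀) * (ι (+ 2) * odd n * B₀) * (ι (+ 64) * r)
        * (r ^ n * D n (ι (+ 0)))
        ≈⟨ solve 5 (λ o b r x d →
             (:n 2 :* o :* b) :* (:n 2 :* o :* b) :* (:n 2 :* o :* b) :* (:n 64 :* r) :* (x :* d)
             := o :* o :* o :* (:n 512 :* r) :* (b :* b :* b :* x :* d)) refl (odd n) B₀ r (r ^ n) (D n (ι (+ 0))) ⟩
      odd n * odd n * odd n * (ι (+ 512) * r) * (B₀ * B₀ * B₀ * r ^ n * D n (ι (+ 0)))
        ≈⟨ *-cong (*-congˡ 512r≈-1) (cube-term n) ⟩
      odd n * odd n * odd n * - ι (+ 1) * (c n * e n (ι (+ 0)))
        ≈⟨ solve 3 (λ o c e → o :* o :* o :* :- :n 1 :* (c :* e)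
             := c :* :- o :* (e :* (o :* o :- :n 0))) refl (odd n) (c n) (e n (ι (+ 0))) ⟩
      c (suc n) * e (suc n) (ι (+ 0)) ∎
      where
      m  = ν (suc n)
      B′ = binom (suc n)
      B₀ = binom n

    term-D : ∀ n → term n * D n (ι (+ 0)) ≈ (ι (+ 6) * ν n + ι (+ 1)) * c n * e n (ι (+ 0))
    term-D n = begin
      ι (+ (6 ℕ.* n ℕ.+ 1)) * ι (+ ((2 ℕ.* n) C n)) ^ 3 * r ^ n * D n (ι (+ 0))
        ≈⟨ *-congʳ (*-congʳ (*-cong
             (trans (sym (ν≈ι (6 ℕ.* n ℕ.+ 1))) (trans (ν-+ (6 ℕ.* n) 1) (+-cong (trans (ν-* 6 n) (*-congʳ (ν≈ι 6))) (ν≈ι 1))))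
             (^-cong 3 (sym (ν≈ι ((2 ℕ.* n) C n)))))) ⟩
      w * binom n ^ 3 * r ^ n * D n (ι (+ 0))
        ≈⟨ solve 4 (λ w b x d → w :* (b :* (b :* (b :* :n 1))) :* x :* d := w :* (b :* b :* b :* x :* d)) refl _ _ _ _ ⟩
      w * (binom n * binom n * binom n * r ^ n * D n (ι (+ 0)))
        ≈⟨ *-congˡ (cube-term n) ⟩
      w * (c n * e n (ι (+ 0)))
        ≈⟨ solve 3 (λ w c e → w :* (c :* e) := w :* c :* e) refl w _ _ ⟩
      w * c n * e n (ι (+ 0)) ∎
      where w = ι (+ 6) * ν n + ι (+ 1)

    ∑-P : ∀ n → ∑ (suc n) term * D n (ι (+ 0)) ≈ P (ι (+ 0)) (suc n)
    ∑-P zero = trans (solve 2 (λ t d → (:n 0 :+ t) :* d := :n 0 :* (:n 4 :* :n 0 :* (:n 16 :* (:n 0 :* :n 0) :- :n 0)) :+ t :* d)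
      refl (term 0) (ι (+ 1))) (+-congˡ (term-D 0))
    ∑-P (suc n) = begin
      (S + term (suc n)) * (D n (ι (+ 0)) * f)
        ≈⟨ solve 4 (λ S t d f → (S :+ t) :* (d :* f) := S :* d :* f :+ t :* (d :* f)) refl S (term (suc n)) (D n (ι (+ 0))) f ⟩
      S * D n (ι (+ 0)) * f + term (suc n) * D (suc n) (ι (+ 0))
        ≈⟨ +-cong (*-congʳ (∑-P n)) (term-D (suc n)) ⟩
      P (ι (+ 0)) (suc n) * f + (ι (+ 6) * ν (suc n) + ι (+ 1)) * c (suc n) * e (suc n) (ι (+ 0)) ∎
      where
      S = ∑ (suc n) term
      f = ι (+ 4) * ν (suc n) * (ι (+ 16) * (ν (suc n) * ν (suc n)) - ι (+ 0))

    ι-c : ∀ n → ι (Z.c n) ≈ c n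
    ι-c n = trans (ι-∏ n _) (∏-cong n (λ i _ → trans (ι-neg (Z.odd i)) (-‿cong (ι-odd i))))

    ι-e : ∀ n s → ι (Z.e n s) ≈ e n (ι s)
    ι-e n s = trans (ι-∏ n _) (∏-cong n (λ i _ → trans (ι-∸ _ s)
      (+-congʳ (trans (ι-* (Z.odd i) (Z.odd i)) (*-cong (ι-odd i) (ι-odd i))))))

    ι-f : ∀ n s → ι (+ 4 Z.* Z.ν n Z.* (+ 16 Z.* (Z.ν n Z.* Z.ν n) Z.- s))
      ≈ ι (+ 4) * ν n * (ι (+ 16) * (ν n * ν n) - ι s)
    ι-f n s = trans (ι-* _ _) (*-cong (trans (ι-* (+ 4) (Z.ν n)) (*-congˡ (ι-ν n)))
      (trans (ι-∸ _ s) (+-congʳ (trans (ι-* (+ 16) _) (*-congˡ (trans (ι-* (Z.ν n) (Z.ν n)) (*-cong (ι-ν n) (ι-ν n))))))))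

    ι-P : ∀ n s → ι (Z.P s n) ≈ P (ι s) n
    ι-P zero    s = refl
    ι-P (suc n) s = trans (ι-+ _ _) (+-cong
      (trans (ι-* (Z.P s n) _) (*-cong (ι-P n s) (ι-f n s)))
      (trans (ι-* _ (Z.e n s)) (*-cong (trans (ι-* _ (Z.c n))
        (*-cong (trans (ι-+ (+ 6 Z.* Z.ν n) (+ 1)) (+-congʳ (trans (ι-* (+ 6) (Z.ν n)) (*-congˡ (ι-ν n))))) (ι-c n)))
        (ι-e n s))))

  partialSum : ∀ n → ∑ (suc n) term * ι (ZP.D n (+ 0)) ≈ ι (Z.P (+ 0) (suc n))
  partialSum n = trans (*-congˡ (trans (ι-∏ n _) (∏-cong n (λ i _ → ι-f (suc i) (+ 0)))))
    (trans (∑-P n) (sym (ι-P (suc n) (+ 0))))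

-- Denominators prime to p

module Local (A : ℤ-Algebra) {p : ℕ} (prime-p : Prime p) where
  open Over A
  open Products A

  -- The elements with denominator prime to p, and the ideal generated by p among them.
  𝒪 𝔪 : Carrier → Set
  𝒪 x = Σ ℕ λ d → p ∤ d × Σ ℤ λ z → ν d * x ≈ ι z
  𝔪 x = Σ Carrier λ y → 𝒪 y × x ≈ ι (+ p) * y

  𝒪-ι : ∀ z → 𝒪 (ι z)
  𝒪-ι z = 1 , prime∤1 prime-p , z , solve 1 (λ x → (:n 0 :+ :n 1) :* x := x) refl (ι z)

  𝒪-* : ∀ {x y} → 𝒪 x → 𝒪 y → 𝒪 (x * y)
  𝒪-* {x} {y} (d , p∤d , a , dx≈) (e , p∤e , b , ey≈) = d ℕ.* e , ∤-* prime-p p∤d p∤e , a ℤ.* b ,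
    trans (*-congʳ (ν-* d e)) (trans (solve 4 (λ d e x y → d :* e :* (x :* y) := d :* x :* (e :* y)) refl _ _ x y)
      (trans (*-cong dx≈ ey≈) (sym (ι-* a b))))

  𝒪-+ : ∀ {x y} → 𝒪 x → 𝒪 y → 𝒪 (x + y)
  𝒪-+ {x} {y} (d , p∤d , a , dx≈) (e , p∤e , b , ey≈) =
    d ℕ.* e , ∤-* prime-p p∤d p∤e , + e ℤ.* a ℤ.+ + d ℤ.* b , (begin
      ν (d ℕ.* e) * (x + y)
        ≈⟨ *-congʳ (ν-* d e) ⟩
      ν d * ν e * (x + y)
        ≈⟨ solve 4 (λ d e x y → d :* e :* (x :+ y) := e :* (d :* x) :+ d :* (e :* y)) refl _ _ x y ⟩
      ν e * (ν d * x) + ν d * (ν e * y)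
        ≈⟨ +-cong (*-cong (ν≈ι e) dx≈) (*-cong (ν≈ι d) ey≈) ⟩
      ι (+ e) * ι a + ι (+ d) * ι b
        ≈⟨ +-cong (ι-* (+ e) a) (ι-* (+ d) b) ⟨
      ι (+ e ℤ.* a) + ι (+ d ℤ.* b)
        ≈⟨ ι-+ _ _ ⟨
      ι (+ e ℤ.* a ℤ.+ + d ℤ.* b) ∎)

  𝒪-resp : ∀ {x y} → x ≈ y → 𝒪 y → 𝒪 x
  𝒪-resp x≈y (d , p∤d , a , dy≈) = d , p∤d , a , trans (*-congˡ x≈y) dy≈

  𝒪-neg : ∀ {x} → 𝒪 x → 𝒪 (- x)
  𝒪-neg {x} Ox = 𝒪-resp (solve 1 (λ x → :- x := con -[1+ 0 ] :* x) refl x) (𝒪-* (𝒪-ι -[1+ 0 ]) Ox)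

  𝒪-ν : ∀ n → 𝒪 (ν n)
  𝒪-ν n = 𝒪-resp (ν≈ι n) (𝒪-ι (+ n))

  𝒪-^ : ∀ {x} n → 𝒪 x → 𝒪 (x ^ n)
  𝒪-^ zero    _  = 𝒪-ι (+ 1)
  𝒪-^ (suc n) Ox = 𝒪-* Ox (𝒪-^ n Ox)

  𝒪-∑ : ∀ n {f} → (∀ i → 𝒪 (f i)) → 𝒪 (∑ n f)
  𝒪-∑ zero    _ = 𝒪-ι (+ 0)
  𝒪-∑ (suc n) h = 𝒪-+ (𝒪-∑ n h) (h n)

  𝔪⇒𝒪 : ∀ {x} → 𝔪 x → 𝒪 x
  𝔪⇒𝒪 (y , Oy , x≈) = 𝒪-resp x≈ (𝒪-* (𝒪-ι (+ p)) Oy)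

  𝔪-+ : ∀ {x y} → 𝔪 x → 𝔪 y → 𝔪 (x + y)
  𝔪-+ (a , Oa , x≈) (b , Ob , y≈) = a + b , 𝒪-+ Oa Ob , trans (+-cong x≈ y≈)
    (solve 3 (λ p a b → p :* a :+ p :* b := p :* (a :+ b)) refl _ a b)

  𝔪-*ˡ : ∀ {x y} → 𝒪 x → 𝔪 y → 𝔪 (x * y)
  𝔪-*ˡ {x} Ox (b , Ob , y≈) = x * b , 𝒪-* Ox Ob , trans (*-congˡ y≈)
    (solve 3 (λ p x b → x :* (p :* b) := p :* (x :* b)) refl _ x b)

  𝔪-resp : ∀ {x y} → x ≈ y → 𝔪 y → 𝔪 x
  𝔪-resp x≈y (a , Oa , y≈) = a , Oa , trans x≈y y≈

  𝔪-neg : ∀ {x} → 𝔪 x → 𝔪 (- x)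
  𝔪-neg {x} mx = 𝔪-resp (solve 1 (λ x → :- x := con -[1+ 0 ] :* x) refl x) (𝔪-*ˡ (𝒪-ι -[1+ 0 ]) mx)

  𝔪-∑ : ∀ n {f} → (∀ i → i < n → 𝔪 (f i)) → 𝔪 (∑ n f)
  𝔪-∑ zero    _ = ι (+ 0) , 𝒪-ι (+ 0) , solve 1 (λ p → :n 0 := p :* :n 0) refl _
  𝔪-∑ (suc n) h = 𝔪-+ (𝔪-∑ n (λ i i<n → h i (ℕₚ.m<n⇒m<1+n i<n))) (h n ℕₚ.≤-refl)

  𝔪-multiple : ∀ {a} → Multiple p a → 𝔪 (ι a)
  𝔪-multiple (w , ≡.refl) = ι w , 𝒪-ι w , trans (ι-* w (+ p)) (solve 2 (λ a b → a :* b := b :* a) refl _ _)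

  𝒪-inverse : ∀ {a x} → p ∤ ℤ.∣ a ∣ → ι a * x ≈ ι (+ 1) → 𝒪 x
  𝒪-inverse {+ n}     {x} p∤a ax≈1 = n , p∤a , + 1 , trans (*-congʳ (ν≈ι n)) ax≈1
  𝒪-inverse { -[1+ n ]} {x} p∤a ax≈1 = suc n , p∤a , -[1+ 0 ] ,
    trans (*-congʳ (ν≈ι (suc n))) (trans (solve 2 (λ a x → a :* x := :- (:- a :* x)) refl _ x)
      (trans (-‿cong (trans (*-congʳ (sym (ι-neg (+ suc n)))) ax≈1)) (sym (ι-neg (+ 1)))))

-- Euler polynomials as alternating power sums modulo p

module EulerPolynomials (𝔸 : RationalSetting) {p : ℕ} (prime-p : Prime p)
    (sgn-p : sgn p ≡ -[1+ 0 ]) (p∤2 : p ∤ 2) where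
  open RationalSetting 𝔸 using (half; x; 2half≈1; 4x≈1; E; E-rec) renaming (algebra to A)
  open Over A
  open Local A prime-p
  open Products A
  open Powers A

  𝒪-half : 𝒪 half
  𝒪-half = 𝒪-inverse p∤2 2half≈1

  𝒪-x : 𝒪 x
  𝒪-x = 𝒪-inverse (∤-* {m = 2} {2} prime-p p∤2 p∤2) 4x≈1

  -- Modulo p this satisfies the recursion of the Euler polynomials, because shifting the
  -- summation index changes the sign and (x + p) ^ n ≡ x ^ n.
  Y : ℕ → Carrier
  Y n = ∑ p (λ j → ι (sgn j) * (x + ν j) ^ n)

  ∑-swap : ∀ m n (f : ℕ → ℕ → Carrier) → ∑ m (λ i → ∑ n (f i)) ≈ ∑ n (λ j → ∑ m (λ i → f i j))
  ∑-swap zero    n f = sym (∑-zero n (λ _ _ → refl))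
  ∑-swap (suc m) n f = trans (+-congʳ (∑-swap m n f)) (sym (∑-+ n _ _))

  ∑-neg : ∀ n f → ∑ n (λ i → - f i) ≈ - ∑ n f
  ∑-neg zero    f = solve 0 (:n 0 := :- :n 0) refl
  ∑-neg (suc n) f = trans (+-congʳ (∑-neg n f)) (solve 2 (λ a b → :- a :+ :- b := :- (a :+ b)) refl _ _)

  -- The binomial theorem turns the left side into the alternating sum of (x+j+1)^n, that is -Y n up
  -- to the two boundary terms; the upper one has a plus sign because p is odd.
  Y-binomial : ∀ n → ∑ (suc n) (λ k → ι (+ (n C k)) * Y k) ≈ x ^ n + (x + ν p) ^ n - Y n
  Y-binomial n = begin
    ∑ (suc n) (λ k → ι (+ (n C k)) * Y k)
      ≈⟨ ∑-cong (suc n) (λ k _ → trans (sym (∑-*ˡ p _ _)) (∑-cong p (λ j _ → trans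
           (*-congʳ (sym (ν≈ι (n C k)))) (solve 3 (λ a s y → a :* (s :* y) := s :* (a :* y)) refl _ _ _)))) ⟩
    ∑ (suc n) (λ k → ∑ p (λ j → ι (sgn j) * (ν (n C k) * (x + ν j) ^ k)))
      ≈⟨ ∑-swap (suc n) p _ ⟩
    ∑ p (λ j → ∑ (suc n) (λ k → ι (sgn j) * (ν (n C k) * (x + ν j) ^ k)))
      ≈⟨ ∑-cong p (λ j _ → begin
           ∑ (suc n) (λ k → ι (sgn j) * (ν (n C k) * (x + ν j) ^ k))
             ≈⟨ ∑-*ˡ (suc n) (ι (sgn j)) _ ⟩
           ι (sgn j) * ∑ (suc n) (λ k → ν (n C k) * (x + ν j) ^ k)
             ≈⟨ *-congˡ (binomial (x + ν j) n) ⟩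
           ι (sgn j) * (x + ν j + ι (+ 1)) ^ n
             ≈⟨ *-congˡ (^-cong n (solve 2 (λ x j → x :+ j :+ :n 1 := x :+ (j :+ :n 1)) refl x _)) ⟩
           ι (sgn j) * (x + ν (suc j)) ^ n
             ≈⟨ solve 2 (λ s y → s :* y := :- (:- s :* y)) refl _ _ ⟩
           - (- ι (sgn j) * (x + ν (suc j)) ^ n)
             ≈⟨ -‿cong (*-congʳ (sym (ι-neg (sgn j)))) ⟩
           - (ι (sgn (suc j)) * (x + ν (suc j)) ^ n) ∎) ⟩
    ∑ p (λ j → - f (suc j))
      ≈⟨ ∑-neg p (λ j → f (suc j)) ⟩
    - ∑ p (λ j → f (suc j))
      ≈⟨ solve 2 (λ a s → :- s := a :- (a :+ s)) refl (f 0) _ ⟩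
    f 0 - (f 0 + ∑ p (λ j → f (suc j)))
      ≈⟨ +-congˡ (-‿cong (sym (∑-head p f))) ⟩
    f 0 - (Y n + f p)
      ≈⟨ -‿cong₂ (trans (solve 1 (λ y → :n 1 :* y := y) refl _)
                   (^-cong n (solve 1 (λ x → x :+ :n 0 := x) refl x)))
                 (+-congˡ (*-congʳ (reflexive (≡.cong ι sgn-p)))) ⟩
    x ^ n - (Y n + ι -[1+ 0 ] * (x + ν p) ^ n)
      ≈⟨ solve 3 (λ a y b → a :- (y :+ con -[1+ 0 ] :* b) := a :+ b :- y) refl _ _ _ ⟩
    x ^ n + (x + ν p) ^ n - Y n ∎
    where
    f : ℕ → Carrier
    f j = ι (sgn j) * (x + ν j) ^ n

  shifted-power : ∀ n → 𝔪 ((x + ν p) ^ n - x ^ n)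
  shifted-power zero = 𝔪-resp (solve 0 (:n 1 :- :n 1 := :n 0) refl) (𝔪-∑ 0 {λ _ → x} (λ _ ()))
  shifted-power (suc n) = 𝔪-resp
    (solve 4 (λ x p a b → (x :+ p) :* a :- x :* b := (x :+ p) :* (a :- b) :+ b :* p) refl x (ν p) _ _)
    (𝔪-+ (𝔪-*ˡ (𝒪-+ 𝒪-x (𝒪-ν p)) (shifted-power n))
         (𝔪-*ˡ (𝒪-^ n 𝒪-x) (ι (+ 1) , 𝒪-ι (+ 1) , trans (ν≈ι p) (solve 1 (λ p → p := p :* :n 1) refl _))))

  -- The difference obeys the Euler recursion with its source replaced by a term divisible by p, so
  -- divisibility passes up from smaller indices.
  E-Y : ∀ n → E n - Y n ≈ - (half * ((x + ν p) ^ n - x ^ n))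
    - half * ∑ n (λ j → ι (+ (n C j)) * (E j - Y j))
  E-Y n = begin
    E n - Y n
      ≈⟨ +-cong (E-rec n) (-‿cong Y≈) ⟩
    x ^ n - half * ΣE - half * (x ^ n + (x + ν p) ^ n - ΣY)
      ≈⟨ solve 5 (λ a b h e y → a :- h :* e :- h :* (a :+ b :- y)
           := :n 1 :* a :- h :* (a :+ b) :- h :* (e :- y)) refl (x ^ n) ((x + ν p) ^ n) half ΣE ΣY ⟩
    ι (+ 1) * x ^ n - half * (x ^ n + (x + ν p) ^ n) - half * (ΣE - ΣY)
      ≈⟨ -‿cong₂ (+-congʳ (*-congʳ (sym 2half≈1))) (*-congˡ (begin
           ΣE - ΣY
             ≈⟨ +-congˡ (∑-neg n _) ⟨
           ΣE + ∑ n (λ j → - (ι (+ (n C j)) * Y j))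
             ≈⟨ ∑-+ n _ _ ⟨
           ∑ n (λ j → ι (+ (n C j)) * E j + - (ι (+ (n C j)) * Y j))
             ≈⟨ ∑-cong n (λ j _ → solve 3 (λ c e y → c :* e :+ :- (c :* y) := c :* (e :- y)) refl _ _ _) ⟩
           ∑ n (λ j → ι (+ (n C j)) * (E j - Y j)) ∎)) ⟩
    ι (+ 2) * half * x ^ n - half * (x ^ n + (x + ν p) ^ n) - half * ∑ n (λ j → ι (+ (n C j)) * (E j - Y j))
      ≈⟨ +-congʳ (solve 3 (λ h a b → :n 2 :* h :* a :- h :* (a :+ b) := :- (h :* (b :- a))) refl half _ _) ⟩
    - (half * ((x + ν p) ^ n - x ^ n)) - half * ∑ n (λ j → ι (+ (n C j)) * (E j - Y j)) ∎
    where
    ΣE = ∑ n (λ j → ι (+ (n C j)) * E j)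
    ΣY = ∑ n (λ j → ι (+ (n C j)) * Y j)
    Y≈ : Y n ≈ half * (x ^ n + (x + ν p) ^ n - ΣY)
    Y≈ = begin
      Y n
        ≈⟨ solve 2 (λ s y → y := :n 1 :* (y :+ s :- s)) refl ΣY (Y n) ⟩
      ι (+ 1) * (Y n + ΣY - ΣY)
        ≈⟨ *-congʳ (sym 2half≈1) ⟩
      ι (+ 2) * half * (Y n + ΣY - ΣY)
        ≈⟨ solve 3 (λ h s y → :n 2 :* h :* (y :+ s :- s) := h :* ((s :+ :n 1 :* y) :+ y :- s)) refl half ΣY (Y n) ⟩
      half * ((ΣY + ι (+ 1) * Y n) + Y n - ΣY)
        ≈⟨ *-congˡ (+-congʳ (+-congʳ (trans (+-congˡ (*-congʳ (reflexive (≡.cong (λ c → ι (+ c)) (≡.sym (nCn≡1 n))))))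
             (Y-binomial n)))) ⟩
      half * (x ^ n + (x + ν p) ^ n - Y n + Y n - ΣY)
        ≈⟨ solve 4 (λ h b y s → h :* (b :- y :+ y :- s) := h :* (b :- s)) refl half _ (Y n) ΣY ⟩
      half * (x ^ n + (x + ν p) ^ n - ΣY) ∎

  E≡Y-below : ∀ n k → k < n → 𝔪 (E k - Y k)
  E≡Y-below (suc n) k k≤n = 𝔪-resp (E-Y k) (𝔪-+
    (𝔪-neg (𝔪-*ˡ 𝒪-half (shifted-power k)))
    (𝔪-neg (𝔪-*ˡ 𝒪-half (𝔪-∑ k (λ j j<k → 𝔪-*ˡ (𝒪-ι _) (E≡Y-below n j (ℕₚ.<-≤-trans j<k (ℕₚ.≤-pred k≤n))))))))

  E≡Y : ∀ k → 𝔪 (E k - Y k)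
  E≡Y k = E≡Y-below (suc k) k ℕₚ.≤-refl

  𝒪-E : ∀ k → 𝒪 (E k)
  𝒪-E k = 𝒪-resp (solve 2 (λ e y → e := e :- y :+ y) refl _ _) (𝒪-+ (𝔪⇒𝒪 (E≡Y k))
    (𝒪-∑ p (λ j → 𝒪-* (𝒪-ι (sgn j)) (𝒪-^ k (𝒪-+ 𝒪-x (𝒪-ν j))))))

-- The congruence in an abstract rational setting

module Conclusion {p′ : ℕ} (prime-p : Prime (suc p′)) (m : ℕ)
    (p′≡ : p′ ≡ suc (suc m) ℕ.+ suc (suc m)) (l : ℕ)
    (p′≡l : p′ ≡ 4 ℕ.* l ⊎ p′ ≡ 2 ℕ.+ 4 ℕ.* l)
    (𝔽 : Residues (suc p′)) (𝕂 : CubicResidues (suc p′)) (𝔸 : RationalSetting) where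
  open RationalSetting 𝔸 hiding (algebra)
  open RationalSetting 𝔸 using () renaming (algebra to A)
  open Over A
  open Products A
  open Powers A
  open Homomorphism A
  open Local A prime-p
  open PartialSum 𝔸
  private
    module 𝔽 = Residues 𝔽
    module F = Over 𝔽.algebra
    module FH = Homomorphism 𝔽.algebra
    module FC = Characteristic 𝔽.algebra prime-p 𝔽.p≈0
    module Z = Over ℤ-algebra
  open Assembly prime-p m p′≡ l p′≡l 𝔽 𝕂
    using (k; u; p∤2; p∤4; p′≡2+k; congruent; eulerSum; D₀; D₀-multiple; P-evaluation)

  p : ℕ
  p = suc p′

  π : Carrier
  π = ι (+ p)

  open EulerPolynomials 𝔸 prime-p (sgn-odd (suc (suc m)) p′≡) p∤2

  4^p′-multiple : Multiple p ((+ 4) Z.^ p′ ℤ.- + 1)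
  4^p′-multiple = congruent ((+ 4) Z.^ p′) (+ 1)
    (F.trans (FH.ι-^ (+ 4) p′) (F.trans (F.^-cong p′ (F.sym (F.ν≈ι 4))) (FC.fermat p∤4)))

  4^k-Y : ι (+ 4) ^ k * Y k ≈ ι eulerSum
  4^k-Y = begin
    ι (+ 4) ^ k * Y k
      ≈⟨ ∑-*ˡ p _ _ ⟨
    ∑ p (λ j → ι (+ 4) ^ k * (ι (sgn j) * (x + ν j) ^ k))
      ≈⟨ ∑-cong p (λ j _ → begin
           ι (+ 4) ^ k * (ι (sgn j) * (x + ν j) ^ k)
             ≈⟨ solve 3 (λ a s y → a :* (s :* y) := s :* (a :* y)) refl _ _ _ ⟩
           ι (sgn j) * (ι (+ 4) ^ k * (x + ν j) ^ k)
             ≈⟨ *-congˡ (*-^ _ _ k) ⟨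
           ι (sgn j) * (ι (+ 4) * (x + ν j)) ^ k
             ≈⟨ *-congˡ (^-cong k (begin
                  ι (+ 4) * (x + ν j)
                    ≈⟨ solve 2 (λ x j → :n 4 :* (x :+ j) := :n 4 :* x :+ :n 4 :* j) refl x (ν j) ⟩
                  ι (+ 4) * x + ι (+ 4) * ν j
                    ≈⟨ +-cong (trans 4x≈1 (sym (ν≈ι 1))) (trans (*-congʳ (sym (ν≈ι 4))) (sym (ν-* 4 j))) ⟩
                  ν 1 + ν (4 ℕ.* j)
                    ≈⟨ ν-+ 1 (4 ℕ.* j) ⟨
                  ν (u j)
                    ≈⟨ ν≈ι (u j) ⟩
                  ι (+ u j) ∎)) ⟩
           ι (sgn j) * ι (+ u j) ^ k
             ≈⟨ trans (ι-* (sgn j) _) (*-congˡ (ι-^ (+ u j) k)) ⟨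
           ι (sgn j ℤ.* (+ u j) Z.^ k) ∎) ⟩
    ∑ p (λ j → ι (sgn j ℤ.* (+ u j) Z.^ k))
      ≈⟨ ι-∑ p _ ⟨
    ι eulerSum ∎

  -- `eulerSum` is 4^(p-3) Y, hence 4^(p-3) E modulo p, and 16 · 4^(p-3) = 4^(p-1) is 1: this is
  -- where the 1/16 of the theorem comes from.
  E/16 : 𝔪 (sixteenth * E k - ι eulerSum)
  E/16 = 𝔪-resp (begin
    sixteenth * E k - ι eulerSum
      ≈⟨ -‿cong₂ refl (trans (sym 4^k-Y) (trans (solve 1 (λ y → y := :n 1 :* y) refl _) (*-congʳ (sym 16s≈1)))) ⟩
    sixteenth * E k - ι (+ 16) * sixteenth * (w * Y k)
      ≈⟨ solve 4 (λ s e w y → s :* e :- :n 16 :* s :* (w :* y)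
           := s :* (:n 16 :* (w :* (e :- y)) :+ :- (e :* (:n 4 :* (:n 4 :* w) :- :n 1)))) refl sixteenth (E k) w (Y k) ⟩
    sixteenth * (ι (+ 16) * (w * (E k - Y k)) + - (E k * (ι (+ 4) * (ι (+ 4) * w) - ι (+ 1))))
      ≈⟨ *-congˡ (+-congˡ (-‿cong (*-congˡ (+-congʳ (reflexive (≡.cong (ι (+ 4) ^_) (≡.sym p′≡2+k))))))) ⟩
    sixteenth * (ι (+ 16) * (w * (E k - Y k)) + - (E k * (ι (+ 4) ^ p′ - ι (+ 1))))
      ≈⟨ *-congˡ (+-congˡ (-‿cong (*-congˡ (trans (+-congʳ (sym (ι-^ (+ 4) p′))) (sym (ι-∸ _ (+ 1))))))) ⟩
    sixteenth * (ι (+ 16) * (w * (E k - Y k)) + - (E k * ι ((+ 4) Z.^ p′ ℤ.- + 1))) ∎)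
    (𝔪-*ˡ (𝒪-inverse (∤-* prime-p p∤4 p∤4) 16s≈1)
      (𝔪-+ (𝔪-*ˡ (𝒪-ι (+ 16)) (𝔪-*ˡ (𝒪-^ k (𝒪-ι (+ 4))) (E≡Y k)))
           (𝔪-neg (𝔪-*ˡ (𝒪-E k) (𝔪-multiple 4^p′-multiple)))))
    where w = ι (+ 4) ^ k

  p∤D₀ : p ∤ ℤ.∣ D₀ ∣
  p∤D₀ p∣D₀ = prime∤1 prime-p (multiple⇒∣ {p} {+ 1} (b ℤ.- a , (Z.begin
    + 1                    Z.≡⟨ Z.solve 1 (λ d → Z.:n 1 Z.:= d Z.:+ Z.:n 1 Z.:- d) ≡.refl D₀ ⟩
    D₀ ℤ.+ + 1 ℤ.- D₀      Z.≡⟨ ≡.cong₂ ℤ._-_ b≡ a≡ ⟩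
    b ℤ.* + p ℤ.- a ℤ.* + p Z.≡⟨ Z.solve 3 (λ a b p → b Z.:* p Z.:- a Z.:* p Z.:= (b Z.:- a) Z.:* p) ≡.refl a b (+ p) ⟩
    (b ℤ.- a) ℤ.* + p Z.∎)))
    where
    a = proj₁ (∣⇒multiple {p} {D₀} p∣D₀)
    a≡ = proj₂ (∣⇒multiple {p} {D₀} p∣D₀)
    b = proj₁ D₀-multiple
    b≡ = proj₂ D₀-multiple

  D₀≢0 : D₀ ≢ + 0
  D₀≢0 eq = p∤D₀ (≡.subst (λ z → p ∣ ℤ.∣ z ∣) (≡.sym eq) (divides 0 ≡.refl))

  ι-p^ : ∀ n → ι (+ (p ℕ.^ n)) ≈ π ^ n
  ι-p^ zero    = refl
  ι-p^ (suc n) = trans (reflexive (≡.cong ι (ℤₚ.pos-* p (p ℕ.^ n)))) (trans (ι-* _ _) (*-congˡ (ι-p^ n)))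

  -- The sum times D₀ is exactly `P (+ 0) p`. Since D₀ is prime to p, dividing `P-evaluation` by it
  -- keeps the error in p⁴ `𝒪`; `E/16` then replaces `eulerSum` at the cost of another multiple of
  -- p³ · p.
  conclusion : Σ Carrier λ y → 𝒪 y ×
    ∑ p term - (π * ι (sgn l) + ι (+ (p ℕ.^ 3)) * sixteenth * E k) ≈ ι (+ (p ℕ.^ 4)) * y
  conclusion = ι w * D⁻¹ + - z , 𝒪-+ (𝒪-* (𝒪-ι w) (𝒪-inverse p∤D₀ D⁻¹≈)) (𝒪-neg Oz) , (begin
    S - (π * σ + ι (+ (p ℕ.^ 3)) * sixteenth * E k)
      ≈⟨ +-cong S≈ (-‿cong (+-congˡ (*-congʳ (*-congʳ (ι-p^ 3))))) ⟩
    t + π⁴ * ι w * D⁻¹ - (π * σ + π ^ 3 * sixteenth * E k)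
      ≈⟨ solve 7 (λ p s e y w h E →
           s :* p :+ p :* p :* p :* e :+ p :* p :* p :* p :* w :* y
             :- (p :* s :+ p :* (p :* (p :* :n 1)) :* h :* E)
           := p :* p :* p :* p :* (w :* y) :- p :* p :* p :* (h :* E :- e))
           refl π σ (ι eulerSum) D⁻¹ (ι w) sixteenth (E k) ⟩
    π⁴ * (ι w * D⁻¹) - π * π * π * (sixteenth * E k - ι eulerSum)
      ≈⟨ +-congˡ (-‿cong (*-congˡ E/16≈)) ⟩
    π⁴ * (ι w * D⁻¹) - π * π * π * (π * z)
      ≈⟨ solve 3 (λ p a z → p :* p :* p :* p :* a :- p :* p :* p :* (p :* z)
           := p :* (p :* (p :* (p :* :n 1))) :* (a :+ :- z)) refl π _ z ⟩
    π ^ 4 * (ι w * D⁻¹ + - z)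
      ≈⟨ *-congʳ (ι-p^ 4) ⟨
    ι (+ (p ℕ.^ 4)) * (ι w * D⁻¹ + - z) ∎)
    where
    S = ∑ p term
    σ = ι (sgn l)
    w = proj₁ P-evaluation
    D⁻¹ = proj₁ (inverse D₀ D₀≢0)
    D⁻¹≈ = proj₂ (inverse D₀ D₀≢0)
    z = proj₁ E/16
    Oz = proj₁ (proj₂ E/16)
    E/16≈ = proj₂ (proj₂ E/16)
    π⁴ = π * π * π * π
    t = σ * π + π * π * π * ι eulerSum
    SD≈ : S * ι D₀ ≈ ι D₀ * t + π⁴ * ι w
    SD≈ = begin
      S * ι D₀
        ≈⟨ partialSum p′ ⟩
      ι (Z.P (+ 0) p)
        ≡⟨ ≡.cong ι (proj₂ P-evaluation) ⟩
      ι (D₀ ℤ.* (sgn l ℤ.* + p ℤ.+ + p ℤ.* + p ℤ.* + p ℤ.* eulerSum) ℤ.+ + p ℤ.* + p ℤ.* + p ℤ.* + p ℤ.* w)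
        ≈⟨ trans (ι-+ _ _) (+-cong
             (trans (ι-* D₀ _) (*-congˡ (trans (ι-+ _ _) (+-cong (ι-* (sgn l) (+ p))
               (trans (ι-* _ eulerSum) (*-congʳ (trans (ι-* _ (+ p)) (*-congʳ (ι-* (+ p) (+ p))))))))))
             (trans (ι-* _ w) (*-congʳ (trans (ι-* _ (+ p)) (*-congʳ (trans (ι-* _ (+ p)) (*-congʳ (ι-* (+ p) (+ p))))))))) ⟩
      ι D₀ * t + π⁴ * ι w ∎
    S≈ : S ≈ t + π⁴ * ι w * D⁻¹
    S≈ = begin
      S
        ≈⟨ solve 1 (λ s → s := s :* :n 1) refl S ⟩
      S * ι (+ 1)
        ≈⟨ *-congˡ (sym D⁻¹≈) ⟩
      S * (ι D₀ * D⁻¹)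
        ≈⟨ solve 3 (λ s d y → s :* (d :* y) := s :* d :* y) refl S (ι D₀) D⁻¹ ⟩
      S * ι D₀ * D⁻¹
        ≈⟨ *-congʳ SD≈ ⟩
      (ι D₀ * t + π⁴ * ι w) * D⁻¹
        ≈⟨ solve 4 (λ d t a y → (d :* t :+ a) :* y := (d :* y) :* t :+ a :* y) refl (ι D₀) t (π⁴ * ι w) D⁻¹ ⟩
      (ι D₀ * D⁻¹) * t + π⁴ * ι w * D⁻¹
        ≈⟨ +-congʳ (trans (*-congʳ D⁻¹≈) (solve 1 (λ t → :n 1 :* t := t) refl t)) ⟩
      t + π⁴ * ι w * D⁻¹ ∎

-- The rational numbers as an instance

open import Data.Rational using (_+_; _*_)

integerᵘ : ∀ z → toℚᵘ (z / 1) ≃ᵘ mkℚᵘ z 0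
integerᵘ z = ℚₚ.toℚᵘ-fromℚᵘ (mkℚᵘ z 0)

integer-+ : ∀ a b → (a ℤ.+ b) / 1 ≡ a / 1 + b / 1
integer-+ a b = ℚₚ.toℚᵘ-injective (begin
  toℚᵘ ((a ℤ.+ b) / 1)          ≈⟨ integerᵘ (a ℤ.+ b) ⟩
  mkℚᵘ (a ℤ.+ b) 0              ≈⟨ *≡* (≡.cong₂ (λ x y → (x ℤ.+ y) ℤ.* + 1) (≡.sym (ℤₚ.*-identityʳ a)) (≡.sym (ℤₚ.*-identityʳ b))) ⟩
  mkℚᵘ a 0 ℚᵘ.+ mkℚᵘ b 0        ≈⟨ ℚᵘₚ.+-cong (integerᵘ a) (integerᵘ b) ⟨
  toℚᵘ (a / 1) ℚᵘ.+ toℚᵘ (b / 1) ≈⟨ ℚₚ.toℚᵘ-homo-+ (a / 1) (b / 1) ⟨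
  toℚᵘ (a / 1 + b / 1) ∎)
  where open ℚᵘₚ.≃-Reasoning

integer-* : ∀ a b → (a ℤ.* b) / 1 ≡ a / 1 * (b / 1)
integer-* a b = ℚₚ.toℚᵘ-injective (begin
  toℚᵘ ((a ℤ.* b) / 1)          ≈⟨ integerᵘ (a ℤ.* b) ⟩
  mkℚᵘ (a ℤ.* b) 0              ≈⟨ *≡* ≡.refl ⟩
  mkℚᵘ a 0 ℚᵘ.* mkℚᵘ b 0        ≈⟨ ℚᵘₚ.*-cong (integerᵘ a) (integerᵘ b) ⟨
  toℚᵘ (a / 1) ℚᵘ.* toℚᵘ (b / 1) ≈⟨ ℚₚ.toℚᵘ-homo-* (a / 1) (b / 1) ⟨
  toℚᵘ (a / 1 * (b / 1)) ∎)
  where open ℚᵘₚ.≃-Reasoning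

integer-neg : ∀ a → (ℤ.- a) / 1 ≡ ℚ.- (a / 1)
integer-neg a = ℚₚ.toℚᵘ-injective (begin
  toℚᵘ ((ℤ.- a) / 1)   ≈⟨ integerᵘ (ℤ.- a) ⟩
  ℚᵘ.- mkℚᵘ a 0        ≈⟨ ℚᵘₚ.-‿cong (integerᵘ a) ⟨
  ℚᵘ.- toℚᵘ (a / 1)    ≈⟨ ℚₚ.toℚᵘ-homo‿- (a / 1) ⟨
  toℚᵘ (ℚ.- (a / 1)) ∎)
  where open ℚᵘₚ.≃-Reasoning

integer-injective : ∀ a b → a / 1 ≡ b / 1 → a ≡ b
integer-injective a b a≡b with ℚᵘₚ.≃-trans (ℚᵘₚ.≃-sym (integerᵘ a))
                                (ℚᵘₚ.≃-trans (ℚₚ.toℚᵘ-cong a≡b) (integerᵘ b))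
... | *≡* a*1≡b*1 = ≡.trans (≡.sym (ℤₚ.*-identityʳ a)) (≡.trans a*1≡b*1 (ℤₚ.*-identityʳ b))

ℚ-algebra : ℤ-Algebra
ℚ-algebra = record
  { commutativeRing = ℚₚ.+-*-commutativeRing
  ; ι = λ z → z / 1
  ; ι-+ = integer-+ ; ι-* = integer-* ; ι-neg = integer-neg
  ; ι-0 = ≡.refl ; ι-1 = ≡.refl }

ℚ-inverse : ∀ z → z ≢ + 0 → Σ ℚ λ y → z / 1 * y ≡ + 1 / 1
ℚ-inverse z z≢0 = ℚ.1/_ (z / 1) {{nonZero}} , ℚₚ.*-inverseʳ (z / 1) {{nonZero}}
  where
  nonZero : ℚ.NonZero (z / 1)
  nonZero = ℚ.≢-nonZero (λ z/1≡0 → z≢0 (integer-injective z (+ 0) z/1≡0))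

module ℚ-Sums where
  open Over ℚ-algebra using (∑; _^_)

  ^ℚ≡^ : ∀ x n → x ^ℚ n ≡ x ^ n
  ^ℚ≡^ x zero    = ≡.refl
  ^ℚ≡^ x (suc n) = ≡.cong (x *_) (^ℚ≡^ x n)

  sumTo≡∑ : ∀ n {f g} → (∀ i → i < n → f i ≡ g i) → sumTo n f ≡ ∑ n g
  sumTo≡∑ zero    h = ≡.refl
  sumTo≡∑ (suc n) h = ≡.cong₂ _+_ (sumTo≡∑ n (λ i i<n → h i (ℕₚ.m<n⇒m<1+n i<n))) (h n ℕₚ.≤-refl)

  eulerUpTo-diagonal : ∀ x m → eulerUpTo x (suc m) m ≡
    x ^ℚ m ℚ.- (+ 1 / 2) * sumTo m (λ j → ℕ→ℚ (m C j) * eulerUpTo x m j)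
  eulerUpTo-diagonal x m with m ℕ.≟ m
  ... | yes _  = ≡.refl
  ... | no m≢m = contradiction ≡.refl m≢m

  eulerUpTo-below : ∀ x m k → k ≢ m → eulerUpTo x (suc m) k ≡ eulerUpTo x m k
  eulerUpTo-below x m k k≢m with k ℕ.≟ m
  ... | yes k≡m = contradiction k≡m k≢m
  ... | no _    = ≡.refl

  eulerUpTo≡EulerPoly : ∀ x m k → k < m → eulerUpTo x m k ≡ EulerPoly k x
  eulerUpTo≡EulerPoly x (suc m) k k<1+m with ℕₚ.m≤n⇒m<n∨m≡n (ℕₚ.≤-pred k<1+m)
  ... | inj₁ k<m    = ≡.trans (eulerUpTo-below x m k (ℕₚ.<⇒≢ k<m)) (eulerUpTo≡EulerPoly x m k k<m)
  ... | inj₂ ≡.refl = ≡.refl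

  EulerPoly-rec : ∀ x n → EulerPoly n x ≡
    x ^ n ℚ.- (+ 1 / 2) * ∑ n (λ j → (+ (n C j)) / 1 * EulerPoly j x)
  EulerPoly-rec x n = ≡.trans (eulerUpTo-diagonal x n) (≡.cong₂ (λ a b → a ℚ.- (+ 1 / 2) * b) (^ℚ≡^ x n)
    (sumTo≡∑ n (λ j j<n → ≡.cong (λ y → ℕ→ℚ (n C j) * y) (eulerUpTo≡EulerPoly x n j j<n))))

rationals : RationalSetting
rationals = record
  { algebra = ℚ-algebra ; inverse = ℚ-inverse
  ; r = -[1+ 0 ] / 512 ; half = + 1 / 2 ; x = + 1 / 4 ; sixteenth = + 1 / 16
  ; 512r≈-1 = ≡.refl ; 2half≈1 = ≡.refl ; 4x≈1 = ≡.refl ; 16s≈1 = ≡.refl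
  ; E = λ n → EulerPoly n (+ 1 / 4) ; E-rec = ℚ-Sums.EulerPoly-rec (+ 1 / 4) }

-- The reduced denominator is coprime to the numerator, so it divides every d that clears c, in
-- particular one prime to p.
integral⇒coprime : ∀ {p} → Prime p → ∀ d z c → p ∤ d → + d / 1 * c ≡ z / 1 → Coprime (ℚ.↧ₙ c) p
integral⇒coprime {p} prime-p d z c@(mkℚ n D-1 n⊥D) p∤d dc≡z {i} (i∣D , i∣p)
    with prime⇒irreducible prime-p i∣p
... | inj₁ i≡1    = i≡1
... | inj₂ ≡.refl = contradiction (∣-trans i∣D D∣d) p∤d
  where
  cross : (+ d ℤ.* n) ℤ.* + 1 ≡ z ℤ.* (+ 1 ℤ.* + suc D-1)
  cross with ℚᵘₚ.≃-trans (ℚᵘₚ.*-congʳ (ℚᵘₚ.≃-sym (integerᵘ (+ d))))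
               (ℚᵘₚ.≃-trans (ℚᵘₚ.≃-sym (ℚₚ.toℚᵘ-homo-* (+ d / 1) c))
                 (ℚᵘₚ.≃-trans (ℚₚ.toℚᵘ-cong dc≡z) (integerᵘ z)))
  ... | *≡* eq = eq
  D∣nd : suc D-1 ∣ ℤ.∣ n ∣ ℕ.* d
  D∣nd = divides ℤ.∣ z ∣ (≡.trans (ℕₚ.*-comm ℤ.∣ n ∣ d) (≡.trans (≡.sym (ℤₚ.abs-* (+ d) n))
    (≡.trans (≡.cong ℤ.∣_∣ (≡.trans (≡.sym (ℤₚ.*-identityʳ (+ d ℤ.* n)))
      (≡.trans cross (≡.cong (z ℤ.*_) (ℤₚ.*-identityˡ (+ suc D-1)))))) (ℤₚ.abs-* z (+ suc D-1)))))
  D∣d : suc D-1 ∣ d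
  D∣d = coprime-divisor (Coprimality.sym (Coprimality.recompute n⊥D)) D∣nd

-- The cases of p modulo 4 and the theorem

-- The first equation says that p is odd and at least 5, with (p-1)/2 = m+2; the second that l is
-- the integer part of p/4.
data Shape : ℕ → Set where
  shape : ∀ p′ m l → p′ ≡ suc (suc m) ℕ.+ suc (suc m) → p′ ≡ 4 ℕ.* l ⊎ p′ ≡ 2 ℕ.+ 4 ℕ.* l →
    Shape (suc p′)

prime-shape : ∀ p → Prime p → 3 < p → Shape p
prime-shape p prime-p 3<p = go (p % 4) (p ℕ./ 4) (m%n<n p 4) (m≡m%n+[m/n]*n p 4)
  where
  2∤p : 2 ∤ p
  2∤p 2∣p with prime⇒irreducible prime-p 2∣p
  ... | inj₂ ≡.refl = ℕₚ.<⇒≱ 3<p (s≤s (s≤s z≤n))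
  even : ∀ q → 2 ℕ.+ q ℕ.* 4 ≡ (1 ℕ.+ q ℕ.* 2) ℕ.* 2
  even = ℕ-solver.solve-∀
  one : ∀ q → 1 ℕ.+ suc q ℕ.* 4 ≡ suc (4 ℕ.* suc q)
  one = ℕ-solver.solve-∀
  three : ∀ q → 3 ℕ.+ suc q ℕ.* 4 ≡ suc (2 ℕ.+ 4 ℕ.* suc q)
  three = ℕ-solver.solve-∀
  half₁ : ∀ q → 4 ℕ.* suc q ≡ suc (suc (q ℕ.+ q)) ℕ.+ suc (suc (q ℕ.+ q))
  half₁ = ℕ-solver.solve-∀
  half₃ : ∀ q → 2 ℕ.+ 4 ℕ.* suc q ≡ suc (suc (suc (q ℕ.+ q))) ℕ.+ suc (suc (suc (q ℕ.+ q)))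
  half₃ = ℕ-solver.solve-∀
  go : ∀ r q → r < 4 → p ≡ r ℕ.+ q ℕ.* 4 → Shape p
  go 0 q _ p≡ = contradiction (divides (q ℕ.* 2) (≡.trans p≡ (≡.sym (ℕₚ.*-assoc q 2 2)))) 2∤p
  go 1 zero    _ p≡ = contradiction (≡.subst (3 <_) p≡ 3<p) (λ { (s≤s ()) })
  go 1 (suc q) _ p≡ = ≡.subst Shape (≡.sym (≡.trans p≡ (one q)))
    (shape (4 ℕ.* suc q) (q ℕ.+ q) (suc q) (half₁ q) (inj₁ ≡.refl))
  go 2 q _ p≡ = contradiction (divides (1 ℕ.+ q ℕ.* 2) (≡.trans p≡ (even q))) 2∤p
  go 3 zero    _ p≡ = contradiction (≡.subst (3 <_) p≡ 3<p) (λ { (s≤s (s≤s (s≤s ()))) })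
  go 3 (suc q) _ p≡ = ≡.subst Shape (≡.sym (≡.trans p≡ (three q)))
    (shape (2 ℕ.+ 4 ℕ.* suc q) (suc (q ℕ.+ q)) (suc q) (half₃ q) (inj₂ ≡.refl))
  go (suc (suc (suc (suc _)))) _ (s≤s (s≤s (s≤s (s≤s ())))) _

theorem1p3 : (p : ℕ) → Prime p → 3 < p →
    CongModIn p (ℕ→ℚ (p ℕ.^ 4))
    (sumTo p (λ n → ℕ→ℚ (6 ℕ.* n ℕ.+ 1) * (ℕ→ℚ ((2 ℕ.* n) C n) ^ℚ 3) * ((-[1+ 0 ] / 512) ^ℚ n)))
    (ℕ→ℚ p * (legendre -[1+ 1 ] p / 1) + (ℕ→ℚ (p ℕ.^ 3) * ((+ 1) / 16)) * EulerPoly (p ∸ 3) ((+ 1) / 4))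
theorem1p3 p prime-p 3<p with prime-shape p prime-p 3<p
... | shape p′ m l p′≡ p′≡l = y , integral⇒coprime prime-p d z y p∤d dy≡z , (begin
    sumTo p summand ℚ.- (ℕ→ℚ p * (legendre -[1+ 1 ] p / 1) + (ℕ→ℚ (p ℕ.^ 3) * (+ 1 / 16)) * EulerPoly (p ∸ 3) (+ 1 / 4))
      ≡⟨ ≡.cong₂ ℚ._-_ sum≡ (≡.cong₂ (λ s k → ℕ→ℚ p * (s / 1) + (ℕ→ℚ (p ℕ.^ 3) * (+ 1 / 16)) * EulerPoly k (+ 1 / 4))
           -- The index `p ∸ 3` computes to `p′ ∸ 2`.
           legendre≡ (≡.cong (_∸ 2) p′≡2+k)) ⟩
    ∑ p term ℚ.- (ℕ→ℚ p * (sgn l / 1) + (ℕ→ℚ (p ℕ.^ 3) * (+ 1 / 16)) * EulerPoly k (+ 1 / 4))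
      ≡⟨ proj₂ (proj₂ conclusion) ⟩
    ℕ→ℚ (p ℕ.^ 4) * y ∎)
  where
  open ≡.≡-Reasoning
  open Over ℚ-algebra using (∑; ν≈ι)
  open ℚ-Sums
  open PartialSum rationals using (term)
  open Conclusion prime-p m p′≡ l p′≡l (residues p) (cubicResidues p) rationals using (conclusion)
  k = suc m ℕ.+ suc m
  p′≡2+k : p′ ≡ suc (suc k)
  p′≡2+k = ≡.trans p′≡ (≡.cong (λ j → suc (suc j)) (ℕₚ.+-suc m (suc m)))
  y = proj₁ conclusion
  d = proj₁ (proj₁ (proj₂ conclusion))
  p∤d = proj₁ (proj₂ (proj₁ (proj₂ conclusion)))
  z = proj₁ (proj₂ (proj₂ (proj₁ (proj₂ conclusion))))
  dy≡z : + d / 1 * y ≡ z / 1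
  dy≡z = ≡.trans (≡.cong (_* y) (≡.sym (ν≈ι d))) (proj₂ (proj₂ (proj₂ (proj₁ (proj₂ conclusion)))))
  summand : ℕ → ℚ
  summand n = ℕ→ℚ (6 ℕ.* n ℕ.+ 1) * (ℕ→ℚ ((2 ℕ.* n) C n) ^ℚ 3) * ((-[1+ 0 ] / 512) ^ℚ n)
  sum≡ : sumTo p summand ≡ ∑ p term
  sum≡ = sumTo≡∑ p (λ n _ → ≡.cong₂ (λ a b → ℕ→ℚ (6 ℕ.* n ℕ.+ 1) * a * b)
    (^ℚ≡^ (ℕ→ℚ ((2 ℕ.* n) C n)) 3) (^ℚ≡^ (-[1+ 0 ] / 512) n))
  legendre≡ : legendre -[1+ 1 ] p ≡ sgn l
  legendre≡ = QuadraticResidue.legendre-2 prime-p m p′≡ l p′≡l (residues p) (cubicResidues p)
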